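{- For all integers $n\ge 0$ and $\alpha\ge 0$, \begin{align*} v_0(2^{2\alpha+1}(2n+1)) &\equiv 0 \pmod{2^{3\alpha}},\\ v_0(2^{2\alpha+2}(4n+3)) &\equiv 0 \pmod{2^{3\alpha+4}},\\ v_0(2^{2\alpha+2}(8n+7)) &\equiv 0 \pmod{2^{3\alpha+6}},\\ v_0(2^{2\alpha+2}(8n+5)) &\equiv 0 \pmod{2^{3\alpha+6}}. \end{align*}
   Context: The integer sequence $v_0(n)$, $n\ge 0$, is defined by the generating function (formal power series in $q$) $$\sum_{n=0}^\infty v_0(n)q^n=\sum_{n=0}^\infty \frac{q^{n^2}(-q;q^2)_n}{(q;q^2)_n},$$ where $(a;q)_0=1$ and $(a;q)_n=\prod_{i=1}^n(1-aq^{i-1})$ for $n\ge1$, so that $(-q;q^2)_n=\prod_{i=1}^n(1+q^{2i-1})$ and $(q;q^2)_n=\prod_{i=1}^n(1-q^{2i-1})$. -}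

module Defs where

open import Data.Fin using (Fin; zero; suc; toℕ)
open import Data.Integer as ℤ using (ℤ; 0ℤ; 1ℤ)
open import Data.Integer.Properties as ℤₚ using (+-0-commutativeMonoid)
open import Data.Nat as ℕ using (ℕ; zero; suc; _∸_)
open import Data.Vec using (Vec; []; _∷_; head; lookup)
open import Function using (_∘_)
open import Relation.Binary.PropositionalEquality

open import Algebra.Properties.CommutativeMonoid.Sum +-0-commutativeMonoid public
  using (sum; sum-cong-≗; sum-syntax)

infixl 6 _⊕_ _⊖_
infixl 7 _⊛_
infix  8 ⊝_
infixr 9 _^ˢ_
infix  10 _⁻¹

-- Formal power series over ℤ, as coefficient sequences; equality of series is
-- pointwise equality _≗_.
Series : Set
Series = ℕ → ℤ

𝟙 : Series
𝟙 zero    = 1ℤ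
𝟙 (suc _) = 0ℤ

q : Series
q zero          = 0ℤ
q (suc zero)    = 1ℤ
q (suc (suc _)) = 0ℤ

_⊕_ : Series → Series → Series
(f ⊕ g) n = f n ℤ.+ g n

⊝_ : Series → Series
(⊝ f) n = ℤ.- f n

_⊖_ : Series → Series → Series
f ⊖ g = f ⊕ ⊝ g

_⊛_ : Series → Series → Series
(f ⊛ g) n = ∑[ i < suc n ] (f (toℕ i) ℤ.* g (n ∸ toℕ i))

_^ˢ_ : Series → ℕ → Series
f ^ˢ zero  = 𝟙
f ^ˢ suc n = f ⊛ f ^ˢ n

-- The multiplicative inverse h of a series f with constant term 1 is determined by
-- h₀ = 1 and hₙ₊₁ = - (f₁ hₙ + f₂ hₙ₋₁ + ⋯ + fₙ₊₁ h₀).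
-- inverseCoeffs f n lists hₙ, hₙ₋₁, …, h₀ in this order.
-- The constant term of f is never inspected: see ⊛-inverse for the hypothesis.
inverseCoeffs : Series → (n : ℕ) → Vec ℤ (suc n)
inverseCoeffs f zero    = 1ℤ ∷ []
inverseCoeffs f (suc n) =
  ℤ.- (∑[ i < suc n ] (f (suc (toℕ i)) ℤ.* lookup (inverseCoeffs f n) i))
  ∷ inverseCoeffs f n

_⁻¹ : Series → Series
(f ⁻¹) n = head (inverseCoeffs f n)

-- qPochhammer a b n is (a; b)ₙ = ∏_{i=1}^{n} (1 - a b^{i-1}).
qPochhammer : Series → Series → ℕ → Series
qPochhammer a b zero    = 𝟙
qPochhammer a b (suc n) = qPochhammer a b n ⊛ (𝟙 ⊖ a ⊛ b ^ˢ n)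

v₀-term : ℕ → Series
v₀-term n =
  q ^ˢ (n ℕ.* n) ⊛ qPochhammer (⊝ q) (q ^ˢ 2) n ⊛ qPochhammer q (q ^ˢ 2) n ⁻¹

-- v₀-term n is divisible by q^(n²), so only the indices n ≤ m can contribute to the
-- coefficient of q^m in the infinite sum of the v₀-term n.
v₀ : ℕ → ℤ
v₀ m = ∑[ n < suc m ] v₀-term (toℕ n) m

lookup-inverseCoeffs : ∀ f n (i : Fin (suc n)) →
                       lookup (inverseCoeffs f n) i ≡ (f ⁻¹) (n ∸ toℕ i)
lookup-inverseCoeffs f zero    zero    = refl
lookup-inverseCoeffs f (suc n) zero    = refl
lookup-inverseCoeffs f (suc n) (suc i) = lookup-inverseCoeffs f n i

⊛-inverse : ∀ f → f 0 ≡ 1ℤ → f ⊛ f ⁻¹ ≗ 𝟙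
⊛-inverse f f₀≡1 zero    rewrite f₀≡1 = refl
⊛-inverse f f₀≡1 (suc n) = begin
  f 0 ℤ.* ℤ.- s ℤ.+ t    ≡⟨ cong (λ x → x ℤ.* ℤ.- s ℤ.+ t) f₀≡1 ⟩
  1ℤ ℤ.* ℤ.- s ℤ.+ t     ≡⟨ cong (ℤ._+ t) (ℤₚ.*-identityˡ (ℤ.- s)) ⟩
  ℤ.- s ℤ.+ t            ≡⟨ cong (λ x → ℤ.- s ℤ.+ x) t≡s ⟩
  ℤ.- s ℤ.+ s            ≡⟨ ℤₚ.+-inverseˡ s ⟩
  0ℤ                     ∎
  where
  open ≡-Reasoning
  s t : ℤ
  s = ∑[ i < suc n ] (f (suc (toℕ i)) ℤ.* lookup (inverseCoeffs f n) i)
  t = ∑[ i < suc n ] (f (suc (toℕ i)) ℤ.* (f ⁻¹) (n ∸ toℕ i))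
  t≡s : t ≡ s
  t≡s = sum-cong-≗ {suc n} λ i →
    cong (f (suc (toℕ i)) ℤ.*_) (sym (lookup-inverseCoeffs f n i))

-- Hence the inverse taken in v₀-term is a genuine one.
denominator-constant : ∀ b n → qPochhammer q b n 0 ≡ 1ℤ
denominator-constant b zero    = refl
denominator-constant b (suc n) rewrite denominator-constant b n = refl

{-# OPTIONS --safe #-}
-- Put tₙ(w) = q^(n²) ∏_{i=1}^{n} (w + q^(2i-1)) / (1 - w q^(2i-1)), g(w) = Σₙ tₙ(w) and
-- G(w) = g(w) + g(-w) - 1. With Rₙ = w tₙ(w) / (w + q^(2n-1)),
--   (1 + q²w²) tₙ(q²w) - (1 - q²w²) tₙ(w) = (1 - q²w²) (Rₙ₊₁ - Rₙ),
-- so (1 + q²w²) G(q²w) = (1 - q²w²) G(w), while G(q^(2k) w) → φ(q²) for φ(q) = Σ_{n∈ℤ} q^(n²).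
-- At w = 1, G(1) is twice the even part of Σ v₀(n) qⁿ, minus 1; at w = i the fractions cancel and
-- G(i) = φ(-q⁴). The two infinite products that arise are inverse to each other, whence
--   2 Σ v₀(2n) qⁿ - 1 = φ(q)² / φ(-q²)   and   φ(q) φ(-q) = φ(-q²)².
-- The latter implies φ(q)² + φ(-q)² = 2 φ(q²)², so W = 2 Σ v₀(4n) qⁿ - 1 = φ(q)² / φ(-q).
--
-- Let U₄ keep every fourth coefficient, y = φ(q)⁴ / φ(-q)⁴ and X = y - 1, which is 0 modulo 16.
-- In terms of r = φ(q) / φ(q⁴) - 1, whose fourth power is 1 - 1 / y(q⁴), the series φ, W and φ X
-- are φ(q⁴) times polynomials in r, y(q⁴) and 1 / y(q⁴), and U₄ extracts the powers of r⁴. Hence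
-- U₄ W = φ + 4 φ X, and U₄ maps φ X ℤ[y, 1/y] into 8 φ X ℤ[y, 1/y]: each step gains a factor 8.
-- The remaining powers of 2 are read off from the expansion of φ X in r, as r ≡ 0 (mod 2), and φ
-- itself has no coefficients in the residue classes of the theorem.
--
-- Notation: D f = f(q²), σ f = f(-q), U f = Σ f₂ₙ qⁿ, φ̄ = σ φ, ψ = Σ_{n≥0} q^(n(n+1)/2).
module Submission where

open import Algebra using (CommutativeRing)
open import Algebra.Morphism.Construct.Composition using (isRingHomomorphism)
open import Algebra.Morphism.Structures using (module RingMorphisms)
open import Algebra.Solver.Ring.AlmostCommutativeRing
  using (fromCommutativeRing; _-Raw-AlmostCommutative⟶_)
open import Algebra.Structures using (IsCommutativeRing)
open import Data.Fin using (toℕ)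
open import Data.Integer as ℤ using (ℤ; +_; -[1+_]; 0ℤ; 1ℤ)
open import Data.Integer.Divisibility using (_∣_)
import Data.Integer.Divisibility.Signed as Signed
import Data.Integer.Properties as ℤₚ
import Data.Integer.Solver as ℤ-Solver
open import Data.Maybe.Base using (Maybe; just; nothing)
open import Data.Nat as ℕ using (ℕ; zero; suc; _<_; _≤_; s≤s; z≤n)
import Data.Nat.Divisibility as ℕ∣
import Data.Nat.Properties as ℕₚ
import Data.Nat.Solver as ℕ-Solver
open import Data.Product using (_,_; _×_; ∃; proj₁)
import Data.Sign as Sign
open import Data.Sum using (inj₁; inj₂)
open import Defs
open import Function using (_∘_; case_of_)
open import Level using (0ℓ)
open import Relation.Binary.PropositionalEquality as P using (_≡_; _≗_)
open import Relation.Nullary using (yes; no)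

-- Solving ring equations with integer coefficients

-- No infinite product is formed. Partial sums are compared with finite products modulo a power of
-- q, the products are cancelled at that precision, and only then does the precision grow. The
-- functional equation is proved over an arbitrary commutative ring because it serves twice: over
-- ℤ[[q]], and over the Gaussian extension that contains i. In this way the product formula for φ
-- comes from the same telescoping sum as the one for v₀, without the Jacobi triple product.
--
-- The parameter r is θ₂/θ₃ at the nome q⁴, so r⁴ is the modular λ-function there. What makes U₄
-- computable is that r is q times a series in q⁴: the powers 1, r, r², r³ separate the residue
-- classes modulo 4, and r⁴ is again a series in q⁴.
--
-- As W carries 2 v₀(4n), one power of 2 is lost at the end, whence the moduli 16, 32, 128 for W in
-- place of 8, 16, 64. They come out because r / 2 = β / φ(q⁴), where β = q ψ(q⁸) has exponents 1
-- modulo 8: up to series in q⁴, the powers β², β³, β⁴ fall into the classes 2, 3, 0 modulo 4, and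
-- the powers of 2 that accompany them suffice there.

module IntegerSolver (R : CommutativeRing 0ℓ 0ℓ) where
  open CommutativeRing R
  open import Algebra.Properties.Semiring.Mult.TCOptimised semiring using (1+×; ×-homo-+; ×1-homo-*)
    renaming (_×_ to infixl 8 _·_)
  open import Algebra.Properties.Ring ring using (-‿distribˡ-*; -‿distribʳ-*; -0#≈0#; -‿involutive)
  open import Algebra.Properties.AbelianGroup +-abelianGroup using (⁻¹-∙-comm)
  open import Relation.Binary.Reasoning.Setoid setoid

  -- With the optimised multiple, `⟦ + 0 ⟧` and `⟦ + 1 ⟧` reduce to `0#` and `1#`, so constants in
  -- solver goals agree definitionally with the ring's own.
  ⟦_⟧ : ℤ → Carrier
  ⟦ + n      ⟧ = n · 1#
  ⟦ -[1+ n ] ⟧ = - (suc n · 1#)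

  ⟦⟧-⊖ : ∀ m n → ⟦ m ℤ.⊖ n ⟧ ≈ m · 1# - n · 1#
  ⟦⟧-⊖ zero    zero    = sym (-‿inverseʳ 0#)
  ⟦⟧-⊖ zero    (suc n) = sym (+-identityˡ _)
  ⟦⟧-⊖ (suc m) zero    = sym (trans (+-congˡ -0#≈0#) (+-identityʳ _))
  ⟦⟧-⊖ (suc m) (suc n) = begin
    ⟦ suc m ℤ.⊖ suc n ⟧                        ≡⟨ P.cong ⟦_⟧ (ℤₚ.[1+m]⊖[1+n]≡m⊖n m n) ⟩
    ⟦ m ℤ.⊖ n ⟧                                ≈⟨ ⟦⟧-⊖ m n ⟩
    m · 1# - n · 1#                          ≈⟨ +-congʳ (+-identityˡ _) ⟨
    0# + m · 1# - n · 1#                     ≈⟨ +-congʳ (+-congʳ (-‿inverseʳ 1#)) ⟨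
    1# - 1# + m · 1# - n · 1#                ≈⟨ +-congʳ (+-assoc _ _ _) ⟩
    1# + (- 1# + m · 1#) - n · 1#            ≈⟨ +-congʳ (+-congˡ (+-comm _ _)) ⟩
    1# + (m · 1# + - 1#) - n · 1#            ≈⟨ +-congʳ (+-assoc _ _ _) ⟨
    1# + m · 1# + - 1# - n · 1#              ≈⟨ +-assoc _ _ _ ⟩
    1# + m · 1# + (- 1# - n · 1#)            ≈⟨ +-cong (1+× m 1#)
      (trans (-‿cong (1+× n 1#)) (sym (⁻¹-∙-comm _ _))) ⟨
    suc m · 1# - suc n · 1#                  ∎

  ⟦⟧-neg : ∀ i → ⟦ ℤ.- i ⟧ ≈ - ⟦ i ⟧
  ⟦⟧-neg (+ zero)  = sym -0#≈0#
  ⟦⟧-neg (+ suc n) = refl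
  ⟦⟧-neg -[1+ n ]  = sym (-‿involutive _)

  ⟦⟧-+ : ∀ i j → ⟦ i ℤ.+ j ⟧ ≈ ⟦ i ⟧ + ⟦ j ⟧
  ⟦⟧-+ (+ m)    (+ n)    = ×-homo-+ 1# m n
  ⟦⟧-+ (+ m)    -[1+ n ] = ⟦⟧-⊖ m (suc n)
  ⟦⟧-+ -[1+ m ] (+ n)    = trans (⟦⟧-⊖ n (suc m)) (+-comm _ _)
  ⟦⟧-+ -[1+ m ] -[1+ n ] = begin
    - (suc (suc (m ℕ.+ n)) · 1#)        ≡⟨ P.cong (λ k → - (k · 1#)) (P.cong suc (ℕₚ.+-suc m n)) ⟨
    - ((suc m ℕ.+ suc n) · 1#)          ≈⟨ -‿cong (×-homo-+ 1# (suc m) (suc n)) ⟩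
    - (suc m · 1# + suc n · 1#)         ≈⟨ ⁻¹-∙-comm _ _ ⟨
    - (suc m · 1#) - suc n · 1#         ∎

  ⟦⟧-* : ∀ i j → ⟦ i ℤ.* j ⟧ ≈ ⟦ i ⟧ * ⟦ j ⟧
  ⟦⟧-* (+ m)    (+ n)    = trans (reflexive (P.cong ⟦_⟧ (ℤₚ.+◃n≡+n (m ℕ.* n)))) (×1-homo-* m n)
  ⟦⟧-* (+ m)    -[1+ n ] = begin
    ⟦ Sign.- ℤ.◃ m ℕ.* suc n ⟧          ≡⟨ P.cong ⟦_⟧ (ℤₚ.-◃n≡-n (m ℕ.* suc n)) ⟩
    ⟦ ℤ.- + (m ℕ.* suc n) ⟧             ≈⟨ ⟦⟧-neg (+ (m ℕ.* suc n)) ⟩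
    - ((m ℕ.* suc n) · 1#)              ≈⟨ -‿cong (×1-homo-* m (suc n)) ⟩
    - (m · 1# * suc n · 1#)             ≈⟨ -‿distribʳ-* _ _ ⟩
    m · 1# * - (suc n · 1#)             ∎
  ⟦⟧-* -[1+ m ] (+ n)    = begin
    ⟦ Sign.- ℤ.◃ suc m ℕ.* n ⟧          ≡⟨ P.cong ⟦_⟧ (ℤₚ.-◃n≡-n (suc m ℕ.* n)) ⟩
    ⟦ ℤ.- + (suc m ℕ.* n) ⟧             ≈⟨ ⟦⟧-neg (+ (suc m ℕ.* n)) ⟩
    - ((suc m ℕ.* n) · 1#)              ≈⟨ -‿cong (×1-homo-* (suc m) n) ⟩
    - (suc m · 1# * n · 1#)             ≈⟨ -‿distribˡ-* _ _ ⟩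
    - (suc m · 1#) * n · 1#             ∎
  ⟦⟧-* -[1+ m ] -[1+ n ] = begin
    (suc m ℕ.* suc n) · 1#              ≈⟨ ×1-homo-* (suc m) (suc n) ⟩
    suc m · 1# * suc n · 1#             ≈⟨ -‿involutive _ ⟨
    - - (suc m · 1# * suc n · 1#)       ≈⟨ -‿cong (-‿distribˡ-* _ _) ⟩
    - (- (suc m · 1#) * suc n · 1#)     ≈⟨ -‿distribʳ-* _ _ ⟩
    - (suc m · 1#) * - (suc n · 1#)     ∎

  integerMorphism : CommutativeRing.rawRing ℤₚ.+-*-commutativeRing
                      -Raw-AlmostCommutative⟶ fromCommutativeRing R
  integerMorphism = record
    { ⟦_⟧ = ⟦_⟧ ; +-homo = ⟦⟧-+ ; *-homo = ⟦⟧-* ; -‿homo = ⟦⟧-neg ; 0-homo = refl ; 1-homo = refl }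

  ⟦⟧-≟ : ∀ i j → Maybe (⟦ i ⟧ ≈ ⟦ j ⟧)
  ⟦⟧-≟ i j = case i ℤₚ.≟ j of λ where
    (yes p) → just (reflexive (P.cong ⟦_⟧ p))
    (no  _) → nothing

  open import Algebra.Solver.Ring
    (CommutativeRing.rawRing ℤₚ.+-*-commutativeRing) (fromCommutativeRing R) integerMorphism ⟦⟧-≟
    public using (solve; _:=_; _:+_; _:*_; _:-_; :-_; _:^_; con; Polynomial)

  :0 :1 :2 : ∀ {n} → Polynomial n
  :0 = con (+ 0)
  :1 = con (+ 1)
  :2 = con (+ 2)

-- Doubling by constructors: sums of length `dbl n` and coefficients of f(q²) then reduce two steps
-- at a time.
dbl : ℕ → ℕ
dbl zero    = zero
dbl (suc n) = suc (suc (dbl n))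

-- Telescoping

module SumsProducts (R : CommutativeRing 0ℓ 0ℓ) where
  open CommutativeRing R

  psum : (ℕ → Carrier) → ℕ → Carrier
  psum s zero    = 0#
  psum s (suc n) = psum s n + s n

  psum-cong : ∀ {s s′} → (∀ n → s n ≈ s′ n) → ∀ n → psum s n ≈ psum s′ n
  psum-cong p zero    = refl
  psum-cong p (suc n) = +-cong (psum-cong p n) (p n)

  -- prod r k v = ∏_{j<k} (1 + v rʲ)
  prod : Carrier → ℕ → Carrier → Carrier
  prod r zero    v = 1#
  prod r (suc k) v = prod r k (r * v) * (1# + v)

  prod-cong : ∀ {r r′ v v′} → r ≈ r′ → v ≈ v′ → ∀ k → prod r k v ≈ prod r′ k v′
  prod-cong p p′ zero    = refl
  prod-cong p p′ (suc k) = *-cong (prod-cong p (*-cong p p′) k) (+-congˡ p′)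

module Telescope (R : CommutativeRing 0ℓ 0ℓ) (q : CommutativeRing.Carrier R) where
  open CommutativeRing R
  open import Algebra.Properties.Semiring.Exp semiring using (_^_)
  open IntegerSolver R
  open SumsProducts R
  open import Relation.Binary.Reasoning.Setoid setoid

  infix 4 _≈_[mod_]

  -- Truncation for a ring in which there are no coefficients to compare. Over series it yields
  -- agreement below index n, by `mod⇒≈`.
  record _≈_[mod_] (a b : Carrier) (n : ℕ) : Set where
    constructor _,_
    field
      quotient : Carrier
      equality : a ≈ b + q ^ n * quotient

  ≈⇒≈[] : ∀ {n a b} → a ≈ b → a ≈ b [mod n ]
  ≈⇒≈[] {n} {a} {b} a≈b = 0# , trans a≈b (sym (trans (+-congˡ (zeroʳ _)) (+-identityʳ b)))

  trans[] : ∀ {n a b c} → a ≈ b [mod n ] → b ≈ c [mod n ] → a ≈ c [mod n ]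
  trans[] {n} {a} {b} {c} (h , p) (k , r) = k + h , (begin
    a                             ≈⟨ p ⟩
    b + q ^ n * h                 ≈⟨ +-congʳ r ⟩
    c + q ^ n * k + q ^ n * h     ≈⟨ +-assoc _ _ _ ⟩
    c + (q ^ n * k + q ^ n * h)   ≈⟨ +-congˡ (distribˡ _ _ _) ⟨
    c + q ^ n * (k + h)           ∎)

  +-cong[] : ∀ {n a b c d} → a ≈ b [mod n ] → c ≈ d [mod n ] → a + c ≈ b + d [mod n ]
  +-cong[] {n} {a} {b} {c} {d} (h , p) (k , r) = h + k , trans (+-cong p r)
    (solve 5 (λ b d h k P → (b :+ P :* h) :+ (d :+ P :* k)
      := b :+ d :+ P :* (h :+ k)) refl b d h k (q ^ n))

  *-cong[] : ∀ {n a b c d} → a ≈ b [mod n ] → c ≈ d [mod n ] → a * c ≈ b * d [mod n ]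
  *-cong[] {n} {a} {b} {c} {d} (h , p) (k , r) = _ , trans (*-cong p r)
    (solve 5 (λ b d h k P → (b :+ P :* h) :* (d :+ P :* k)
                            := b :* d :+ P :* (h :* d :+ b :* k :+ h :* P :* k)) refl b d h k
                              (q ^ n))

  x : ℕ → Carrier
  x zero    = q
  x (suc n) = q * q * x n

  -- x n = q^(2n+1), and t w e n is tₙ(w) when e n is the inverse of 1 - w q^(2n+1).
  t : Carrier → (ℕ → Carrier) → ℕ → Carrier
  t w e zero    = 1#
  t w e (suc n) = t w e n * (x n * (w + x n) * e n)

  psum-cong[] : ∀ {s s′ k} → (∀ n → s n ≈ s′ n [mod k ]) → ∀ n → psum s n ≈ psum s′ n [mod k ]
  psum-cong[] p zero    = ≈⇒≈[] refl
  psum-cong[] p (suc n) = +-cong[] (psum-cong[] p n) (p n)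

  x≈^ : ∀ n → x n ≈ q ^ suc n * q ^ n
  x≈^ zero    = sym (trans (*-identityʳ _) (*-identityʳ _))
  x≈^ (suc n) = trans (*-congˡ (x≈^ n))
    (solve 2 (λ q P → q :* q :* (q :* P :* P) := q :* (q :* P) :* (q :* P)) refl q (q ^ n))

  module _ (w : Carrier) (e : ℕ → Carrier) (inv : ∀ n → e n * (1# - w * x n) ≈ 1#) where

    -- Replacing w by q²w turns w + q^(2j+1) into q² (w + q^(2j-1)), so the factors move by one
    -- place. The unmatched first factor q (1 + qw) is completed to 1 - q²w² by the denominator 1 -
    -- qw that has dropped out.
    t-shift : ∀ n → t (q * q * w) (e ∘ suc) (suc n)
                    ≈ x n * x n * (1# - q * q * (w * w)) * e n * e (suc n) * t w e n
    t-shift zero = begin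
      1# * (q * (q * q * w + q) * e 1)
        ≈⟨ solve 3 (λ q w e → :1 :* (q :* (q :* q :* w :+ q) :* e)
                     := q :* q :* (:1 :+ w :* q) :* :1 :* e) refl q w (e 1) ⟩
      q * q * (1# + w * q) * 1# * e 1
        ≈⟨ *-congʳ (*-congˡ (inv 0)) ⟨
      q * q * (1# + w * q) * (e 0 * (1# - w * q)) * e 1
        ≈⟨ solve 4 (λ q w e f → q :* q :* (:1 :+ w :* q) :* (e :* (:1 :- w :* q)) :* f
                     := q :* q :* (:1 :- q :* q :* (w :* w)) :* e :* f :* :1) refl q w (e 0) (e 1) ⟩
      q * q * (1# - q * q * (w * w)) * e 0 * e 1 * 1#
        ∎
    t-shift (suc n) = trans (*-congʳ (t-shift n))
      (solve 8 (λ q w x o e₀ e₁ e₂ t →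
        x :* x :* o :* e₀ :* e₁ :* t :* (q :* q :* x :* (q :* q :* w :+ q :* q :* x) :* e₂)
        := q :* q :* x :* (q :* q :* x) :* o :* e₁ :* e₂ :* (t :* (x :* (w :+ x) :* e₀)))
        refl q w (x n) (1# - q * q * (w * w)) (e n) (e (suc n)) (e (suc (suc n))) (t w e n))

    -- (1 - q²w²) Rₙ₊₁
    remainder : ℕ → Carrier
    remainder n = (1# - q * q * (w * w)) * (w * x n * e n * t w e n)

    -- Up to common factors, with x = `x n`, the claim is (1 + q²w²) x = (w + x) (1 - w q²x) + w q²x
    -- (w + x) - w (1 - w q²x). Units `e (suc n) * (1# - w * x (suc n))` are inserted to make the
    -- equation polynomial.
    t-telescope : ∀ n → (1# + q * q * (w * w)) * t (q * q * w) (e ∘ suc) (suc n)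
                        ≈ (1# - q * q * (w * w)) * t w e (suc n) + (remainder (suc n) - remainder n)
    t-telescope n = begin
      (1# + q * q * (w * w)) * t (q * q * w) (e ∘ suc) (suc n)
        ≈⟨ *-congˡ (t-shift n) ⟩
      (1# + q * q * (w * w)) * (x n * x n * m * e n * e (suc n) * t w e n)
        ≈⟨ solve 8 (λ q w x m e₀ e₁ t o →
             (o :+ q :* q :* (w :* w)) :* (x :* x :* m :* e₀ :* e₁ :* t)
             := m :* (t :* (x :* (w :+ x) :* e₀)) :*
                  (e₁ :* (o :- w :* (q :* q :* x)))
                :+ (m :* (w :* (q :* q :* x) :* e₁ :* (t :* (x :* (w :+ x) :* e₀)))
                :- m :* (w :* x :* e₀ :* t) :* (e₁ :* (o :- w :* (q :* q :* x)))))
             refl q w (x n) m (e n) (e (suc n)) (t w e n) 1# ⟩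
      m * t w e (suc n) * (e (suc n) * (1# - w * x (suc n))) +
        (remainder (suc n) - remainder n * (e (suc n) * (1# - w * x (suc n))))
        ≈⟨ +-cong (trans (*-congˡ (inv (suc n))) (*-identityʳ _))
                  (+-congˡ (-‿cong (trans (*-congˡ (inv (suc n))) (*-identityʳ _)))) ⟩
      m * t w e (suc n) + (remainder (suc n) - remainder n) ∎
      where m = 1# - q * q * (w * w)

    -- `t-telescope` covers only positive indices. The term of index 0 adds 2q²w² and the lower end
    -- of the telescope subtracts wq (1 + wq), which leaves the constant -wq (1 - wq).
    psum-telescope : ∀ n → (1# + q * q * (w * w)) * psum (t (q * q * w) (e ∘ suc)) (suc n)
      ≈ (1# - q * q * (w * w)) * psum (t w e) (suc n) + (remainder n - w * q * (1# - w * q))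
    psum-telescope zero = begin
      (1# + q * q * (w * w)) * (0# + 1#)
        ≈⟨ solve 2 (λ q w → (:1 :+ q :* q :* (w :* w)) :* (:0 :+ :1)
             := :1 :- q :* q :* (w :* w)
                :+ ((:1 :+ w :* q) :* w :* q :* :1 :- w :* q :* (:1 :- w :* q)))
             refl q w ⟩
      m + ((1# + w * q) * w * q * 1# - w * q * (1# - w * q))
        ≈⟨ +-congˡ (+-congʳ (*-congˡ (inv 0))) ⟨
      m + ((1# + w * q) * w * q * (e 0 * (1# - w * q)) - w * q * (1# - w * q))
        ≈⟨ solve 3 (λ q w e → let m = :1 :- q :* q :* (w :* w) in
             m :+ ((:1 :+ w :* q) :* w :* q :* (e :* (:1 :- w :* q)) :- w :* q :* (:1 :- w :* q))
             := m :* (:0 :+ :1) :+ (m :* (w :* q :* e :* :1) :- w :* q :* (:1 :- w :* q))) refl q w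
               (e 0) ⟩
      m * (0# + 1#) + (remainder 0 - w * q * (1# - w * q)) ∎
      where m = 1# - q * q * (w * w)
    psum-telescope (suc n) = trans (distribˡ _ _ _)
      (trans (+-cong (psum-telescope n) (t-telescope n))
      (solve 6 (λ m s r r′ k t → m :* s :+ (r :- k) :+ (m :* t :+ (r′ :- r))
        := m :* (s :+ t) :+ (r′ :- k))
        refl (1# - q * q * (w * w)) (psum (t w e) (suc n)) (remainder n) (remainder (suc n))
          (w * q * (1# - w * q)) (t w e (suc n))))

    t≈[] : ∀ k u → w ≈ q ^ k * u → ∀ n → t w (λ m → e m) n ≈ t 0# (λ _ → 1#) n [mod k ]
    t≈[] k u w≈ zero    = ≈⇒≈[] refl
    t≈[] k u w≈ (suc n) = *-cong[] (t≈[] k u w≈ n)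
      (*-cong[] (*-cong[] (≈⇒≈[] refl) (+-cong[] (u , trans w≈ (sym (+-identityˡ _))) (≈⇒≈[] refl)))
        (e n * u * x n , (begin
          e n ≈⟨ *-identityʳ _ ⟨
          e n * 1# ≈⟨ solve 4 (λ e w x o → e :* o
            := e :* (o :- w :* x) :+ e :* w :* x) refl (e n) w (x n) 1# ⟩
          e n * (1# - w * x n) + e n * w * x n ≈⟨ +-cong (inv n) (*-congʳ (*-congˡ w≈)) ⟩
          1# + e n * (q ^ k * u) * x n
            ≈⟨ solve 5 (λ e P u x o → o :+ e :* (P :* u) :* x
              := o :+ P :* (e :* u :* x)) refl (e n) (q ^ k) u (x n) 1# ⟩
          1# + q ^ k * (e n * u * x n) ∎)))

  -- The boundary constants of `psum-telescope` at w and -w add up to 2q²w² = (1 + q²w²) - (1 -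
  -- q²w²). Subtracting 1 from the sum absorbs exactly this and makes the functional equation
  -- homogeneous.
  G : Carrier → (e ē : ℕ → Carrier) → ℕ → Carrier
  G w e ē n = psum (t w e) n + psum (t (- w) ē) n - 1#

  -- This is `G` at w = 0, where tₙ(0) = q^(2n²): a partial sum of φ(q²).
  Φ : ℕ → Carrier
  Φ n = psum (t 0# (λ _ → 1#)) n + psum (t 0# (λ _ → 1#)) n - 1#

  Inverses : Carrier → (ℕ → Carrier) → Set
  Inverses w e = ∀ n → e n * (1# - w * x n) ≈ 1#

  shift-inverses : ∀ {w e} → Inverses w e → Inverses (q * q * w) (e ∘ suc)
  shift-inverses {w} {e} inv n = trans (*-congˡ (+-congˡ (-‿cong
    (solve 3 (λ q w x → q :* q :* w :* x := w :* (q :* q :* x)) refl q w (x n))))) (inv (suc n))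

  t-cong : ∀ {w w′} e → w ≈ w′ → ∀ n → t w e n ≈ t w′ e n
  t-cong e p zero = refl
  t-cong e p (suc n) = *-cong (t-cong e p n) (*-congʳ (*-congˡ (+-congʳ p)))

  -- Both remainders at the upper end contain `x n`, that is q^(n+1) q^n, so they vanish modulo
  -- q^(n+1).
  G-functional : ∀ {w e ē} → Inverses w e → Inverses (- w) ē → ∀ n →
    (1# - q * q * (w * w)) * G w e ē n ≈
    (1# + q * q * (w * w)) * G (q * q * w) (e ∘ suc) (ē ∘ suc) n [mod n ]
  G-functional inv inv′ zero = _ , solve 2 (λ a b → a := b :+ :1 :* (a :- b)) refl _ _
  G-functional {w} {e} {ē} inv inv′ (suc n) =
    - (q ^ n * (m * (w * e n * t w e n - w * ē n * t (- w) ē n))) , (begin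
      m * (S + S̄ - 1#)
        ≈⟨ solve 4 (λ m S S̄ o → m :* (S :+ S̄ :- o)
          := m :* S :+ m :* S̄ :- m :* o) refl m S S̄ 1# ⟩
      m * S + m * S̄ - m * 1#
        ≈⟨ +-congʳ (+-cong lem lem′) ⟩
      p * S′ - (r - w * q * (1# - w * q)) + (p * S̄′ - (r̄ + w * q * (1# + w * q))) - m * 1#
        ≈⟨ solve 6 (λ S′ S̄′ r r̄ w q →
             let m = :1 :- q :* q :* (w :* w) ; p = :1 :+ q :* q :* (w :* w) in
             p :* S′ :- (r :- w :* q :* (:1 :- w :* q))
               :+ (p :* S̄′ :- (r̄ :+ w :* q :* (:1 :+ w :* q))) :- m :* :1
             := p :* (S′ :+ S̄′ :- :1) :- (r :+ r̄)) refl S′ S̄′ r r̄ w q ⟩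
      p * (S′ + S̄′ - 1#) - (r + r̄)
        ≈⟨ +-congˡ (-‿cong (+-cong (*-congˡ (*-congʳ (*-congʳ (*-congˡ (x≈^ n)))))
                             (*-congˡ (*-congʳ (*-congʳ (*-congˡ (x≈^ n))))))) ⟩
      p * (S′ + S̄′ - 1#) - (m * (w * (q ^ suc n * q ^ n) * e n * t w e n)
         + m * (- w * (q ^ suc n * q ^ n) * ē n * t (- w) ē n))
        ≈⟨ +-congˡ (solve 8 (λ m w P Q e ē t t̄ →
             :- (m :* (w :* (P :* Q) :* e :* t) :+ m :* (:- w :* (P :* Q) :* ē :* t̄))
             := P :* (:- (Q :* (m :* (w :* e :* t :- w :* ē :* t̄))))) refl
             m w (q ^ suc n) (q ^ n) (e n) (ē n) (t w e n) (t (- w) ē n)) ⟩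
      p * (S′ + S̄′ - 1#) + q ^ suc n
        * - (q ^ n * (m * (w * e n * t w e n - w * ē n * t (- w) ē n)))
        ≈⟨ +-congʳ (*-congˡ (+-congʳ (+-congˡ (psum-cong (t-cong (ē ∘ suc)
           (solve 2 (λ q w → q :* q :* :- w := :- (q :* q :* w)) refl q w)) (suc n))))) ⟩
      p * G (q * q * w) (e ∘ suc) (ē ∘ suc) (suc n) + q ^ suc n
        * - (q ^ n * (m * (w * e n * t w e n - w * ē n * t (- w) ē n))) ∎)
    where
    m = 1# - q * q * (w * w)
    p = 1# + q * q * (w * w)
    S = psum (t w e) (suc n)
    S̄ = psum (t (- w) ē) (suc n)
    S′ = psum (t (q * q * w) (e ∘ suc)) (suc n)
    S̄′ = psum (t (q * q * - w) (ē ∘ suc)) (suc n)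
    r = remainder w e inv n
    r̄ = m * (- w * x n * ē n * t (- w) ē n)
    w² : - w * - w ≈ w * w
    w² = solve 1 (λ w → :- w :* :- w := w :* w) refl w
    lem : m * S ≈ p * S′ - (r - w * q * (1# - w * q))
    lem = trans (solve 2 (λ a b → a := a :+ b :- b) refl (m * S) (r - w * q * (1# - w * q)))
            (+-congʳ (sym (psum-telescope w e inv n)))
    lem′ : m * S̄ ≈ p * S̄′ - (r̄ + w * q * (1# + w * q))
    lem′ = trans (solve 2 (λ a b → a := a :+ b :- b) refl (m * S̄) (r̄ + w * q * (1# + w * q)))
      (+-congʳ (begin
        m * S̄ + (r̄ + w * q * (1# + w * q))
          ≈⟨ +-cong (*-congʳ (+-congˡ (-‿cong (*-congˡ (sym w²)))))
               (+-cong (*-congʳ (+-congˡ (-‿cong (*-congˡ (sym w²)))))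
                 (solve 3 (λ w q o → w :* q :* (o :+ w :* q)
                   := :- (:- w :* q :* (o :- :- w :* q))) refl w q 1#)) ⟩
        _ ≈⟨ psum-telescope (- w) ē inv′ n ⟨
        (1# + q * q * (- w * - w)) * S̄′ ≈⟨ *-congʳ (+-congˡ (*-congˡ w²)) ⟩
        p * S̄′ ∎))

  q⁴ : Carrier
  q⁴ = q * q * (q * q)

  -- Each use of the functional equation multiplies w by q², of which one factor q is enough: after
  -- k steps w is divisible by q^(k+j) = q^n and may be replaced by 0. The prefactors collected on
  -- the way form the two products.
  G≈Φ[] : ∀ {w e ē} → Inverses w e → Inverses (- w) ē → ∀ k n j u → n P.≡ k ℕ.+ j → w ≈ q ^ j * u →
    prod q⁴ k (- (q * q * (w * w))) * G w e ē n ≈ prod q⁴ k (q * q * (w * w)) * Φ n [mod n ]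
  G≈Φ[] {w} {e} {ē} inv inv′ zero n j u P.refl w≈ = *-cong[] (≈⇒≈[] refl)
    (+-cong[] (+-cong[] (psum-cong[] (t≈[] w e inv j u w≈) n)
                        (psum-cong[] (t≈[] (- w) ē inv′ j (- u)
                           (trans (-‿cong w≈) (solve 2 (λ a b → :- (a :* b)
                             := a :* :- b) refl (q ^ j) u))) n))
              (≈⇒≈[] refl))
  G≈Φ[] {w} {e} {ē} inv inv′ (suc k) n j u n≡ w≈ =
    trans[] (≈⇒≈[] (*-assoc _ _ _))
    (trans[] (*-cong[] (≈⇒≈[] refl) (G-functional inv inv′ n))
    (trans[] (≈⇒≈[] (trans (solve 3 (λ a b c → a :* (b :* c) := b :* (a :* c)) refl _ _ _)
                           (*-congˡ (*-congʳ (prod-cong refl shift⁻ k)))))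
    (trans[] (*-cong[] (≈⇒≈[] refl)
               (G≈Φ[] (shift-inverses inv) inv″ k n (suc j) (q * u)
                 (P.trans n≡ (P.sym (ℕₚ.+-suc k j)))
                 (trans (*-congˡ w≈) (solve 3 (λ q P u → q :* q :* (P :* u)
                   := q :* P :* (q :* u)) refl q (q ^ j) u))))
    (≈⇒≈[] (trans (*-congˡ (*-congʳ (prod-cong refl shift⁺ k)))
       (solve 3 (λ a b c → a :* (b :* c) := b :* a :* c) refl _ _ _))))))
    where
    shift⁺ : q * q * (q * q * w * (q * q * w)) ≈ q⁴ * (q * q * (w * w))
    shift⁺ = solve 2 (λ q w → q :* q :* (q :* q :* w :* (q :* q :* w))
      := q :* q :* (q :* q) :* (q :* q :* (w :* w))) refl q w
    shift⁻ : q⁴ * - (q * q * (w * w)) ≈ - (q * q * (q * q * w * (q * q * w)))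
    shift⁻ = solve 2 (λ q w → q :* q :* (q :* q) :* :- (q :* q :* (w :* w))
      := :- (q :* q :* (q :* q :* w :* (q :* q :* w)))) refl q w
    inv″ : Inverses (- (q * q * w)) (ē ∘ suc)
    inv″ m = trans (*-congˡ (+-congˡ (-‿cong (*-congʳ
      (solve 2 (λ q w → :- (q :* q :* w) := q :* q :* :- w) refl q w))))) (shift-inverses inv′ m)

  G-limit : ∀ {c e ē} → Inverses c e → Inverses (- c) ē → ∀ n →
    prod q⁴ n (- (q * q * (c * c))) * G c e ē n ≈ prod q⁴ n (q * q * (c * c)) * Φ n [mod n ]
  G-limit inv inv′ n = G≈Φ[] inv inv′ n n 0 _ (P.sym (ℕₚ.+-identityʳ n)) (sym (*-identityˡ _))

  sq : ℕ → Carrier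
  sq zero    = 1#
  sq (suc n) = sq n * x n

  alt : ℕ → Carrier
  alt zero    = 1#
  alt (suc n) = - alt n

  module _ {i : Carrier} (i²≈-1 : i * i ≈ - 1#) where

    -- As i² = -1, the numerator i + x equals i (1 - ix), and each fraction collapses to i.
    t-imaginary : ∀ {e} → Inverses i e → ∀ n → t i e n ≈ i ^ n * sq n
    t-imaginary inv zero    = sym (*-identityʳ 1#)
    t-imaginary {e} inv (suc n) = begin
      t i e n * (x n * (i + x n) * e n)
        ≈⟨ *-cong (t-imaginary inv n) (*-congʳ (*-congˡ (begin
          i + x n           ≈⟨ solve 2 (λ i x → i :+ x := i :+ :- :- :1 :* x) refl i (x n) ⟩
          i + - - 1# * x n  ≈⟨ +-congˡ (*-congʳ (-‿cong i²≈-1)) ⟨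
          i + - (i * i) * x n ∎))) ⟩
      i ^ n * sq n * (x n * (i + - (i * i) * x n) * e n)
        ≈⟨ solve 5 (λ I s x i e → I :* s :* (x :* (i :+ :- (i :* i) :* x) :* e)
                     := i :* I :* (s :* x) :* (e :* (:1 :- i :* x))) refl (i ^ n) (sq n) (x n) i
                       (e n) ⟩
      i * i ^ n * (sq n * x n) * (e n * (1# - i * x n))
        ≈⟨ trans (*-congˡ (inv n)) (*-identityʳ _) ⟩
      i * i ^ n * (sq n * x n) ∎

    ^-dbl : ∀ n → i ^ dbl n ≈ alt n
    ^-dbl zero    = refl
    ^-dbl (suc n) = trans (sym (*-assoc _ _ _))
      (trans (*-cong i²≈-1 (^-dbl n)) (solve 1 (λ a → :- :1 :* a := :- a) refl _))

  [-i]²≈-1 : ∀ {i} → i * i ≈ - 1# → - i * - i ≈ - 1#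
  [-i]²≈-1 p = trans (solve 1 (λ i → :- i :* :- i := i :* i) refl _) p

  -- iⁿ + (-i)ⁿ is 0 for odd n and 2 (-1)^m for n = 2m. The terms are therefore taken in pairs,
  -- which accounts for the length `dbl n`.
  G-imaginary : ∀ {i e ē} → i * i ≈ - 1# → Inverses i e → Inverses (- i) ē → ∀ n →
    G i e ē (dbl n) ≈ psum (λ m → alt m * sq (dbl m)) n + psum (λ m → alt m * sq (dbl m)) n - 1#
  G-imaginary {i} {e} {ē} i² inv inv′ n = +-congʳ (go n)
    where
    go : ∀ n → psum (t i e) (dbl n) + psum (t (- i) ē) (dbl n)
               ≈ psum (λ m → alt m * sq (dbl m)) n + psum (λ m → alt m * sq (dbl m)) n
    go zero    = refl
    go (suc n) = begin
      S + t i e (dbl n) + t i e (suc (dbl n)) + (S̄ + t (- i) ē (dbl n) + t (- i) ē (suc (dbl n)))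
        ≈⟨ +-cong (+-cong (+-congˡ (trans (t-imaginary i² inv (dbl n)) (*-congʳ (^-dbl i² n))))
                         (trans (t-imaginary i² inv (suc (dbl n)))
                           (*-congʳ (*-congˡ (^-dbl i² n)))))
             (+-cong (+-congˡ (trans (t-imaginary -i² inv′ (dbl n)) (*-congʳ (^-dbl -i² n))))
                         (trans (t-imaginary -i² inv′ (suc (dbl n)))
                           (*-congʳ (*-congˡ (^-dbl -i² n))))) ⟩
      S + alt n * s + i * alt n * s′ + (S̄ + alt n * s + - i * alt n * s′)
        ≈⟨ solve 6 (λ S S̄ a i s s′ → S :+ a :* s :+ i :* a :* s′
          :+ (S̄ :+ a :* s :+ :- i :* a :* s′)
                     := S :+ S̄ :+ (a :* s :+ a :* s)) refl S S̄ (alt n) i s s′ ⟩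
      S + S̄ + (alt n * s + alt n * s)
        ≈⟨ +-congʳ (go n) ⟩
      T + T + (alt n * s + alt n * s)
        ≈⟨ solve 2 (λ T a → T :+ T :+ (a :+ a) := T :+ a :+ (T :+ a)) refl T (alt n * s) ⟩
      T + alt n * s + (T + alt n * s) ∎
      where
      S = psum (t i e) (dbl n)
      S̄ = psum (t (- i) ē) (dbl n)
      T = psum (λ m → alt m * sq (dbl m)) n
      s = sq (dbl n)
      s′ = sq (suc (dbl n))
      -i² = [-i]²≈-1 i²

-- Ring homomorphisms and the telescoping data

module _ {R S : CommutativeRing 0ℓ 0ℓ} where
  private
    module R = CommutativeRing R
    module S = CommutativeRing S

  open RingMorphisms R.rawRing S.rawRing

  ringHomomorphism : ∀ (h : R.Carrier → S.Carrier) → (∀ {a b} → a R.≈ b → h a S.≈ h b) →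
    (∀ a b → h (a R.+ b) S.≈ h a S.+ h b) → (∀ a b → h (a R.* b) S.≈ h a S.* h b) →
    (∀ a → h (R.- a) S.≈ S.- h a) → h R.0# S.≈ S.0# → h R.1# S.≈ S.1# → IsRingHomomorphism h
  ringHomomorphism h cong +-homo *-homo -‿homo 0#-homo 1#-homo = record
    { isSemiringHomomorphism = record
      { isNearSemiringHomomorphism = record
        { +-isMonoidHomomorphism = record
          { isMagmaHomomorphism = record { isRelHomomorphism = record { cong = cong } ; homo =
            +-homo }
          ; ε-homo = 0#-homo }
        ; *-homo = *-homo }
      ; 1#-homo = 1#-homo }
    ; -‿homo = -‿homo }

  module Hom {h : R.Carrier → S.Carrier} (isHom : IsRingHomomorphism h) where
    open IsRingHomomorphism isHom public renaming (⟦⟧-cong to cong)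
    private
      module ΣR = SumsProducts R
      module ΣS = SumsProducts S

    psum-homo : ∀ s n → h (ΣR.psum s n) S.≈ ΣS.psum (h ∘ s) n
    psum-homo s zero    = 0#-homo
    psum-homo s (suc n) = S.trans (+-homo _ _) (S.+-congʳ (psum-homo s n))

    prod-homo : ∀ r n v → h (ΣR.prod r n v) S.≈ ΣS.prod (h r) n (h v)
    prod-homo r zero    v = 1#-homo
    prod-homo r (suc n) v = S.trans (*-homo _ _) (S.*-cong
      (S.trans (prod-homo r n (r R.* v)) (ΣS.prod-cong S.refl (*-homo r v) n))
      (S.trans (+-homo _ _) (S.+-congʳ 1#-homo)))

    module Transport (q : R.Carrier) where
      private
        module TR = Telescope R q
        module TS = Telescope S (h q)

      open import Algebra.Properties.Semiring.Exp R.semiring using () renaming (_^_ to _^R_)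
      open import Algebra.Properties.Semiring.Exp S.semiring using () renaming (_^_ to _^S_)

      ^-homo : ∀ n → h (q ^R n) S.≈ h q ^S n
      ^-homo zero    = 1#-homo
      ^-homo (suc n) = S.trans (*-homo _ _) (S.*-congˡ (^-homo n))

      x-homo : ∀ n → h (TR.x n) S.≈ TS.x n
      x-homo zero    = S.refl
      x-homo (suc n) = S.trans (*-homo _ _) (S.*-cong (*-homo q q) (x-homo n))

      sq-homo : ∀ n → h (TR.sq n) S.≈ TS.sq n
      sq-homo zero    = 1#-homo
      sq-homo (suc n) = S.trans (*-homo _ _) (S.*-cong (sq-homo n) (x-homo n))

      alt-homo : ∀ n → h (TR.alt n) S.≈ TS.alt n
      alt-homo zero    = 1#-homo
      alt-homo (suc n) = S.trans (-‿homo _) (S.-‿cong (alt-homo n))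

      t₀-homo : ∀ n → h (TR.t R.0# (λ _ → R.1#) n) S.≈ TS.t S.0# (λ _ → S.1#) n
      t₀-homo zero    = 1#-homo
      t₀-homo (suc n) = S.trans (*-homo _ _) (S.*-cong (t₀-homo n) (S.trans (*-homo _ _) (S.*-cong
        (S.trans (*-homo _ _) (S.*-cong (x-homo n)
          (S.trans (+-homo _ _) (S.+-cong 0#-homo (x-homo n))))) 1#-homo)))

      Φ-homo : ∀ n → h (TR.Φ n) S.≈ TS.Φ n
      Φ-homo n = S.trans (+-homo _ _)
        (S.+-cong (S.trans (+-homo _ _) (S.+-cong lem lem)) (S.trans (-‿homo _) (S.-‿cong 1#-homo)))
        where lem = S.trans (psum-homo _ n) (ΣS.psum-cong t₀-homo n)

∘-hom : ∀ {R S T : CommutativeRing 0ℓ 0ℓ} →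
  let module R = CommutativeRing R ; module S = CommutativeRing S ; module T = CommutativeRing T in
  ∀ {g h} → RingMorphisms.IsRingHomomorphism R.rawRing S.rawRing g →
    RingMorphisms.IsRingHomomorphism S.rawRing T.rawRing h →
  RingMorphisms.IsRingHomomorphism R.rawRing T.rawRing (h ∘ g)
∘-hom {T = T} = isRingHomomorphism (CommutativeRing.trans T)

-- The ring of power series

module Z = ℤ-Solver.+-*-Solver

-- The product as defined unfolds definitionally to
-- (f ⊛ g) (suc n) = f 0 * g (suc n) + (tail f ⊛ g) n, so inductions on the index run along tails.
tail : Series → Series
tail f = f ∘ suc

𝟘 : Series
𝟘 _ = 0ℤ

-- Needed because `tail (f ⊛ g)` unfolds to `scale (f 0) (tail g) ⊕ tail f ⊛ g`.
scale : ℤ → Series → Series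
scale a f n = a ℤ.* f n

⊛-cong : ∀ {f f′ g g′} → f ≗ f′ → g ≗ g′ → f ⊛ g ≗ f′ ⊛ g′
⊛-cong p q zero    = P.cong₂ (λ a b → a ℤ.* b ℤ.+ 0ℤ) (p 0) (q 0)
⊛-cong p q (suc n) = P.cong₂ ℤ._+_ (P.cong₂ ℤ._*_ (p 0) (q (suc n))) (⊛-cong (p ∘ suc) q n)

⊛-zeroˡ : ∀ g → 𝟘 ⊛ g ≗ 𝟘
⊛-zeroˡ g zero    = P.refl
⊛-zeroˡ g (suc n) = P.trans (ℤₚ.+-identityˡ _) (⊛-zeroˡ g n)

⊛-identityˡ : ∀ g → 𝟙 ⊛ g ≗ g
⊛-identityˡ g zero    = P.trans (ℤₚ.+-identityʳ _) (ℤₚ.*-identityˡ _)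
⊛-identityˡ g (suc n) = P.trans (P.cong₂ ℤ._+_ (ℤₚ.*-identityˡ (g (suc n))) (⊛-zeroˡ g n))
  (ℤₚ.+-identityʳ _)

⊛-distribʳ : ∀ h f g → (f ⊕ g) ⊛ h ≗ f ⊛ h ⊕ g ⊛ h
⊛-distribʳ h f g zero    = Z.solve 3 (λ a b c → (a Z.:+ b) Z.:* c Z.:+ Z.con 0ℤ
  Z.:= a Z.:* c Z.:+ Z.con 0ℤ Z.:+ (b Z.:* c Z.:+ Z.con 0ℤ)) P.refl (f 0) (g 0) (h 0)
⊛-distribʳ h f g (suc n) = P.trans
  (P.cong (ℤ._+_ ((f 0 ℤ.+ g 0) ℤ.* h (suc n))) (⊛-distribʳ h (tail f) (tail g) n))
  (Z.solve 5 (λ a b c d e → (a Z.:+ b) Z.:* c Z.:+ (d Z.:+ e)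
    Z.:= a Z.:* c Z.:+ d Z.:+ (b Z.:* c Z.:+ e)) P.refl (f 0) (g 0) (h (suc n)) ((tail f ⊛ h) n)
    ((tail g ⊛ h) n))

scale-⊛ : ∀ a f g → scale a f ⊛ g ≗ scale a (f ⊛ g)
scale-⊛ a f g zero    = Z.solve 3 (λ a f g → a Z.:* f Z.:* g Z.:+ Z.con 0ℤ
  Z.:= a Z.:* (f Z.:* g Z.:+ Z.con 0ℤ)) P.refl a (f 0) (g 0)
scale-⊛ a f g (suc n) = P.trans (P.cong (ℤ._+_ (a ℤ.* f 0 ℤ.* g (suc n))) (scale-⊛ a (tail f) g n))
  (Z.solve 4 (λ a f g h → a Z.:* f Z.:* g Z.:+ a Z.:* h
    Z.:= a Z.:* (f Z.:* g Z.:+ h)) P.refl a (f 0) (g (suc n)) ((tail f ⊛ g) n))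

⊛-assoc : ∀ f g h → (f ⊛ g) ⊛ h ≗ f ⊛ (g ⊛ h)
⊛-assoc f g h zero    = Z.solve 3 (λ a b c → (a Z.:* b Z.:+ Z.con 0ℤ) Z.:* c Z.:+ Z.con 0ℤ
  Z.:= a Z.:* (b Z.:* c Z.:+ Z.con 0ℤ) Z.:+ Z.con 0ℤ) P.refl (f 0) (g 0) (h 0)
⊛-assoc f g h (suc n) = begin
  (f ⊛ g) 0 ℤ.* h (suc n) ℤ.+ (tail (f ⊛ g) ⊛ h) n
    ≡⟨ P.cong (ℤ._+_ ((f ⊛ g) 0 ℤ.* h (suc n))) (⊛-distribʳ h (scale (f 0) (tail g)) (tail f ⊛ g) n)
      ⟩
  (f ⊛ g) 0 ℤ.* h (suc n) ℤ.+ ((scale (f 0) (tail g) ⊛ h) n ℤ.+ ((tail f ⊛ g) ⊛ h) n)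
    ≡⟨ P.cong₂ (λ a b → (f ⊛ g) 0 ℤ.* h (suc n) ℤ.+ (a ℤ.+ b)) (scale-⊛ (f 0) (tail g) h n)
      (⊛-assoc (tail f) g h n) ⟩
  (f ⊛ g) 0 ℤ.* h (suc n) ℤ.+ (f 0 ℤ.* (tail g ⊛ h) n ℤ.+ (tail f ⊛ (g ⊛ h)) n)
    ≡⟨ Z.solve 5 (λ a b c d e → (a Z.:* b Z.:+ Z.con 0ℤ) Z.:* c Z.:+ (a Z.:* d Z.:+ e)
      Z.:= a Z.:* (b Z.:* c Z.:+ d) Z.:+ e)
         P.refl (f 0) (g 0) (h (suc n)) ((tail g ⊛ h) n) ((tail f ⊛ (g ⊛ h)) n) ⟩
  f 0 ℤ.* (g ⊛ h) (suc n) ℤ.+ (tail f ⊛ (g ⊛ h)) n ∎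
  where open P.≡-Reasoning

-- The definition peels off the first summand of the convolution; this peels off the last, and
-- comparing the two gives commutativity.
⊛-tailʳ : ∀ f g n → (f ⊛ g) (suc n) ≡ (f ⊛ tail g) n ℤ.+ f (suc n) ℤ.* g 0
⊛-tailʳ f g zero    = Z.solve 4 (λ a b c d → a Z.:* b Z.:+ (c Z.:* d Z.:+ Z.con 0ℤ)
  Z.:= a Z.:* b Z.:+ Z.con 0ℤ Z.:+ c Z.:* d) P.refl (f 0) (g 1) (f 1) (g 0)
⊛-tailʳ f g (suc n) = P.trans (P.cong (ℤ._+_ (f 0 ℤ.* g (suc (suc n)))) (⊛-tailʳ (tail f) g n))
  (P.sym (ℤₚ.+-assoc (f 0 ℤ.* g (suc (suc n))) ((tail f ⊛ tail g) n) (f (suc (suc n)) ℤ.* g 0)))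

⊛-comm : ∀ f g → f ⊛ g ≗ g ⊛ f
⊛-comm f g zero    = P.cong (ℤ._+ 0ℤ) (ℤₚ.*-comm (f 0) (g 0))
⊛-comm f g (suc n) = P.trans (P.cong₂ ℤ._+_ (ℤₚ.*-comm (f 0) (g (suc n))) (⊛-comm (tail f) g n))
  (P.trans (ℤₚ.+-comm _ ((g ⊛ tail f) n)) (P.sym (⊛-tailʳ g f n)))

-- A record rather than _≗_ itself, and opaque operations, so that the two sides of an equation
-- between series are never unfolded into coefficients during type checking.
infix 4 _≋_

record _≋_ (f g : Series) : Set where
  constructor pointwise
  field at : f ≗ g

open _≋_ public

opaque
  addₛ mulₛ : Series → Series → Series
  addₛ = _⊕_
  mulₛ = _⊛_

  negₛ : Series → Series
  negₛ = ⊝_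

  isCommutativeRing : IsCommutativeRing _≋_ addₛ mulₛ negₛ 𝟘 𝟙
  isCommutativeRing = record
    { isRing = record
      { +-isAbelianGroup = record
        { isGroup = record
          { isMonoid = record
            { isSemigroup = record
              { isMagma = record
                { isEquivalence = record
                  { refl = pointwise λ _ → P.refl
                  ; sym = λ p → pointwise λ n → P.sym (at p n)
                  ; trans = λ p q → pointwise λ n → P.trans (at p n) (at q n) }
                ; ∙-cong = λ p q → pointwise λ n → P.cong₂ ℤ._+_ (at p n) (at q n) }
              ; assoc = λ f g h → pointwise λ n → ℤₚ.+-assoc (f n) (g n) (h n) }
            ; identity = (λ f → pointwise λ n → ℤₚ.+-identityˡ (f n)) ,
              (λ f → pointwise λ n → ℤₚ.+-identityʳ (f n)) }
          ; inverse = (λ f → pointwise λ n → ℤₚ.+-inverseˡ (f n)) ,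
            (λ f → pointwise λ n → ℤₚ.+-inverseʳ (f n))
          ; ⁻¹-cong = λ p → pointwise λ n → P.cong ℤ.-_ (at p n) }
        ; comm = λ f g → pointwise λ n → ℤₚ.+-comm (f n) (g n) }
      ; *-cong = λ p q → pointwise (⊛-cong (at p) (at q))
      ; *-assoc = λ f g h → pointwise (⊛-assoc f g h)
      ; *-identity = (λ f → pointwise (⊛-identityˡ f)) , λ f → pointwise λ n →
        P.trans (⊛-comm f 𝟙 n) (⊛-identityˡ f n)
      ; distrib = (λ h f g → pointwise λ n →
        P.trans (⊛-comm h (f ⊕ g) n) (P.trans (⊛-distribʳ h f g n)
                                (P.cong₂ ℤ._+_ (⊛-comm f h n) (⊛-comm g h n))))
                , λ h f g → pointwise (⊛-distribʳ h f g) }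
    ; *-comm = λ f g → pointwise (⊛-comm f g) }

seriesRing : CommutativeRing 0ℓ 0ℓ
seriesRing = record { isCommutativeRing = isCommutativeRing }

-- Adjoining a square root of -1

module Gaussian (R : CommutativeRing 0ℓ 0ℓ) where
  open CommutativeRing R
  open IntegerSolver R

  gaussianRing : CommutativeRing 0ℓ 0ℓ
  gaussianRing = record
    { Carrier = Carrier × Carrier
    ; _≈_ = λ (a , b) (c , d) → a ≈ c × b ≈ d
    ; _+_ = λ (a , b) (c , d) → a + c , b + d
    ; _*_ = λ (a , b) (c , d) → a * c - b * d , a * d + b * c
    ; -_ = λ (a , b) → - a , - b
    ; 0# = 0# , 0#
    ; 1# = 1# , 0#
    ; isCommutativeRing = record
      { isRing = record
        { +-isAbelianGroup = record
          { isGroup = record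
            { isMonoid = record
              { isSemigroup = record
                { isMagma = record
                  { isEquivalence = record
                    { refl = refl , refl ; sym = λ (p , q) → sym p , sym q
                    ; trans = λ (p , q) (p′ , q′) → trans p p′ , trans q q′ }
                  ; ∙-cong = λ (p , q) (p′ , q′) → +-cong p p′ , +-cong q q′ }
                ; assoc = λ _ _ _ → +-assoc _ _ _ , +-assoc _ _ _ }
              ; identity = (λ _ → +-identityˡ _ , +-identityˡ _) ,
                (λ _ → +-identityʳ _ , +-identityʳ _) }
            ; inverse = (λ _ → -‿inverseˡ _ , -‿inverseˡ _) , (λ _ → -‿inverseʳ _ , -‿inverseʳ _)
            ; ⁻¹-cong = λ (p , q) → -‿cong p , -‿cong q }
          ; comm = λ _ _ → +-comm _ _ , +-comm _ _ }
        ; *-cong = λ (p , q) (p′ , q′) →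
          +-cong (*-cong p p′) (-‿cong (*-cong q q′)) , +-cong (*-cong p q′) (*-cong q p′)
        ; *-assoc = λ (a , b) (c , d) (e , f) →
            solve 6 (λ a b c d e f → (a :* c :- b :* d) :* e :- (a :* d :+ b :* c) :* f
                                     := a :* (c :* e :- d :* f) :- b :* (c :* f :+ d :* e)) refl a b
                                       c d e f ,
            solve 6 (λ a b c d e f → (a :* c :- b :* d) :* f :+ (a :* d :+ b :* c) :* e
                                     := a :* (c :* f :+ d :* e) :+ b :* (c :* e :- d :* f)) refl a b
                                       c d e f
        ; *-identity =
            (λ (a , b) → solve 2 (λ a b → :1 :* a :- :0 :* b
              := a) refl a b , solve 2 (λ a b → :1 :* b :+ :0 :* a := b) refl a b) ,
            (λ (a , b) → solve 2 (λ a b → a :* :1 :- b :* :0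
              := a) refl a b , solve 2 (λ a b → a :* :0 :+ b :* :1 := b) refl a b)
        ; distrib =
            (λ (a , b) (c , d) (e , f) →
              solve 6 (λ a b c d e f → a :* (c :+ e) :- b :* (d :+ f)
                := a :* c :- b :* d :+ (a :* e :- b :* f)) refl a b c d e f ,
              solve 6 (λ a b c d e f → a :* (d :+ f) :+ b :* (c :+ e)
                := a :* d :+ b :* c :+ (a :* f :+ b :* e)) refl a b c d e f) ,
            (λ (a , b) (c , d) (e , f) →
              solve 6 (λ a b c d e f → (c :+ e) :* a :- (d :+ f) :* b
                := c :* a :- d :* b :+ (e :* a :- f :* b)) refl a b c d e f ,
              solve 6 (λ a b c d e f → (c :+ e) :* b :+ (d :+ f) :* a
                := c :* b :+ d :* a :+ (e :* b :+ f :* a)) refl a b c d e f) }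
      ; *-comm = λ (a , b) (c , d) →
          solve 4 (λ a b c d → a :* c :- b :* d := c :* a :- d :* b) refl a b c d ,
          solve 4 (λ a b c d → a :* d :+ b :* c := c :* b :+ d :* a) refl a b c d } }

module ThetaSeries where
  open CommutativeRing seriesRing hiding (zero)
  open IntegerSolver seriesRing
  open SumsProducts seriesRing
  open Telescope seriesRing q
  open import Algebra.Properties.Ring ring using (-‿distribˡ-*)
  open import Algebra.Properties.Semiring.Exp semiring using (_^_; ^-congˡ; ^-homo-*)
  open import Relation.Binary.Reasoning.Setoid setoid
  open Signed using (divides) renaming (_∣_ to _∣ₛ_)

  -- Truncation, substitution and dissection

  infix 4 _≈[_]_

  record _≈[_]_ (f : Series) (n : ℕ) (g : Series) : Set where
    constructor agree
    field below : ∀ {m} → m < n → f m ≡ g m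

  open _≈[_]_ public

  ≈⇒≈ₙ : ∀ {n f g} → f ≈ g → f ≈[ n ] g
  ≈⇒≈ₙ p = agree λ _ → at p _

  ≈ₙ⇒≈ : ∀ {f g} → (∀ n → f ≈[ n ] g) → f ≈ g
  ≈ₙ⇒≈ p = pointwise λ m → below (p (suc m)) ℕₚ.≤-refl

  ≈ₙ-refl : ∀ {n f} → f ≈[ n ] f
  ≈ₙ-refl = ≈⇒≈ₙ refl

  ≈ₙ-trans : ∀ {n f g h} → f ≈[ n ] g → g ≈[ n ] h → f ≈[ n ] h
  ≈ₙ-trans p q = agree λ m<n → P.trans (below p m<n) (below q m<n)

  ≈ₙ-sym : ∀ {n f g} → f ≈[ n ] g → g ≈[ n ] f
  ≈ₙ-sym p = agree λ m<n → P.sym (below p m<n)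

  ≈ₙ-weaken : ∀ {m n f g} → m ≤ n → f ≈[ n ] g → f ≈[ m ] g
  ≈ₙ-weaken m≤n p = agree λ k<m → below p (ℕₚ.≤-trans k<m m≤n)

  opaque
    unfolding addₛ mulₛ negₛ

    +-cong-≈ₙ : ∀ {n f f′ g g′} → f ≈[ n ] f′ → g ≈[ n ] g′ → f + g ≈[ n ] f′ + g′
    +-cong-≈ₙ p q = agree λ m<n → P.cong₂ ℤ._+_ (below p m<n) (below q m<n)

    *-cong-≈ₙ : ∀ {n f f′ g g′} → f ≈[ n ] f′ → g ≈[ n ] g′ → f * g ≈[ n ] f′ * g′
    *-cong-≈ₙ p q = agree (go p q)
      where
      go : ∀ {n f f′ g g′} → f ≈[ n ] f′ → g ≈[ n ] g′ → ∀ {m} → m < n → (f ⊛ g) m ≡ (f′ ⊛ g′) m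
      go p q {zero}  m<n = P.cong₂ (λ a b → a ℤ.* b ℤ.+ 0ℤ) (below p m<n) (below q m<n)
      go {suc n} {f} {f′} {g} {g′} p q {suc m} (s≤s m<n) =
        P.cong₂ ℤ._+_ (P.cong₂ ℤ._*_ (below p (s≤s z≤n)) (below q (s≤s m<n)))
          (go {n} {tail f} {tail f′} {g} {g′} (agree λ k<n → below p (s≤s k<n))
            (agree λ k<n → below q (ℕₚ.m≤n⇒m≤1+n k<n)) m<n)

    q*-zero : ∀ f → (q * f) 0 ≡ 0ℤ
    q*-zero f = P.refl

    q*-suc : ∀ f n → (q * f) (suc n) ≡ f n
    q*-suc f n = P.trans (ℤₚ.+-identityˡ _)
      (P.trans (⊛-cong {f = tail q} {f′ = 𝟙} {g = f} (λ { zero → P.refl ; (suc _) → P.refl }) (λ _ → P.refl) n) (⊛-identityˡ f n))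

    +-coeff : ∀ f g n → (f + g) n ≡ f n ℤ.+ g n
    +-coeff f g n = P.refl

    neg-coeff : ∀ f n → (- f) n ≡ ℤ.- f n
    neg-coeff f n = P.refl

    constant-* : ∀ {f g} → f 0 ≡ 1ℤ → g 0 ≡ 1ℤ → (f * g) 0 ≡ 1ℤ
    constant-* {f} {g} p q = P.cong₂ (λ a b → a ℤ.* b ℤ.+ 0ℤ) p q

    inverseʳ : ∀ f → f 0 ≡ 1ℤ → f * f ⁻¹ ≈ 1#
    inverseʳ f f₀ = pointwise (⊛-inverse f f₀)

  q^*-< : ∀ n f → q ^ n * f ≈[ n ] 0#
  q^*-< zero    f = agree λ ()
  q^*-< (suc n) f = ≈ₙ-trans (≈⇒≈ₙ (*-assoc q (q ^ n) f)) (agree (shifted _))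
    where
    shifted : ∀ m → m < suc n → (q * (q ^ n * f)) m ≡ 0ℤ
    shifted zero    _         = q*-zero (q ^ n * f)
    shifted (suc m) (s≤s m<n) = P.trans (q*-suc (q ^ n * f) m) (below (q^*-< n f) m<n)

  mod⇒≈ : ∀ {f g n} → f ≈ g [mod n ] → f ≈[ n ] g
  mod⇒≈ {g = g} {n} (h , p) = ≈ₙ-trans (≈⇒≈ₙ p)
    (≈ₙ-trans (+-cong-≈ₙ ≈ₙ-refl (q^*-< n h)) (≈⇒≈ₙ (+-identityʳ g)))

  *-cancelˡ-≈ₙ : ∀ {n f g h} → f 0 ≡ 1ℤ → f * g ≈[ n ] f * h → g ≈[ n ] h
  *-cancelˡ-≈ₙ {n} {f} {g} {h} f₀ p = ≈ₙ-trans (≈⇒≈ₙ (sym (lem g)))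
    (≈ₙ-trans (*-cong-≈ₙ ≈ₙ-refl p) (≈⇒≈ₙ (lem h)))
    where
    lem : ∀ g → f ⁻¹ * (f * g) ≈ g
    lem g = begin
      f ⁻¹ * (f * g)   ≈⟨ solve 3 (λ a b c → a :* (b :* c) := b :* a :* c) refl (f ⁻¹) f g ⟩
      f * f ⁻¹ * g     ≈⟨ *-congʳ (inverseʳ f f₀) ⟩
      1# * g           ≈⟨ *-identityˡ g ⟩
      g                ∎

  -- The recursion is f(q²) = f₀ + q² (tail f)(q²), along tails like that of `⊛`.
  D : Series → Series
  D f zero          = f 0
  D f (suc zero)    = 0ℤ
  D f (suc (suc n)) = D (tail f) n

  D-cong : ∀ {f g} → f ≗ g → D f ≗ D g
  D-cong p zero          = p 0
  D-cong p (suc zero)    = P.refl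
  D-cong p (suc (suc n)) = D-cong (p ∘ suc) n

  D-⊕ : ∀ f g → D (f ⊕ g) ≗ D f ⊕ D g
  D-⊕ f g zero          = P.refl
  D-⊕ f g (suc zero)    = P.refl
  D-⊕ f g (suc (suc n)) = D-⊕ (tail f) (tail g) n

  D-⊝ : ∀ f → D (⊝ f) ≗ ⊝ D f
  D-⊝ f zero          = P.refl
  D-⊝ f (suc zero)    = P.refl
  D-⊝ f (suc (suc n)) = D-⊝ (tail f) n

  D-scale : ∀ a f → D (scale a f) ≗ scale a (D f)
  D-scale a f zero          = P.refl
  D-scale a f (suc zero)    = P.sym (ℤₚ.*-zeroʳ a)
  D-scale a f (suc (suc n)) = D-scale a (tail f) n

  D-𝟘 : D 𝟘 ≗ 𝟘
  D-𝟘 zero          = P.refl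
  D-𝟘 (suc zero)    = P.refl
  D-𝟘 (suc (suc n)) = D-𝟘 n

  D-𝟙 : D 𝟙 ≗ 𝟙
  D-𝟙 zero          = P.refl
  D-𝟙 (suc zero)    = P.refl
  D-𝟙 (suc (suc n)) = D-𝟘 n

  D-⊛ : ∀ f g → D (f ⊛ g) ≗ D f ⊛ D g
  D-⊛ f g zero          = P.refl
  D-⊛ f g (suc zero)    = P.sym (P.cong₂ (λ a b → a ℤ.+ (b ℤ.+ 0ℤ)) (ℤₚ.*-zeroʳ (f 0))
    (ℤₚ.*-zeroˡ (g 0)))
  D-⊛ f g (suc (suc n)) = E.begin
    D (scale (f 0) (tail g) ⊕ tail f ⊛ g) n
      E.≡⟨ D-⊕ (scale (f 0) (tail g)) (tail f ⊛ g) n ⟩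
    D (scale (f 0) (tail g)) n ℤ.+ D (tail f ⊛ g) n
      E.≡⟨ P.cong₂ ℤ._+_ (D-scale (f 0) (tail g) n) (D-⊛ (tail f) g n) ⟩
    f 0 ℤ.* D (tail g) n ℤ.+ (D (tail f) ⊛ D g) n
      E.≡⟨ P.cong (ℤ._+_ (f 0 ℤ.* D (tail g) n)) (ℤₚ.+-identityˡ _) ⟨
    (D f ⊛ D g) (suc (suc n)) E.∎
    where module E = P.≡-Reasoning

  opaque
    unfolding addₛ mulₛ negₛ

    D-hom : RingMorphisms.IsRingHomomorphism rawRing rawRing D
    D-hom = ringHomomorphism {R = seriesRing} {S = seriesRing} D (λ p → pointwise (D-cong (at p)))
      (λ f g → pointwise (D-⊕ f g)) (λ f g → pointwise (D-⊛ f g)) (λ f → pointwise (D-⊝ f))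
        (pointwise D-𝟘) (pointwise D-𝟙)

  module D = Hom {R = seriesRing} {S = seriesRing} D-hom

  D-q : D q ≈ q * q
  D-q = pointwise λ where
      zero                → P.sym (q*-zero q)
      (suc zero)          → P.sym (q*-suc q 0)
      (suc (suc zero))    → P.sym (q*-suc q 1)
      (suc (suc (suc n))) → P.sym (P.trans (q*-suc q (suc (suc n))) (P.sym (lem n)))
    where
    lem : ∀ n → D (tail q) (suc n) ≡ 0ℤ
    lem zero    = P.refl
    lem (suc n) = P.trans (D-cong (λ _ → P.refl) n) (D-𝟘 n)

  D-cong-≈ₙ : ∀ {n f g} → f ≈[ n ] g → D f ≈[ n ] D g
  D-cong-≈ₙ p = agree (go p)
    where
    go : ∀ {n f g} → f ≈[ n ] g → ∀ {m} → m < n → D f m ≡ D g m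
    go p {zero}        m<n = below p m<n
    go p {suc zero}    m<n = P.refl
    go {suc n} {f} {g} p {suc (suc m)} (s≤s m<n) = go {n} {tail f} {tail g}
      (agree λ k<n → below p (s≤s k<n)) (ℕₚ.<⇒≤ m<n)

  U : Series → Series
  U f n = f (dbl n)

  U-D : ∀ f → U (D f) ≗ f
  U-D f zero    = P.refl
  U-D f (suc n) = U-D (tail f) n

  dbl-mono-< : ∀ {m n} → m < n → dbl m < dbl n
  dbl-mono-< {zero}  (s≤s _)   = s≤s z≤n
  dbl-mono-< {suc m} (s≤s m<n) = s≤s (s≤s (dbl-mono-< m<n))

  n≤dbl : ∀ n → n ≤ dbl n
  n≤dbl zero    = z≤n
  n≤dbl (suc n) = s≤s (ℕₚ.m≤n⇒m≤1+n (n≤dbl n))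

  -- Precision is halved, since coefficient m of f sits at index 2m of f(q²).
  D-injective-≈ₙ : ∀ {n f g} → D f ≈[ dbl n ] D g → f ≈[ n ] g
  D-injective-≈ₙ {f = f} {g} p = agree λ m<n →
    P.trans (P.sym (U-D f _)) (P.trans (below p (dbl-mono-< m<n)) (U-D g _))

  U-cong : ∀ {f g} → f ≈ g → U f ≈ U g
  U-cong p = pointwise λ n → at p (dbl n)

  opaque
    unfolding addₛ mulₛ negₛ

    U-+ : ∀ f g → U (f + g) ≈ U f + U g
    U-+ f g = pointwise λ _ → P.refl

    -- A series in q² has even exponents only, hence acts as a scalar on the extraction of even
    -- coefficients.
    U-D-* : ∀ f g → U (D f * g) ≈ f * U g
    U-D-* f g = pointwise (go f g)
      where
      go : ∀ f g → U (D f ⊛ g) ≗ f ⊛ U g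
      go f g zero    = P.refl
      go f g (suc n) = P.cong (ℤ._+_ (f 0 ℤ.* U g (suc n)))
        (P.trans (ℤₚ.+-identityˡ _) (go (tail f) g n))

  U-q*D : ∀ f → U (q * D f) ≈ 0#
  U-q*D f = pointwise λ where
      zero    → q*-zero (D f)
      (suc n) → P.trans (q*-suc (D f) (suc (dbl n))) (odd f n)
    where
    odd : ∀ f n → D f (suc (dbl n)) ≡ 0ℤ
    odd f zero    = P.refl
    odd f (suc n) = odd (tail f) n

  σ : Series → Series
  σ f zero    = f 0
  σ f (suc n) = ℤ.- σ (tail f) n

  σ-cong : ∀ {f g} → f ≗ g → σ f ≗ σ g
  σ-cong p zero    = p 0
  σ-cong p (suc n) = P.cong ℤ.-_ (σ-cong (p ∘ suc) n)

  σ-⊕ : ∀ f g → σ (f ⊕ g) ≗ σ f ⊕ σ g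
  σ-⊕ f g zero    = P.refl
  σ-⊕ f g (suc n) = P.trans (P.cong ℤ.-_ (σ-⊕ (tail f) (tail g) n))
    (ℤₚ.neg-distrib-+ (σ (tail f) n) (σ (tail g) n))

  σ-scale : ∀ a f → σ (scale a f) ≗ scale a (σ f)
  σ-scale a f zero    = P.refl
  σ-scale a f (suc n) = P.trans (P.cong ℤ.-_ (σ-scale a (tail f) n))
    (ℤₚ.neg-distribʳ-* a (σ (tail f) n))

  σ-⊝ : ∀ f → σ (⊝ f) ≗ ⊝ σ f
  σ-⊝ f zero    = P.refl
  σ-⊝ f (suc n) = P.cong ℤ.-_ (σ-⊝ (tail f) n)

  σ-𝟘 : σ 𝟘 ≗ 𝟘
  σ-𝟘 zero    = P.refl
  σ-𝟘 (suc n) = P.cong ℤ.-_ (σ-𝟘 n)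

  σ-𝟙 : σ 𝟙 ≗ 𝟙
  σ-𝟙 zero    = P.refl
  σ-𝟙 (suc n) = P.cong ℤ.-_ (σ-𝟘 n)

  σ-⊛ : ∀ f g → σ (f ⊛ g) ≗ σ f ⊛ σ g
  σ-⊛ f g zero    = P.refl
  σ-⊛ f g (suc n) = E.begin
    ℤ.- σ (scale (f 0) (tail g) ⊕ tail f ⊛ g) n
      E.≡⟨ P.cong ℤ.-_ (P.trans (σ-⊕ (scale (f 0) (tail g)) (tail f ⊛ g) n)
        (P.cong₂ ℤ._+_ (σ-scale (f 0) (tail g) n) (σ-⊛ (tail f) g n))) ⟩
    ℤ.- (f 0 ℤ.* σ (tail g) n ℤ.+ (σ (tail f) ⊛ σ g) n)
      E.≡⟨ Z.solve 3 (λ a b c → Z.:- (a Z.:* b Z.:+ c)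
        Z.:= a Z.:* (Z.:- b) Z.:+ Z.con (ℤ.- 1ℤ) Z.:* c) P.refl (f 0) (σ (tail g) n) _ ⟩
    f 0 ℤ.* ℤ.- σ (tail g) n ℤ.+ ℤ.- 1ℤ ℤ.* (σ (tail f) ⊛ σ g) n
      E.≡⟨ P.cong (ℤ._+_ (f 0 ℤ.* ℤ.- σ (tail g) n)) (scale-⊛ (ℤ.- 1ℤ) (σ (tail f)) (σ g) n) ⟨
    f 0 ℤ.* ℤ.- σ (tail g) n ℤ.+ (scale (ℤ.- 1ℤ) (σ (tail f)) ⊛ σ g) n
      E.≡⟨ P.cong (ℤ._+_ (f 0 ℤ.* ℤ.- σ (tail g) n))
        (⊛-cong {g = σ g} (λ m → ℤₚ.-1*i≡-i (σ (tail f) m)) (λ _ → P.refl) n) ⟩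
    (σ f ⊛ σ g) (suc n) E.∎
    where module E = P.≡-Reasoning

  opaque
    unfolding addₛ mulₛ negₛ

    σ-hom : RingMorphisms.IsRingHomomorphism rawRing rawRing σ
    σ-hom = ringHomomorphism {R = seriesRing} {S = seriesRing} σ (λ p → pointwise (σ-cong (at p)))
      (λ f g → pointwise (σ-⊕ f g)) (λ f g → pointwise (σ-⊛ f g)) (λ f → pointwise (σ-⊝ f))
        (pointwise σ-𝟘) (pointwise σ-𝟙)

  module σ = Hom {R = seriesRing} {S = seriesRing} σ-hom

  σ-cong-≈ₙ : ∀ {n f g} → f ≈[ n ] g → σ f ≈[ n ] σ g
  σ-cong-≈ₙ p = agree (go p)
    where
    go : ∀ {n f g} → f ≈[ n ] g → ∀ {m} → m < n → σ f m ≡ σ g m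
    go p {zero}  m<n = below p m<n
    go {suc n} {f} {g} p {suc m} (s≤s m<n) = P.cong ℤ.-_
      (go {n} {tail f} {tail g} (agree λ k<n → below p (s≤s k<n)) m<n)

  opaque
    unfolding addₛ mulₛ negₛ

    σ-q : σ q ≈ - q
    σ-q = pointwise λ where
      zero          → P.refl
      (suc zero)    → P.refl
      (suc (suc n)) → P.cong (λ a → ℤ.- ℤ.- a) (σ-𝟘 n)

    +-σ : ∀ f → f + σ f ≈ D (U f + U f)
    +-σ f = pointwise (go f)
      where
      go : ∀ f → f ⊕ σ f ≗ D (U f ⊕ U f)
      go f zero          = P.refl
      go f (suc zero)    = ℤₚ.+-inverseʳ (f 1)
      go f (suc (suc n)) = P.trans (P.cong (ℤ._+_ (f (suc (suc n)))) (ℤₚ.neg-involutive _))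
        (go (tail (tail f)) n)

  σ-D : ∀ f → σ (D f) ≈ D f
  σ-D f = pointwise (go f)
    where
    go : ∀ f → σ (D f) ≗ D f
    go f zero          = P.refl
    go f (suc zero)    = P.refl
    go f (suc (suc n)) = P.trans (ℤₚ.neg-involutive _) (go (tail f) n)

  -- For a `Convergent` sequence the terms of index above m do not reach q^m, so m + 1 terms give
  -- the exact coefficient. The shape is that of `v₀`.
  Lim : (ℕ → Series) → Series
  Lim s m = psum s (suc m) m

  Convergent : (ℕ → Series) → Set
  Convergent s = ∀ n → s n ≈[ n ] 0#

  psum-Lim : ∀ {s} → Convergent s → ∀ n → psum s n ≈[ n ] Lim s
  psum-Lim {s} conv n = agree (go n)
    where
    go : ∀ n {m} → m < n → psum s n m ≡ Lim s m
    go (suc n) {m} (s≤s m≤n) = case ℕₚ.m≤n⇒m<n∨m≡n m≤n of λ where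
      (inj₁ m<n) → P.trans (+-coeff (psum s n) (s n) m)
        (P.trans (P.cong (ℤ._+_ (psum s n m)) (below (conv n) m<n))
                     (P.trans (ℤₚ.+-identityʳ _) (go n m<n)))
      (inj₂ P.refl) → P.refl

  *-vanishʳ : ∀ {n f g} → g ≈[ n ] 0# → f * g ≈[ n ] 0#
  *-vanishʳ {f = f} p = ≈ₙ-trans (*-cong-≈ₙ ≈ₙ-refl p) (≈⇒≈ₙ (zeroʳ f))

  *-vanishˡ : ∀ {n f g} → f ≈[ n ] 0# → f * g ≈[ n ] 0#
  *-vanishˡ {f = f} {g} p = ≈ₙ-trans (≈⇒≈ₙ (*-comm f g)) (*-vanishʳ p)

  x-vanish : ∀ n → x n ≈[ suc n ] 0#
  x-vanish n = ≈ₙ-trans (≈⇒≈ₙ (x≈^ n)) (q^*-< (suc n) (q ^ n))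

  x-constant : ∀ n → x n 0 ≡ 0ℤ
  x-constant n = below (x-vanish n) (s≤s z≤n)

  sq-convergent : Convergent sq
  sq-convergent zero    = agree λ ()
  sq-convergent (suc n) = *-vanishʳ (x-vanish n)

  t-convergent : ∀ w e → Convergent (t w e)
  t-convergent w e zero    = agree λ ()
  t-convergent w e (suc n) = *-vanishʳ (*-vanishˡ (*-vanishˡ (x-vanish n)))

  -- Theta series and the dissection of φ

  tri : ℕ → Series
  tri zero    = 1#
  tri (suc n) = tri n * q ^ suc n

  tri-convergent : Convergent tri
  tri-convergent zero    = agree λ ()
  tri-convergent (suc n) = *-vanishʳ
    (≈ₙ-trans (≈⇒≈ₙ (sym (*-identityʳ (q ^ suc n)))) (q^*-< (suc n) 1#))

  φ φ̄ ψ : Series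
  φ = Lim sq + Lim sq - 1#
  φ̄ = σ φ
  ψ = Lim tri

  x-dbl : ∀ n → x (dbl n) * q ≈ x n * x n
  x-dbl zero    = refl
  x-dbl (suc n) = begin
    q * q * (q * q * x (dbl n)) * q
      ≈⟨ solve 2 (λ q x → q :* q :* (q :* q :* x) :* q
        := q :* q :* q :* q :* (x :* q)) refl q (x (dbl n)) ⟩
    q * q * q * q * (x (dbl n) * q)
      ≈⟨ *-congˡ (x-dbl n) ⟩
    q * q * q * q * (x n * x n)
      ≈⟨ solve 2 (λ q x → q :* q :* q :* q :* (x :* x)
        := q :* q :* x :* (q :* q :* x)) refl q (x n) ⟩
    x (suc n) * x (suc n) ∎

  D-x : ∀ n → D (x n) ≈ x n * x n
  D-x zero    = D-q
  D-x (suc n) = begin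
    D (q * q * x n)                ≈⟨ trans (D.*-homo (q * q) (x n))
      (*-cong (trans (D.*-homo q q) (*-cong D-q D-q)) (D-x n)) ⟩
    q * q * (q * q) * (x n * x n)  ≈⟨ solve 2 (λ q x → q :* q :* (q :* q) :* (x :* x)
      := q :* q :* x :* (q :* q :* x)) refl q (x n) ⟩
    x (suc n) * x (suc n)          ∎

  D-sq : ∀ n → D (sq n) ≈ t 0# (λ _ → 1#) n
  D-sq zero    = D.1#-homo
  D-sq (suc n) = trans (D.*-homo (sq n) (x n)) (*-cong (D-sq n) (trans (D-x n)
    (solve 1 (λ x → x :* x := x :* (:0 :+ x) :* :1) refl (x n))))

  DD-sq : ∀ n → D (D (sq n)) ≈ sq (dbl n)
  DD-sq zero    = trans (D.cong D.1#-homo) D.1#-homo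
  DD-sq (suc n) = begin
    D (D (sq n * x n))               ≈⟨ D.cong (D.*-homo (sq n) (x n)) ⟩
    D (D (sq n) * D (x n))           ≈⟨ D.*-homo (D (sq n)) (D (x n)) ⟩
    D (D (sq n)) * D (D (x n))       ≈⟨ *-cong (DD-sq n)
      (trans (D.cong (D-x n)) (trans (D.*-homo (x n) (x n)) (*-cong (D-x n) (D-x n)))) ⟩
    sq (dbl n) * (x n * x n * (x n * x n))
      ≈⟨ *-congˡ (*-cong (x-dbl n) (x-dbl n)) ⟨
    sq (dbl n) * (x (dbl n) * q * (x (dbl n) * q))
      ≈⟨ solve 3 (λ s x q → s :* (x :* q :* (x :* q))
        := s :* x :* (q :* q :* x)) refl (sq (dbl n)) (x (dbl n)) q ⟩
    sq (dbl n) * x (dbl n) * x (suc (dbl n)) ∎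

  D³ : Series → Series
  D³ f = D (D (D f))

  D³-* : ∀ f g → D³ (f * g) ≈ D³ f * D³ g
  D³-* f g = trans (D.cong (D.cong (D.*-homo f g)))
    (trans (D.cong (D.*-homo (D f) (D g))) (D.*-homo (D (D f)) (D (D g))))

  D-q^ : ∀ n → D (q ^ suc n) ≈ q * x n
  D-q^ zero    = trans (D.*-homo q 1#) (trans (*-cong D-q D.1#-homo) (*-identityʳ _))
  D-q^ (suc n) = trans (D.*-homo q (q ^ suc n)) (trans (*-cong D-q (D-q^ n))
    (solve 2 (λ q x → q :* q :* (q :* x) := q :* (q :* q :* x)) refl q (x n)))

  -- Odd squares are (2n+1)² = 1 + 8 · n(n+1)/2.
  D-tri : ∀ n → q * D³ (tri n) ≈ sq (suc (dbl n))
  D-tri zero    = trans (*-congˡ (trans (D.cong (trans (D.cong D.1#-homo) D.1#-homo)) D.1#-homo))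
    (*-comm q 1#)
  D-tri (suc n) = begin
    q * D³ (tri n * q ^ suc n)
      ≈⟨ *-congˡ (trans (D³-* (tri n) (q ^ suc n)) (*-congˡ (trans (D.cong (D.cong (D-q^ n)))
           (trans (D.cong (dd q (x n) D-q (D-x n))) (dd _ _ (D-square D-q) (D-square (D-x n))))))) ⟩
    q * (D³ (tri n) * (q * q * (q * q) * (x n * x n * (x n * x n))))
      ≈⟨ trans (sym (*-assoc _ _ _)) (*-cong (D-tri n)
        (*-congˡ (*-cong (sym (x-dbl n)) (sym (x-dbl n))))) ⟩
    sq (suc (dbl n)) * (q * q * (q * q) * (x (dbl n) * q * (x (dbl n) * q)))
      ≈⟨ solve 3 (λ s x q → s :* (q :* q :* (q :* q) :* (x :* q :* (x :* q)))
                   := s :* (q :* q :* x) :* (q :* q :* (q :* q :* x))) refl (sq (suc (dbl n)))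
                     (x (dbl n)) q ⟩
    sq (suc (dbl (suc n))) ∎
    where
    dd : ∀ f g {f′ g′} → D f ≈ f′ → D g ≈ g′ → D (f * g) ≈ f′ * g′
    dd f g p p′ = trans (D.*-homo f g) (*-cong p p′)
    D-square : ∀ {f} → D f ≈ f * f → D (f * f) ≈ f * f * (f * f)
    D-square p = dd _ _ p p

  psum-dbl : ∀ s n → psum s (dbl n) ≈ psum (s ∘ dbl) n + psum (s ∘ suc ∘ dbl) n
  psum-dbl s zero    = sym (+-identityˡ 0#)
  psum-dbl s (suc n) = trans (+-congʳ (+-congʳ (psum-dbl s n)))
    (solve 4 (λ a b c d → a :+ b :+ c :+ d
      := a :+ c :+ (b :+ d)) refl _ _ (s (dbl n)) (s (suc (dbl n))))

  psum-q* : ∀ s n → psum (λ k → q * s k) n ≈ q * psum s n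
  psum-q* s zero    = sym (zeroʳ q)
  psum-q* s (suc n) = trans (+-congʳ (psum-q* s n)) (sym (distribˡ q _ _))

  D³-psum : ∀ s n → D³ (psum s n) ≈ psum (λ k → D³ (s k)) n
  D³-psum s n = trans (D.cong (trans (D.cong (D.psum-homo s n)) (D.psum-homo (D ∘ s) n)))
    (D.psum-homo (D ∘ D ∘ s) n)

  -- The squares are split by parity: (2n)² = 4n² gives the first summand, `D-tri` the second.
  Lim-sq : Lim sq ≈ D (D (Lim sq)) + q * D³ ψ
  Lim-sq = ≈ₙ⇒≈ λ n → ≈ₙ-trans (≈ₙ-sym (≈ₙ-weaken (n≤dbl n) (psum-Lim sq-convergent (dbl n))))
    (≈ₙ-trans (≈⇒≈ₙ (trans (psum-dbl sq n) (+-cong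
        (sym (trans (D.cong (D.psum-homo sq n))
          (trans (D.psum-homo (D ∘ sq) n) (psum-cong DD-sq n))))
        (sym (trans (*-congˡ (D³-psum tri n))
          (trans (sym (psum-q* (D³ ∘ tri) n)) (psum-cong D-tri n)))))))
      (+-cong-≈ₙ (D-cong-≈ₙ (D-cong-≈ₙ (psum-Lim sq-convergent n)))
         (*-cong-≈ₙ ≈ₙ-refl (D-cong-≈ₙ (D-cong-≈ₙ (D-cong-≈ₙ (psum-Lim tri-convergent n)))))))

  φ-dissection : φ ≈ D (D φ) + (q * D³ ψ + q * D³ ψ)
  φ-dissection = begin
    Lim sq + Lim sq - 1#
      ≈⟨ +-congʳ (+-cong Lim-sq Lim-sq) ⟩
    D (D (Lim sq)) + q * D³ ψ + (D (D (Lim sq)) + q * D³ ψ) - 1#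
      ≈⟨ solve 3 (λ a b c → a :+ b :+ (a :+ b) :- c
        := a :+ a :- c :+ (b :+ b)) refl (D (D (Lim sq))) (q * D³ ψ) 1# ⟩
    D (D (Lim sq)) + D (D (Lim sq)) - 1# + (q * D³ ψ + q * D³ ψ)
      ≈⟨ +-congʳ (sym (begin
           D (D (Lim sq + Lim sq - 1#))                 ≈⟨ D.cong (D-θ (Lim sq)) ⟩
           D (D (Lim sq) + D (Lim sq) - 1#)             ≈⟨ D-θ (D (Lim sq)) ⟩
           D (D (Lim sq)) + D (D (Lim sq)) - 1#         ∎)) ⟩
    D (D φ) + (q * D³ ψ + q * D³ ψ) ∎
    where
    D-θ : ∀ f → D (f + f - 1#) ≈ D f + D f - 1#
    D-θ f = trans (D.+-homo (f + f) (- 1#))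
      (+-cong (D.+-homo f f) (trans (D.-‿homo 1#) (-‿cong D.1#-homo)))

  -- The generating function of v₀

  opaque
    unfolding addₛ mulₛ negₛ

    one-minus-constant : ∀ f → f 0 ≡ 0ℤ → (1# - f) 0 ≡ 1ℤ
    one-minus-constant f p = P.cong (λ a → 1ℤ ℤ.+ ℤ.- a) p

    one-plus-constant : ∀ f → f 0 ≡ 0ℤ → (1# + f) 0 ≡ 1ℤ
    one-plus-constant f p = P.cong (λ a → 1ℤ ℤ.+ a) p

    *-constantʳ : ∀ f g → g 0 ≡ 0ℤ → (f * g) 0 ≡ 0ℤ
    *-constantʳ f g p = P.trans (P.cong (λ a → f 0 ℤ.* a ℤ.+ 0ℤ) p)
      (P.cong (ℤ._+ 0ℤ) (ℤₚ.*-zeroʳ (f 0)))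

    neg-constant : ∀ f → f 0 ≡ 0ℤ → (- f) 0 ≡ 0ℤ
    neg-constant f p = P.cong ℤ.-_ p

    ^ˢ≈^ : ∀ f n → f ^ˢ n ≈ f ^ n
    ^ˢ≈^ f zero    = refl
    ^ˢ≈^ f (suc n) = *-congˡ {f} (^ˢ≈^ f n)

    qPochhammer-suc : ∀ a b n → qPochhammer a b (suc n) ≈ qPochhammer a b n * (1# - a * b ^ˢ n)
    qPochhammer-suc a b n = refl

    v₀-term-def : ∀ n → v₀-term n ≈ q ^ (n ℕ.* n) * qPochhammer (- q) (q ^ˢ 2) n * qPochhammer q
      (q ^ˢ 2) n ⁻¹
    v₀-term-def n = *-congʳ {qPochhammer q (q ^ˢ 2) n ⁻¹}
      (*-congʳ {qPochhammer (- q) (q ^ˢ 2) n} (^ˢ≈^ q (n ℕ.* n)))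

    ∑≡psum : ∀ (s : ℕ → Series) n m → (∑[ i < n ] s (toℕ i) m) ≡ psum s n m
    ∑≡psum s n m = P.trans (go s n) (P.sym (lem s n))
      where
      ps : (ℕ → ℤ) → ℕ → ℤ
      ps f zero    = 0ℤ
      ps f (suc n) = ps f n ℤ.+ f n
      lem : ∀ (s : ℕ → Series) n → psum s n m ≡ ps (λ k → s k m) n
      lem s zero    = P.refl
      lem s (suc n) = P.cong (ℤ._+ s n m) (lem s n)
      head : ∀ (f : ℕ → ℤ) n → ps f (suc n) ≡ f 0 ℤ.+ ps (f ∘ suc) n
      head f zero    = ℤₚ.+-comm 0ℤ (f 0)
      head f (suc n) = P.trans (P.cong (ℤ._+ f (suc n)) (head f n)) (ℤₚ.+-assoc (f 0) _ _)
      go : ∀ (s : ℕ → Series) n → (∑[ i < n ] s (toℕ i) m) ≡ ps (λ k → s k m) n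
      go s zero    = P.refl
      go s (suc n) = P.trans (P.cong (ℤ._+_ (s 0 m)) (go (s ∘ suc) n))
        (P.sym (head (λ k → s k m) n))

  e⁺ e⁻ : ℕ → Series
  e⁺ n = (1# - 1# * x n) ⁻¹
  e⁻ n = σ (e⁺ n)

  σ-x : ∀ n → σ (x n) ≈ - x n
  σ-x zero    = σ-q
  σ-x (suc n) = begin
    σ (q * q * x n)           ≈⟨ trans (σ.*-homo (q * q) (x n))
      (*-cong (trans (σ.*-homo q q) (*-cong σ-q σ-q)) (σ-x n)) ⟩
    - q * - q * - x n         ≈⟨ solve 2 (λ q x → :- q :* :- q :* :- x
      := :- (q :* q :* x)) refl q (x n) ⟩
    - (q * q * x n)           ∎

  e⁺-inverses : Inverses 1# e⁺
  e⁺-inverses n = trans (*-comm _ _)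
    (inverseʳ _ (one-minus-constant _ (*-constantʳ 1# (x n) (x-constant n))))

  e⁻-inverses : Inverses (- 1#) e⁻
  e⁻-inverses n = begin
    σ (e⁺ n) * (1# - - 1# * x n)
      ≈⟨ *-congˡ (solve 1 (λ x → :1 :- :- :1 :* x := :1 :- :1 :* :- x) refl (x n)) ⟩
    σ (e⁺ n) * (1# - 1# * - x n)
      ≈⟨ *-congˡ (trans (σ.+-homo 1# _) (+-cong σ.1#-homo (trans (σ.-‿homo _) (-‿cong
           (trans (σ.*-homo 1# (x n)) (*-cong σ.1#-homo (σ-x n))))))) ⟨
    σ (e⁺ n) * σ (1# - 1# * x n)
      ≈⟨ σ.*-homo _ _ ⟨
    σ (e⁺ n * (1# - 1# * x n))
      ≈⟨ trans (σ.cong (e⁺-inverses n)) σ.1#-homo ⟩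
    1# ∎

  -- All `x n` are odd powers of q, and under x ↦ -x the factor x (1 + x) / (1 - x) becomes x (-1 +
  -- x) / (1 + x): the sign of q plays the part of the sign of w. Thus the sum at w = -1 is the sum
  -- at w = 1 with q negated.
  σ-t : ∀ n → σ (t 1# e⁺ n) ≈ t (- 1#) e⁻ n
  σ-t zero    = σ.1#-homo
  σ-t (suc n) = begin
    σ (t 1# e⁺ n * (x n * (1# + x n) * e⁺ n))
      ≈⟨ trans (σ.*-homo _ _) (*-cong (σ-t n) (trans (σ.*-homo _ _) (*-congʳ (trans (σ.*-homo _ _)
           (*-cong (σ-x n) (trans (σ.+-homo 1# (x n)) (+-cong σ.1#-homo (σ-x n)))))))) ⟩
    t (- 1#) e⁻ n * (- x n * (1# - x n) * e⁻ n)
      ≈⟨ *-congˡ (*-congʳ (solve 1 (λ x → :- x :* (:1 :- x) := x :* (:- :1 :+ x)) refl (x n))) ⟩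
    t (- 1#) e⁻ n * (x n * (- 1# + x n) * e⁻ n) ∎

  q⊛q²^ : ∀ n → q * (q ^ˢ 2) ^ˢ n ≈ x n
  q⊛q²^ n = trans (*-congˡ (^ˢ≈^ (q ^ˢ 2) n)) (go n)
    where
    go : ∀ n → q * (q ^ˢ 2) ^ n ≈ x n
    go zero    = *-identityʳ q
    go (suc n) = begin
      q * (q ^ˢ 2 * (q ^ˢ 2) ^ n)     ≈⟨ *-congˡ
        (*-congʳ (trans (^ˢ≈^ q 2) (*-congˡ (*-identityʳ q)))) ⟩
      q * (q * q * (q ^ˢ 2) ^ n)      ≈⟨ solve 2 (λ q p → q :* (q :* q :* p)
        := q :* q :* (q :* p)) refl q _ ⟩
      q * q * (q * (q ^ˢ 2) ^ n)      ≈⟨ *-congˡ (go n) ⟩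
      q * q * x n                     ∎

  q^n² : ∀ n → q ^ (n ℕ.* n) ≈ sq n
  q^n² zero    = refl
  q^n² (suc n) = begin
    q ^ (suc n ℕ.* suc n)              ≡⟨ P.cong (q ^_) (lem n) ⟩
    q ^ (n ℕ.* n ℕ.+ (suc n ℕ.+ n))    ≈⟨ trans (^-homo-* q (n ℕ.* n) _)
      (*-congˡ (^-homo-* q (suc n) n)) ⟩
    q ^ (n ℕ.* n) * (q ^ suc n * q ^ n) ≈⟨ *-cong (q^n² n) (sym (x≈^ n)) ⟩
    sq n * x n                         ∎
    where
    lem : ∀ n → suc n ℕ.* suc n ≡ n ℕ.* n ℕ.+ (suc n ℕ.+ n)
    lem n = P.trans (P.cong (suc n ℕ.+_) (ℕₚ.*-suc n n))
      (P.trans (P.cong (suc n ℕ.+_) (ℕₚ.+-comm n (n ℕ.* n)))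
      (P.trans (P.sym (ℕₚ.+-assoc (suc n) (n ℕ.* n) n))
        (P.trans (P.cong (ℕ._+ n) (ℕₚ.+-comm (suc n) (n ℕ.* n))) (ℕₚ.+-assoc (n ℕ.* n) (suc n) n))))

  -- Cross-multiplied, because `t` inverts factor by factor while `v₀-term` inverts the whole
  -- denominator.
  t-pochhammer : ∀ n → t 1# e⁺ n * qPochhammer q (q ^ˢ 2) n ≈ sq n * qPochhammer (- q) (q ^ˢ 2) n
  t-pochhammer zero    = refl
  t-pochhammer (suc n) = begin
    t 1# e⁺ n * (x n * (1# + x n) * e⁺ n) * qPochhammer q (q ^ˢ 2) (suc n)
      ≈⟨ *-congˡ (trans (qPochhammer-suc q (q ^ˢ 2) n)
        (*-congˡ (+-congˡ (-‿cong (trans (q⊛q²^ n) (sym (*-identityˡ (x n)))))))) ⟩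
    t 1# e⁺ n * (x n * (1# + x n) * e⁺ n) * (P⁻ * (1# - 1# * x n))
      ≈⟨ solve 6 (λ t x a e p m → t :* (x :* a :* e) :* (p :* m)
        := t :* p :* (x :* a) :* (e :* m)) refl
           (t 1# e⁺ n) (x n) (1# + x n) (e⁺ n) P⁻ (1# - 1# * x n) ⟩
    t 1# e⁺ n * P⁻ * (x n * (1# + x n)) * (e⁺ n * (1# - 1# * x n))
      ≈⟨ *-cong (*-congʳ (t-pochhammer n)) (e⁺-inverses n) ⟩
    sq n * P⁺ * (x n * (1# + x n)) * 1#
      ≈⟨ solve 3 (λ s p x → s :* p :* (x :* (:1 :+ x)) :* :1
        := s :* x :* (p :* (:1 :- :- x))) refl (sq n) P⁺ (x n) ⟩
    sq n * x n * (P⁺ * (1# - - x n))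
      ≈⟨ *-congˡ (trans (qPochhammer-suc (- q) (q ^ˢ 2) n) (*-congˡ (+-congˡ (-‿cong
           (trans (solve 2 (λ q p → :- q :* p := :- (q :* p)) refl q _) (-‿cong (q⊛q²^ n))))))) ⟨
    sq (suc n) * qPochhammer (- q) (q ^ˢ 2) (suc n) ∎
    where
    P⁻ = qPochhammer q (q ^ˢ 2) n
    P⁺ = qPochhammer (- q) (q ^ˢ 2) n

  v₀-term≈t : ∀ n → v₀-term n ≈ t 1# e⁺ n
  v₀-term≈t n = begin
    v₀-term n                                          ≈⟨ v₀-term-def n ⟩
    q ^ (n ℕ.* n) * P⁺ * P⁻ ⁻¹                          ≈⟨ *-congʳ (*-congʳ (q^n² n)) ⟩
    sq n * P⁺ * P⁻ ⁻¹                                  ≈⟨ *-congʳ (t-pochhammer n) ⟨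
    t 1# e⁺ n * P⁻ * P⁻ ⁻¹                             ≈⟨ *-assoc _ _ _ ⟩
    t 1# e⁺ n * (P⁻ * P⁻ ⁻¹)                           ≈⟨ *-congˡ
      (inverseʳ P⁻ (denominator-constant (q ^ˢ 2) n)) ⟩
    t 1# e⁺ n * 1#                                     ≈⟨ *-identityʳ _ ⟩
    t 1# e⁺ n                                          ∎
    where
    P⁻ = qPochhammer q (q ^ˢ 2) n
    P⁺ = qPochhammer (- q) (q ^ˢ 2) n

  v₀≈Lim : v₀ ≈ Lim (t 1# e⁺)
  v₀≈Lim = pointwise λ m → P.trans (∑≡psum v₀-term (suc m) m) (at (psum-cong v₀-term≈t (suc m)) m)

  E : Series
  E = U v₀ + U v₀ - 1#

  G-real : ∀ n → G 1# e⁺ e⁻ n ≈[ n ] D E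
  G-real n = ≈ₙ-trans
    (+-cong-≈ₙ (≈ₙ-trans (≈⇒≈ₙ (+-congˡ (sym (trans (σ.psum-homo (t 1# e⁺) n) (psum-cong σ-t n)))))
                       (+-cong-≈ₙ lim (σ-cong-≈ₙ lim))) ≈ₙ-refl)
    (≈⇒≈ₙ (begin
      v₀ + σ v₀ - 1#              ≈⟨ +-cong (+-σ v₀) (-‿cong (sym D.1#-homo)) ⟩
      D (U v₀ + U v₀) - D 1#      ≈⟨ trans (D.+-homo (U v₀ + U v₀) (- 1#)) (+-congˡ (D.-‿homo 1#)) ⟨
      D E                         ∎))
    where
    lim : psum (t 1# e⁺) n ≈[ n ] v₀
    lim = ≈ₙ-trans (psum-Lim (t-convergent 1# e⁺) n) (≈⇒≈ₙ (sym v₀≈Lim))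

  Φ-limit : ∀ n → Φ n ≈[ n ] D φ
  Φ-limit n = ≈ₙ-trans (≈⇒≈ₙ (+-congʳ (+-cong lem lem)))
    (≈ₙ-trans (+-cong-≈ₙ (+-cong-≈ₙ lim lim) ≈ₙ-refl) (≈⇒≈ₙ (sym (trans (D.+-homo _ _)
      (+-cong (D.+-homo _ _) (trans (D.-‿homo 1#) (-‿cong D.1#-homo)))))))
    where
    lem : psum (t 0# (λ _ → 1#)) n ≈ D (psum sq n)
    lem = sym (trans (D.psum-homo sq n) (psum-cong D-sq n))
    lim : D (psum sq n) ≈[ n ] D (Lim sq)
    lim = D-cong-≈ₙ (psum-Lim sq-convergent n)

  -- Product formula at w = 1

  π : ℕ → Series → Series
  π = prod (q * q)

  D-π : ∀ n v → D (π n v) ≈ prod q⁴ n (D v)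
  D-π n v = trans (D.prod-homo (q * q) n v)
    (prod-cong (trans (D.*-homo q q) (*-cong D-q D-q)) refl n)

  π-constant : ∀ n v → v 0 ≡ 0ℤ → π n v 0 ≡ 1ℤ
  π-constant zero    v v₀ = P.refl
  π-constant (suc n) v v₀ = constant-* (π-constant n (q * q * v) (*-constantʳ (q * q) v v₀))
    (one-plus-constant v v₀)

  σ-π⁻ : ∀ n → σ (π n (- q)) ≈ π n q
  σ-π⁻ n = trans (σ.prod-homo (q * q) n (- q)) (prod-cong
    (trans (σ.*-homo q q) (trans (*-cong σ-q σ-q) (solve 1 (λ q → :- q :* :- q := q :* q) refl q)))
    (trans (σ.-‿homo q) (trans (-‿cong σ-q) (solve 1 (λ q → :- :- q := q) refl q))) n)

  σ-π⁺ : ∀ n → σ (π n q) ≈ π n (- q)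
  σ-π⁺ n = trans (σ.prod-homo (q * q) n q) (prod-cong
    (trans (σ.*-homo q q) (trans (*-cong σ-q σ-q) (solve 1 (λ q → :- q :* :- q := q :* q) refl q)))
      σ-q n)

  -- `G-limit` at w = 1 is an identity in q² throughout. Removing the substitution halves the
  -- precision, so `dbl n` factors are taken.
  E-product : ∀ n → π (dbl n) (- q) * E ≈[ n ] π (dbl n) q * φ
  E-product n = D-injective-≈ₙ (≈ₙ-trans
    (≈⇒≈ₙ (trans (D.*-homo _ _) (*-congʳ
      (trans (D-π (dbl n) (- q)) (prod-cong refl (trans (D.-‿homo q) (-‿cong
      (trans D-q (solve 1 (λ q → q :* q := q :* q :* (:1 :* :1)) refl q)))) (dbl n))))))
    (≈ₙ-trans (*-cong-≈ₙ ≈ₙ-refl (≈ₙ-sym (G-real (dbl n))))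
    (≈ₙ-trans (mod⇒≈ (G-limit e⁺-inverses e⁻-inverses (dbl n)))
    (≈ₙ-trans (*-cong-≈ₙ ≈ₙ-refl (Φ-limit (dbl n)))
    (≈⇒≈ₙ (sym (trans (D.*-homo _ _) (*-congʳ (trans (D-π (dbl n) q) (prod-cong refl
      (trans D-q (solve 1 (λ q → q :* q := q :* q :* (:1 :* :1)) refl q)) (dbl n)))))))))))

  -- Product formula at w = i

  𝔾 : CommutativeRing 0ℓ 0ℓ
  𝔾 = Gaussian.gaussianRing seriesRing

  module 𝔾 = CommutativeRing 𝔾
  module 𝔾T = Telescope 𝔾 (q , 0#)
  module 𝔾Σ = SumsProducts 𝔾

  real : Series → 𝔾.Carrier
  real f = f , 0#

  real-hom : RingMorphisms.IsRingHomomorphism rawRing 𝔾.rawRing real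
  real-hom = ringHomomorphism {R = seriesRing} {S = 𝔾} real (λ p → p , refl)
    (λ f g → refl , sym (+-identityˡ 0#))
    (λ f g → solve 2 (λ f g → f :* g := f :* g :- :0 :* :0) refl f g , solve 2 (λ f g → :0
      := f :* :0 :+ :0 :* g) refl f g)
    (λ f → refl , solve 0 (:0 := :- :0) refl) 𝔾.refl 𝔾.refl

  module real = Hom {R = seriesRing} {S = 𝔾} real-hom
  open real.Transport q

  -- The quotient may have an imaginary part; q^n being real, the real part of the equation is a
  -- congruence between series.
  real-mod⇒≈ : ∀ {f g n} → real f 𝔾T.≈ real g [mod n ] → f ≈[ n ] g
  real-mod⇒≈ {f} {g} {n} ((h , k) 𝔾T., p) = mod⇒≈
    (h , trans (proj₁ p) (+-congˡ (trans (proj₁ (𝔾.*-congʳ {h , k} (𝔾.sym (^-homo n))))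
    (solve 3 (λ a h k → a :* h :- :0 :* k := a :* h) refl (q ^ n) h k))))

  i : 𝔾.Carrier
  i = 0# , 1#

  i²≈-1 : i 𝔾.* i 𝔾.≈ 𝔾.- 𝔾.1#
  i²≈-1 = solve 0 (:0 :* :0 :- :1 :* :1 := :- :1) refl , solve 0 (:0 :* :1 :+ :1 :* :0
    := :- :0) refl

  e₀ : ℕ → Series
  e₀ n = (1# + x n * x n) ⁻¹

  -- 1 / (1 - ix) = (1 + ix) / (1 + x²), and its conjugate.
  eᵢ e₋ᵢ : ℕ → 𝔾.Carrier
  eᵢ n  = e₀ n , x n * e₀ n
  e₋ᵢ n = e₀ n , - (x n * e₀ n)

  e₀-inverse : ∀ n → (1# + x n * x n) * e₀ n ≈ 1#
  e₀-inverse n = inverseʳ _ (one-plus-constant _ (*-constantʳ (x n) (x n) (x-constant n)))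

  eᵢ-inverses : 𝔾T.Inverses i eᵢ
  eᵢ-inverses n = 𝔾.trans (𝔾.*-congˡ {eᵢ n}
    (𝔾.+-congˡ {𝔾.1#} (𝔾.-‿cong (𝔾.*-congˡ {i} (𝔾.sym (x-homo n))))))
    ( trans (solve 2 (λ x e → e :* (:1 :- (:0 :* x :- :1 :* :0)) :- x :* e
      :* (:0 :- (:0 :* :0 :+ :1 :* x))
                       := (:1 :+ x :* x) :* e) refl (x n) (e₀ n)) (e₀-inverse n)
    , solve 2 (λ x e → e :* (:0 :- (:0 :* :0 :+ :1 :* x)) :+ x :* e :* (:1 :- (:0 :* x :- :1 :* :0))
      := :0) refl (x n) (e₀ n))

  e₋ᵢ-inverses : 𝔾T.Inverses (𝔾.- i) e₋ᵢ
  e₋ᵢ-inverses n = 𝔾.trans (𝔾.*-congˡ {e₋ᵢ n}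
    (𝔾.+-congˡ {𝔾.1#} (𝔾.-‿cong (𝔾.*-congˡ {𝔾.- i} (𝔾.sym (x-homo n))))))
    ( trans (solve 2 (λ x e → e :* (:1 :- (:- :0 :* x :- :- :1 :* :0)) :- (:- (x :* e))
      :* (:0 :- (:- :0 :* :0 :+ :- :1 :* x))
                       := (:1 :+ x :* x) :* e) refl (x n) (e₀ n)) (e₀-inverse n)
    , solve 2 (λ x e → e :* (:0 :- (:- :0 :* :0 :+ :- :1 :* x)) :+ (:- (x :* e))
      :* (:1 :- (:- :0 :* x :- :- :1 :* :0)) := :0) refl (x n) (e₀ n))

  D-alt : ∀ n → D (alt n) ≈ alt n
  D-alt zero    = D.1#-homo
  D-alt (suc n) = trans (D.-‿homo _) (-‿cong (D-alt n))

  σ-sq : ∀ n → σ (sq n) ≈ alt n * sq n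
  σ-sq zero    = trans σ.1#-homo (sym (*-identityˡ 1#))
  σ-sq (suc n) = trans (σ.*-homo _ _) (trans (*-cong (σ-sq n) (σ-x n))
    (solve 3 (λ a s x → a :* s :* :- x := :- a :* (s :* x)) refl (alt n) (sq n) (x n)))

  DDσ-sq : ∀ n → D (D (σ (sq n))) ≈ alt n * sq (dbl n)
  DDσ-sq n = begin
    D (D (σ (sq n)))              ≈⟨ D.cong (D.cong (σ-sq n)) ⟩
    D (D (alt n * sq n))          ≈⟨ trans (D.cong (D.*-homo _ _)) (D.*-homo _ _) ⟩
    D (D (alt n)) * D (D (sq n))  ≈⟨ *-cong (trans (D.cong (D-alt n)) (D-alt n)) (DD-sq n) ⟩
    alt n * sq (dbl n)            ∎

  altSum : ℕ → Series
  altSum n = psum (λ m → alt m * sq (dbl m)) n + psum (λ m → alt m * sq (dbl m)) n - 1#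

  altSum-limit : ∀ n → altSum n ≈[ n ] D (D φ̄)
  altSum-limit n = ≈ₙ-trans (+-cong-≈ₙ (+-cong-≈ₙ lim lim) ≈ₙ-refl) (≈⇒≈ₙ (sym (begin
    D (D (σ (Lim sq + Lim sq - 1#)))
      ≈⟨ D.cong (D.cong (h-θ σ-hom (Lim sq))) ⟩
    D (D (σ (Lim sq) + σ (Lim sq) - 1#))
      ≈⟨ D.cong (h-θ D-hom (σ (Lim sq))) ⟩
    D (D (σ (Lim sq)) + D (σ (Lim sq)) - 1#)
      ≈⟨ h-θ D-hom (D (σ (Lim sq))) ⟩
    D (D (σ (Lim sq))) + D (D (σ (Lim sq))) - 1# ∎)))
    where
    h-θ : ∀ {h} → RingMorphisms.IsRingHomomorphism rawRing rawRing h → ∀ f →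
      h (f + f - 1#) ≈ h f + h f - 1#
    h-θ {h} hom f = trans (H.+-homo _ _)
      (+-cong (H.+-homo _ _) (trans (H.-‿homo _) (-‿cong H.1#-homo)))
      where module H = Hom {R = seriesRing} {S = seriesRing} hom
    lim : psum (λ m → alt m * sq (dbl m)) n ≈[ n ] D (D (σ (Lim sq)))
    lim = ≈ₙ-trans (≈⇒≈ₙ (trans (psum-cong (λ m → sym (DDσ-sq m)) n)
        (sym (trans (D.cong (trans (D.cong (σ.psum-homo sq n)) (D.psum-homo (σ ∘ sq) n)))
          (D.psum-homo (D ∘ σ ∘ sq) n)))))
      (D-cong-≈ₙ (D-cong-≈ₙ (σ-cong-≈ₙ (psum-Lim sq-convergent n))))

  real-altSum : ∀ n → 𝔾T.G i eᵢ e₋ᵢ (dbl n) 𝔾.≈ real (altSum n)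
  real-altSum n = 𝔾.trans (𝔾T.G-imaginary i²≈-1 eᵢ-inverses e₋ᵢ-inverses n)
    (𝔾.sym (𝔾.trans (real.+-homo (s + s) (- 1#))
      (𝔾.+-cong (𝔾.trans (real.+-homo s s) (𝔾.+-cong lem lem)) (real.-‿homo 1#))))
    where
    s = psum (λ m → alt m * sq (dbl m)) n
    lem : real s 𝔾.≈ 𝔾Σ.psum (λ m → 𝔾T.alt m 𝔾.* 𝔾T.sq (dbl m)) n
    lem = 𝔾.trans (real.psum-homo _ n)
      (𝔾Σ.psum-cong (λ m → 𝔾.trans (real.*-homo (alt m) (sq (dbl m)))
      (𝔾.*-cong (alt-homo m) (sq-homo (dbl m)))) n)

  altSum-product : ∀ n → prod q⁴ (dbl n) (q * q) * altSum n ≈[ dbl n ] prod q⁴ (dbl n) (- (q * q))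
    * Φ (dbl n)
  altSum-product n = real-mod⇒≈ (𝔾T.trans[] (𝔾T.≈⇒≈[] lhs)
    (𝔾T.trans[] (𝔾T.G-limit eᵢ-inverses e₋ᵢ-inverses (dbl n)) (𝔾T.≈⇒≈[] (𝔾.sym rhs))))
    where
    real-q⁴ : real q⁴ 𝔾.≈ 𝔾T.q⁴
    real-q⁴ = 𝔾.trans (real.*-homo (q * q) (q * q)) (𝔾.*-cong (real.*-homo q q) (real.*-homo q q))
    real-q²i² : real (- (q * q)) 𝔾.≈ real q 𝔾.* real q 𝔾.* (i 𝔾.* i)
    real-q²i² = 𝔾.trans (real.cong (solve 1 (λ q → :- (q :* q) := q :* q :* :- :1) refl q))
      (𝔾.trans (real.*-homo (q * q) (- 1#))
        (𝔾.*-cong (real.*-homo q q) (𝔾.trans (real.-‿homo 1#) (𝔾.sym i²≈-1))))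
    lhs : real (prod q⁴ (dbl n) (q * q) * altSum n) 𝔾.≈
          𝔾Σ.prod 𝔾T.q⁴ (dbl n) (𝔾.- (real q 𝔾.* real q 𝔾.* (i 𝔾.* i))) 𝔾.* 𝔾T.G i eᵢ e₋ᵢ (dbl n)
    lhs = 𝔾.trans (real.*-homo (prod q⁴ (dbl n) (q * q)) (altSum n)) (𝔾.*-cong
      (𝔾.trans (real.prod-homo q⁴ (dbl n) (q * q)) (𝔾Σ.prod-cong real-q⁴
        (𝔾.trans (real.cong (solve 1 (λ q → q :* q := :- (:- (q :* q))) refl q))
          (𝔾.trans (real.-‿homo (- (q * q))) (𝔾.-‿cong real-q²i²))) (dbl n)))
      (𝔾.sym (real-altSum n)))
    rhs : real (prod q⁴ (dbl n) (- (q * q)) * Φ (dbl n)) 𝔾.≈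
          𝔾Σ.prod 𝔾T.q⁴ (dbl n) (real q 𝔾.* real q 𝔾.* (i 𝔾.* i)) 𝔾.* 𝔾T.Φ (dbl n)
    rhs = 𝔾.trans (real.*-homo (prod q⁴ (dbl n) (- (q * q))) (Φ (dbl n))) (𝔾.*-cong
      (𝔾.trans (real.prod-homo q⁴ (dbl n) (- (q * q))) (𝔾Σ.prod-cong real-q⁴ real-q²i² (dbl n)))
        (Φ-homo (dbl n)))

  -- The k terms of G(i) form `dbl n` pairs, which determine φ(-q⁴) to precision `dbl n`; undoing q
  -- ↦ q² leaves n. Hence the double doubling.
  φ̄-product : ∀ n → let k = dbl (dbl n) in π k q * D φ̄ ≈[ n ] π k (- q) * φ
  φ̄-product n = D-injective-≈ₙ (≈ₙ-trans
    (≈⇒≈ₙ (trans (D.*-homo _ _) (*-congʳ (trans (D-π k q) (prod-cong refl D-q k)))))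
    (≈ₙ-trans (*-cong-≈ₙ ≈ₙ-refl (≈ₙ-sym (altSum-limit (dbl n))))
    (≈ₙ-trans (≈ₙ-weaken (n≤dbl (dbl n)) (altSum-product (dbl n)))
    (≈ₙ-trans (*-cong-≈ₙ ≈ₙ-refl (≈ₙ-weaken (n≤dbl (dbl n)) (Φ-limit k)))
    (≈⇒≈ₙ (sym (trans (D.*-homo _ _)
      (*-congʳ (trans (D-π k (- q)) (prod-cong refl (trans (D.-‿homo q) (-‿cong D-q)) k))))))))))
    where k = dbl (dbl n)

  E*Dφ̄≈φ² : E * D φ̄ ≈ φ * φ
  E*Dφ̄≈φ² = ≈ₙ⇒≈ λ n → let k = dbl (dbl n) in
    *-cancelˡ-≈ₙ (constant-* (π-constant k (- q) (neg-constant q P.refl)) (π-constant k q P.refl))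
    (≈ₙ-trans (≈⇒≈ₙ (solve 4 (λ a b c d → a :* b :* (c :* d)
      := a :* c :* (b :* d)) refl (π k (- q)) (π k q) E (D φ̄)))
    (≈ₙ-trans (*-cong-≈ₙ (≈ₙ-weaken (n≤dbl n) (E-product (dbl n))) (φ̄-product n))
    (≈⇒≈ₙ (solve 3 (λ a b c → b :* c :* (a :* c)
      := a :* b :* (c :* c)) refl (π k (- q)) (π k q) φ))))

  -- q ↦ -q exchanges the two products of `φ̄-product` and fixes φ(-q²). Multiplying the formula by
  -- its image and cancelling both products leaves the identity.
  φ*φ̄ : φ * φ̄ ≈ D φ̄ * D φ̄
  φ*φ̄ = ≈ₙ⇒≈ λ n → let k = dbl (dbl n) in
    *-cancelˡ-≈ₙ (constant-* (π-constant k (- q) (neg-constant q P.refl)) (π-constant k q P.refl))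
    (≈ₙ-sym (≈ₙ-trans (≈⇒≈ₙ (solve 3 (λ a b c → a :* b :* (c :* c)
      := b :* c :* (a :* c)) refl (π k (- q)) (π k q) (D φ̄)))
    (≈ₙ-trans (*-cong-≈ₙ (φ̄-product n) (≈ₙ-trans
        (≈⇒≈ₙ (sym (trans (σ.*-homo _ _) (*-cong (σ-π⁺ k) (σ-D φ̄)))))
        (≈ₙ-trans (σ-cong-≈ₙ (φ̄-product n)) (≈⇒≈ₙ (trans (σ.*-homo _ _) (*-congʳ (σ-π⁻ k)))))))
    (≈⇒≈ₙ (solve 4 (λ a b c d → a :* c :* (b :* d)
      := a :* b :* (c :* d)) refl (π k (- q)) (π k q) φ φ̄)))))

  -- Theta function identities

  -- `D-cong-≈ₙ` only preserves the precision; the doubling here is what drives the induction for Δ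
  -- in `φ²+φ̄²`.
  D-cong-dbl : ∀ {n f g} → f ≈[ n ] g → D f ≈[ dbl n ] D g
  D-cong-dbl p = agree (go p)
    where
    go : ∀ {n f g} → f ≈[ n ] g → ∀ {m} → m < dbl n → D f m ≡ D g m
    go {suc n} p {zero}     m<n = below p (s≤s z≤n)
    go {suc n} p {suc zero} m<n = P.refl
    go {suc n} {f} {g} p {suc (suc m)} (s≤s (s≤s m<n)) = go {n} {tail f} {tail g}
      (agree λ k<n → below p (s≤s k<n)) m<n

  DD : Series → Series
  DD f = D (D f)

  DD-hom : RingMorphisms.IsRingHomomorphism rawRing rawRing DD
  DD-hom = ∘-hom {R = seriesRing} {S = seriesRing} {T = seriesRing} D-hom D-hom

  module DD = Hom {R = seriesRing} {S = seriesRing} DD-hom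

  b : Series
  b = q * D³ ψ + q * D³ ψ

  φ≈ : φ ≈ DD φ + b
  φ≈ = φ-dissection

  σ-b : σ b ≈ - b
  σ-b = trans (σ.+-homo _ _) (trans (+-cong lem lem)
    (solve 1 (λ x → :- x :+ :- x := :- (x :+ x)) refl (q * D³ ψ)))
    where
    lem : σ (q * D³ ψ) ≈ - (q * D³ ψ)
    lem = trans (σ.*-homo _ _) (trans (*-cong σ-q (σ-D _))
      (solve 2 (λ q x → :- q :* x := :- (q :* x)) refl q (D³ ψ)))

  φ̄≈ : φ̄ ≈ DD φ - b
  φ̄≈ = trans (σ.cong φ≈) (trans (σ.+-homo _ _) (+-cong (σ-D _) σ-b))

  -- Write φ² + φ̄² = (φ + φ̄)² - 2 φ φ̄, where φ + φ̄ = 2 φ(q⁴) by the dissection and φ φ̄ =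
  -- φ(-q²)². The right side is then 4 φ(q⁴)² - 2 φ(-q²)², which relates the defect to itself at q².
  φ²+φ̄² : φ * φ + φ̄ * φ̄ ≈ D (φ * φ) + D (φ * φ)
  φ²+φ̄² = begin
    φ * φ + φ̄ * φ̄
      ≈⟨ solve 2 (λ a d → a := a :- d :+ d) refl _ (D (φ * φ) + D (φ * φ)) ⟩
    Δ + (D (φ * φ) + D (φ * φ))
      ≈⟨ +-congʳ (≈ₙ⇒≈ Δ-vanishes) ⟩
    0# + (D (φ * φ) + D (φ * φ))
      ≈⟨ +-identityˡ _ ⟩
    D (φ * φ) + D (φ * φ) ∎
    where
    Δ : Series
    Δ = φ * φ + φ̄ * φ̄ - (D (φ * φ) + D (φ * φ))

    -- Δ(q) = - 2 Δ(q²) forces Δ = 0.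
    Δ-doubling : Δ ≈ - (D Δ + D Δ)
    Δ-doubling = begin
      φ * φ + φ̄ * φ̄ - (D (φ * φ) + D (φ * φ))
        ≈⟨ solve 3 (λ f g d → f :* f :+ g :* g :- (d :+ d)
          := (f :+ g) :* (f :+ g) :- (f :* g :+ f :* g) :- (d :+ d)) refl φ φ̄ (D (φ * φ)) ⟩
      (φ + φ̄) * (φ + φ̄) - (φ * φ̄ + φ * φ̄) - (D (φ * φ) + D (φ * φ))
        ≈⟨ +-congʳ (+-cong (*-cong φ+φ̄ φ+φ̄) (-‿cong (+-cong φ*φ̄ φ*φ̄))) ⟩
      (DD φ + DD φ) * (DD φ + DD φ) - (D φ̄ * D φ̄ + D φ̄ * D φ̄) - (D (φ * φ) + D (φ * φ))
        ≈⟨ solve 3 (λ a g d → (a :+ a) :* (a :+ a) :- (g :+ g) :- (d :+ d)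
                      := :- (d :+ g :- (a :* a :+ a :* a) :+ (d :+ g :- (a :* a :+ a :* a)))) refl
                        (DD φ) (D φ̄ * D φ̄) (D (φ * φ)) ⟩
      - (D (φ * φ) + D φ̄ * D φ̄ - (DD φ * DD φ + DD φ * DD φ)
        + (D (φ * φ) + D φ̄ * D φ̄ - (DD φ * DD φ + DD φ * DD φ)))
        ≈⟨ -‿cong (+-cong DΔ DΔ) ⟨
      - (D Δ + D Δ) ∎
      where
      φ+φ̄ : φ + φ̄ ≈ DD φ + DD φ
      φ+φ̄ = trans (+-cong φ≈ φ̄≈) (solve 2 (λ a b → a :+ b :+ (a :- b) := a :+ a) refl (DD φ) b)
      DΔ : D Δ ≈ D (φ * φ) + D φ̄ * D φ̄ - (DD φ * DD φ + DD φ * DD φ)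
      DΔ = trans (D.+-homo _ _) (+-cong (trans (D.+-homo _ _) (+-congˡ (D.*-homo φ̄ φ̄)))
             (trans (D.-‿homo _) (-‿cong (trans (D.+-homo _ _)
               (+-cong (DD.*-homo φ φ) (DD.*-homo φ φ))))))

    Δ₀ : Δ 0 ≡ 0ℤ
    Δ₀ = ℤₚ.*-cancelˡ-≡ (+ 3) (Δ 0) 0ℤ
      (P.trans (Z.solve 1 (λ d → Z.con (+ 3) Z.:* d Z.:= d Z.:- (Z.:- (d Z.:+ d))) P.refl (Δ 0))
      (P.trans (P.cong (ℤ._- ℤ.- (Δ 0 ℤ.+ Δ 0))
        (P.trans (at Δ-doubling 0) (P.trans (neg-coeff (D Δ + D Δ) 0)
        (P.cong ℤ.-_ (+-coeff (D Δ) (D Δ) 0)))))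
        (ℤₚ.+-inverseʳ (ℤ.- (Δ 0 ℤ.+ Δ 0)))))

    neg-double-0 : - (D 0# + D 0#) ≈ 0#
    neg-double-0 = trans (-‿cong (trans (+-cong D.0#-homo D.0#-homo) (+-identityˡ 0#)))
      (solve 0 (:- :0 := :0) refl)

    Δ-vanishes : ∀ n → Δ ≈[ n ] 0#
    Δ-vanishes zero          = agree λ ()
    Δ-vanishes (suc zero)    = agree λ { (s≤s z≤n) → Δ₀ }
    Δ-vanishes (suc (suc n)) = ≈ₙ-trans (≈⇒≈ₙ Δ-doubling)
      (≈ₙ-trans (neg-cong (+-cong-≈ₙ (DΔ (Δ-vanishes (suc n))) (DΔ (Δ-vanishes (suc n)))))
      (≈⇒≈ₙ neg-double-0))
      where
      DΔ : Δ ≈[ suc n ] 0# → D Δ ≈[ suc (suc n) ] D 0#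
      DΔ p = ≈ₙ-weaken (s≤s (s≤s (n≤dbl n))) (D-cong-dbl p)
      neg-cong : ∀ {n f g} → f ≈[ n ] g → - f ≈[ n ] - g
      neg-cong {f = f} {g} p = agree λ {m} m<n → P.trans (neg-coeff f m) (P.trans (P.cong ℤ.-_ (below p m<n)) (P.sym (neg-coeff g m)))

  double-injective : ∀ {f g} → f + f ≈ g + g → f ≈ g
  double-injective {f} {g} p = pointwise λ n → ℤₚ.*-cancelˡ-≡ (+ 2) (f n) (g n)
    (P.trans (two (f n)) (P.trans (P.sym (+-coeff f f n))
      (P.trans (at p n) (P.trans (+-coeff g g n) (P.sym (two (g n)))))))
    where
    two : ∀ a → + 2 ℤ.* a ≡ a ℤ.+ a
    two = Z.solve 1 (λ a → Z.con (+ 2) Z.:* a Z.:= a Z.:+ a) P.refl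

  -- φ² + φ̄² is twice the even part of φ², so that even part is φ(q²)².
  U-φ² : U (φ * φ) ≈ φ * φ
  U-φ² = double-injective (begin
    U (φ * φ) + U (φ * φ)
      ≈⟨ pointwise (U-D (U (φ * φ) + U (φ * φ))) ⟨
    U (D (U (φ * φ) + U (φ * φ)))
      ≈⟨ U-cong (+-σ (φ * φ)) ⟨
    U (φ * φ + σ (φ * φ))
      ≈⟨ U-cong (trans (+-congˡ (σ.*-homo φ φ)) φ²+φ̄²) ⟩
    U (D (φ * φ) + D (φ * φ))
      ≈⟨ U-+ _ _ ⟩
    U (D (φ * φ)) + U (D (φ * φ))
      ≈⟨ +-cong (pointwise (U-D (φ * φ))) (pointwise (U-D (φ * φ))) ⟩
    φ * φ + φ * φ ∎)

  W : Series
  W = U E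

  -- Even parts of E φ(-q²) = φ² are compared, with φ(-q²) as a scalar.
  φ̄*W : φ̄ * W ≈ φ * φ
  φ̄*W = trans (sym (U-D-* φ̄ E)) (trans (U-cong (trans (*-comm _ _) E*Dφ̄≈φ²)) U-φ²)

  opaque
    unfolding addₛ mulₛ negₛ

    φ-constant : φ 0 ≡ 1ℤ
    φ-constant = P.refl

  -- Parametrisation by r

  I J : Series
  I = φ̄ ⁻¹
  J = φ ⁻¹

  φ̄*I : φ̄ * I ≈ 1#
  φ̄*I = inverseʳ φ̄ φ-constant

  φ*J : φ * J ≈ 1#
  φ*J = inverseʳ φ φ-constant

  inverse-unique : ∀ {f g h} → f * g ≈ 1# → f * h ≈ 1# → g ≈ h
  inverse-unique {f} {g} {h} p p′ = begin
    g           ≈⟨ *-identityˡ g ⟨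
    1# * g      ≈⟨ *-congʳ p′ ⟨
    f * h * g   ≈⟨ solve 3 (λ f g h → f :* h :* g := f :* g :* h) refl f g h ⟩
    f * g * h   ≈⟨ *-congʳ p ⟩
    1# * h      ≈⟨ *-identityˡ h ⟩
    h           ∎

  y z : Series
  y = (φ * I) ^ 4
  z = (φ̄ * J) ^ 4

  y*z : y * z ≈ 1#
  y*z = begin
    (φ * I) ^ 4 * (φ̄ * J) ^ 4
      ≈⟨ solve 4 (λ f g i j → (f :* i) :^ 4 :* (g :* j) :^ 4
        := ((g :* i) :* (f :* j)) :^ 4) refl φ φ̄ I J ⟩
    ((φ̄ * I) * (φ * J)) ^ 4
      ≈⟨ ^-congˡ 4 (*-cong φ̄*I φ*J) ⟩
    (1# * 1#) ^ 4
      ≈⟨ solve 0 ((:1 :* :1) :^ 4 := :1) refl ⟩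
    1# ∎

  -- In classical notation at the nome q⁴: A = θ₃, Ā = θ₄, b = θ₂, r = θ₂/θ₃, Z̄ = (θ₄/θ₃)⁴ = 1 - λ
  -- and Y = 1 / (1 - λ).
  A Ā K r Y Z̄ : Series
  A = DD φ
  Ā = DD φ̄
  K = DD J
  r = b * K
  Y = DD y
  Z̄ = DD z

  A*K : A * K ≈ 1#
  A*K = trans (sym (DD.*-homo φ J)) (trans (DD.cong φ*J) DD.1#-homo)

  Y*Z̄ : Y * Z̄ ≈ 1#
  Y*Z̄ = trans (sym (DD.*-homo y z)) (trans (DD.cong y*z) DD.1#-homo)

  b≈A*r : b ≈ A * r
  b≈A*r = sym (trans (solve 3 (λ a b k → a :* (b :* k) := a :* k :* b) refl A b K)
    (trans (*-congʳ A*K) (*-identityˡ b)))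

  φ≈A[1+r] : φ ≈ A * (1# + r)
  φ≈A[1+r] = trans φ≈ (trans (+-congˡ b≈A*r)
    (solve 2 (λ a r → a :+ a :* r := a :* (:1 :+ r)) refl A r))

  φ̄≈A[1-r] : φ̄ ≈ A * (1# - r)
  φ̄≈A[1-r] = trans φ̄≈ (trans (+-congˡ (-‿cong b≈A*r))
    (solve 2 (λ a r → a :- a :* r := a :* (:1 :- r)) refl A r))

  -- Jacobi's quartic identity θ₃⁴ - θ₂⁴ = θ₄⁴ at q⁴. Twice the left side factors as φ φ̄ (φ² +
  -- φ̄²), that is 2 φ(-q²)² φ(q²)², and φ(q²) φ(-q²) = φ(-q⁴)².
  A⁴-b⁴ : A ^ 4 - b ^ 4 ≈ Ā ^ 4
  A⁴-b⁴ = double-injective (begin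
    A ^ 4 - b ^ 4 + (A ^ 4 - b ^ 4)
      ≈⟨ solve 2 (λ a b → a :^ 4 :- b :^ 4 :+ (a :^ 4 :- b :^ 4)
           := (a :+ b) :* (a :- b) :* ((a :+ b) :* (a :+ b) :+ (a :- b) :* (a :- b))) refl A b ⟩
    (A + b) * (A - b) * ((A + b) * (A + b) + (A - b) * (A - b))
      ≈⟨ *-cong (*-cong φ≈ φ̄≈) (+-cong (*-cong φ≈ φ≈) (*-cong φ̄≈ φ̄≈)) ⟨
    φ * φ̄ * (φ * φ + φ̄ * φ̄)
      ≈⟨ *-cong (trans φ*φ̄ (sym (D.*-homo φ̄ φ̄))) φ²+φ̄² ⟩
    D (φ̄ * φ̄) * (D (φ * φ) + D (φ * φ))
      ≈⟨ solve 2 (λ a b → a :* (b :+ b) := a :* b :+ a :* b) refl (D (φ̄ * φ̄)) (D (φ * φ)) ⟩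
    D (φ̄ * φ̄) * D (φ * φ) + D (φ̄ * φ̄) * D (φ * φ)
      ≈⟨ +-cong lem lem ⟩
    Ā ^ 4 + Ā ^ 4 ∎)
    where
    lem : D (φ̄ * φ̄) * D (φ * φ) ≈ Ā ^ 4
    lem = begin
      D (φ̄ * φ̄) * D (φ * φ)
        ≈⟨ D.*-homo (φ̄ * φ̄) (φ * φ) ⟨
      D (φ̄ * φ̄ * (φ * φ))
        ≈⟨ D.cong (solve 2 (λ f g → g :* g :* (f :* f) := f :* g :* (f :* g)) refl φ φ̄) ⟩
      D (φ * φ̄ * (φ * φ̄))
        ≈⟨ D.cong (*-cong φ*φ̄ φ*φ̄) ⟩
      D (D φ̄ * D φ̄ * (D φ̄ * D φ̄))
        ≈⟨ trans (D.*-homo _ _) (*-cong (D.*-homo _ _) (D.*-homo _ _)) ⟩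
      Ā * Ā * (Ā * Ā)
        ≈⟨ solve 1 (λ a → a :* a :* (a :* a) := a :^ 4) refl Ā ⟩
      Ā ^ 4 ∎

  DD-^ : ∀ f n → DD (f ^ n) ≈ DD f ^ n
  DD-^ f zero    = DD.1#-homo
  DD-^ f (suc n) = trans (DD.*-homo f (f ^ n)) (*-congˡ (DD-^ f n))

  r⁴ : r ^ 4 ≈ 1# - Z̄
  r⁴ = begin
    (b * K) ^ 4
      ≈⟨ solve 3 (λ a b k → (b :* k) :^ 4
        := (a :* k) :^ 4 :- (a :^ 4 :- b :^ 4) :* k :^ 4) refl A b K ⟩
    (A * K) ^ 4 - (A ^ 4 - b ^ 4) * K ^ 4
      ≈⟨ +-cong (^-congˡ 4 A*K) (-‿cong (*-congʳ A⁴-b⁴)) ⟩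
    1# ^ 4 - Ā ^ 4 * K ^ 4
      ≈⟨ solve 2 (λ a k → :1 :^ 4 :- a :^ 4 :* k :^ 4 := :1 :- (a :* k) :^ 4) refl Ā K ⟩
    1# - (Ā * K) ^ 4
      ≈⟨ +-congˡ (-‿cong (trans (DD-^ (φ̄ * J) 4) (^-congˡ 4 (DD.*-homo φ̄ J)))) ⟨
    1# - Z̄ ∎

  [1-r⁴]Y : (1# - r ^ 4) * Y ≈ 1#
  [1-r⁴]Y = trans (*-congʳ (trans (+-congˡ (-‿cong r⁴))
    (solve 1 (λ z → :1 :- (:1 :- z) := z) refl Z̄))) (trans (*-comm _ _) Y*Z̄)

  -- 1 / (1 - r) = (1 + r) (1 + r²) / (1 - r⁴), and 1 / (1 - r⁴) is Y, so no division by a series in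
  -- r remains.
  I≈ : I ≈ (1# + r) * (1# + r * r) * Y * K
  I≈ = inverse-unique φ̄*I (begin
    φ̄ * ((1# + r) * (1# + r * r) * Y * K)
      ≈⟨ *-congʳ φ̄≈A[1-r] ⟩
    A * (1# - r) * ((1# + r) * (1# + r * r) * Y * K)
      ≈⟨ solve 4 (λ a r y k → a :* (:1 :- r) :* ((:1 :+ r) :* (:1 :+ r :* r) :* y :* k)
        := (:1 :- r :^ 4) :* y :* (a :* k)) refl A r Y K ⟩
    (1# - r ^ 4) * Y * (A * K)
      ≈⟨ trans (*-cong [1-r⁴]Y A*K) (*-identityˡ 1#) ⟩
    1# ∎)

  J≈ : J ≈ (1# - r) * (1# + r * r) * Y * K
  J≈ = inverse-unique φ*J (begin
    φ * ((1# - r) * (1# + r * r) * Y * K)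
      ≈⟨ *-congʳ φ≈A[1+r] ⟩
    A * (1# + r) * ((1# - r) * (1# + r * r) * Y * K)
      ≈⟨ solve 4 (λ a r y k → a :* (:1 :+ r) :* ((:1 :- r) :* (:1 :+ r :* r) :* y :* k)
        := (:1 :- r :^ 4) :* y :* (a :* k)) refl A r Y K ⟩
    (1# - r ^ 4) * Y * (A * K)
      ≈⟨ trans (*-cong [1-r⁴]Y A*K) (*-identityˡ 1#) ⟩
    1# ∎)

  φ*I≈ : φ * I ≈ (1# + r) * (1# + r) * (1# + r * r) * Y
  φ*I≈ = trans (*-cong φ≈A[1+r] I≈) (trans
    (solve 4 (λ a r y k → a :* (:1 :+ r) :* ((:1 :+ r) :* (:1 :+ r :* r) :* y :* k)
      := (:1 :+ r) :* (:1 :+ r) :* (:1 :+ r :* r) :* y :* (a :* k)) refl A r Y K)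
    (trans (*-congˡ A*K) (*-identityʳ _)))

  φ̄*J≈ : φ̄ * J ≈ (1# - r) * (1# - r) * (1# + r * r) * Y
  φ̄*J≈ = trans (*-cong φ̄≈A[1-r] J≈) (trans
    (solve 4 (λ a r y k → a :* (:1 :- r) :* ((:1 :- r) :* (:1 :+ r :* r) :* y :* k)
      := (:1 :- r) :* (:1 :- r) :* (:1 :+ r :* r) :* y :* (a :* k)) refl A r Y K)
    (trans (*-congˡ A*K) (*-identityʳ _)))

  W≈ : W ≈ A * ((1# + r) ^ 3 * (1# + r * r) * Y)
  W≈ = begin
    W                          ≈⟨ *-identityˡ W ⟨
    1# * W                     ≈⟨ *-congʳ φ̄*I ⟨
    φ̄ * I * W                  ≈⟨ solve 3 (λ g i w → g :* i :* w := i :* (g :* w)) refl φ̄ I W ⟩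
    I * (φ̄ * W)                ≈⟨ *-congˡ φ̄*W ⟩
    I * (φ * φ)                ≈⟨ solve 2 (λ i f → i :* (f :* f) := f :* (f :* i)) refl I φ ⟩
    φ * (φ * I)                ≈⟨ *-cong φ≈A[1+r] φ*I≈ ⟩
    A * (1# + r) * ((1# + r) * (1# + r) * (1# + r * r) * Y)
      ≈⟨ solve 3 (λ a r y → a :* (:1 :+ r) :* ((:1 :+ r) :* (:1 :+ r) :* (:1 :+ r :* r) :* y)
           := a :* ((:1 :+ r) :^ 3 :* (:1 :+ r :* r) :* y)) refl A r Y ⟩
    A * ((1# + r) ^ 3 * (1# + r * r) * Y) ∎

  X : Series
  X = y - 1#

  -- X = (φ⁴ - φ̄⁴) / φ̄⁴ and (1 + r)⁴ - (1 - r)⁴ = 8 r (1 + r²): this 8 is the factor gained with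
  -- every application of U₄.
  X≈ : X ≈ ⟦ + 8 ⟧ * (r * (1# + r * r) * ((1# + r) * (1# + r * r) * Y) ^ 4)
  X≈ = begin
    (φ * I) ^ 4 - 1#
      ≈⟨ +-congˡ (-‿cong (trans (^-congˡ 4 φ̄*I) (solve 0 (:1 :^ 4 := :1) refl))) ⟨
    (φ * I) ^ 4 - (φ̄ * I) ^ 4
      ≈⟨ solve 3 (λ f g i → (f :* i) :^ 4 :- (g :* i) :^ 4
        := (f :^ 4 :- g :^ 4) :* i :^ 4) refl φ φ̄ I ⟩
    (φ ^ 4 - φ̄ ^ 4) * I ^ 4
      ≈⟨ *-cong (+-cong (^-congˡ 4 φ≈A[1+r]) (-‿cong (^-congˡ 4 φ̄≈A[1-r]))) (^-congˡ 4 I≈) ⟩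
    ((A * (1# + r)) ^ 4 - (A * (1# - r)) ^ 4) * ((1# + r) * (1# + r * r) * Y * K) ^ 4
      ≈⟨ solve 5 (λ a k r v y → ((a :* (:1 :+ r)) :^ 4 :- (a :* (:1 :- r)) :^ 4) :* (v :* y :* k) :^
        4
           := con (+ 8) :* (r :* (:1 :+ r :* r) :* (v :* y) :^ 4) :* (a :* k) :^ 4) refl A K r
             ((1# + r) * (1# + r * r)) Y ⟩
    ⟦ + 8 ⟧ * (r * (1# + r * r) * ((1# + r) * (1# + r * r) * Y) ^ 4) * (A * K) ^ 4
      ≈⟨ *-congˡ (trans (^-congˡ 4 A*K) (solve 0 (:1 :^ 4 := :1) refl)) ⟩
    ⟦ + 8 ⟧ * (r * (1# + r * r) * ((1# + r) * (1# + r * r) * Y) ^ 4) * 1#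
      ≈⟨ *-identityʳ _ ⟩
    ⟦ + 8 ⟧ * (r * (1# + r * r) * ((1# + r) * (1# + r * r) * Y) ^ 4) ∎

  -- The action of U₄

  -- The subring ℤ[y, y⁻¹]; the inverse is needed to express r⁴.
  data T : Series → Set where
    y∈ : T y
    z∈ : T z
    1∈ : T 1#
    +∈ : ∀ {f g} → T f → T g → T (f + g)
    *∈ : ∀ {f g} → T f → T g → T (f * g)
    -∈ : ∀ {f} → T f → T (- f)
    ≈∈ : ∀ {f g} → f ≈ g → T f → T g

  0∈ : T 0#
  0∈ = ≈∈ (-‿inverseʳ 1#) (+∈ 1∈ (-∈ 1∈))

  -- Series in the ring generated by r over the image of ℤ[y, y⁻¹] under q ↦ q⁴. As r only has
  -- exponents that are 1 modulo 4, the summands are the parts of f in the residue classes modulo 4.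
  record Decomposition (f : Series) : Set where
    constructor decomposition
    field
      {c₀ c₁ c₂ c₃} : Series
      c₀∈ : T c₀
      c₁∈ : T c₁
      c₂∈ : T c₂
      c₃∈ : T c₃
      sum≈ : f ≈ DD c₀ + r * (DD c₁ + r * (DD c₂ + r * DD c₃))

  ≈-dec : ∀ {f g} → f ≈ g → Decomposition f → Decomposition g
  ≈-dec p (decomposition a b c d e) = decomposition a b c d (trans (sym p) e)

  DD-dec : ∀ {f} → T f → Decomposition (DD f)
  DD-dec {f} f∈ = decomposition f∈ 0∈ 0∈ 0∈ (sym (trans
    (+-congˡ (*-congˡ (+-cong DD.0#-homo (*-congˡ (+-cong DD.0#-homo (*-congˡ DD.0#-homo))))))
    (solve 2 (λ f r → f :+ r :* (:0 :+ r :* (:0 :+ r :* :0)) := f) refl (DD f) r)))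

  +-dec : ∀ {f g} → Decomposition f → Decomposition g → Decomposition (f + g)
  +-dec (decomposition {a} {b} {c} {d} a∈ b∈ c∈ d∈ p)
    (decomposition {a′} {b′} {c′} {d′} a′∈ b′∈ c′∈ d′∈ p′) =
    decomposition (+∈ a∈ a′∈) (+∈ b∈ b′∈) (+∈ c∈ c′∈) (+∈ d∈ d′∈) (trans (+-cong p p′) (trans
      (solve 9 (λ r a b c d a′ b′ c′ d′ →
        a :+ r :* (b :+ r :* (c :+ r :* d)) :+ (a′ :+ r :* (b′ :+ r :* (c′ :+ r :* d′)))
         := (a :+ a′) :+ r :* ((b :+ b′) :+ r :* ((c :+ c′) :+ r :* (d :+ d′))))
         refl r (DD a) (DD b) (DD c) (DD d) (DD a′) (DD b′) (DD c′) (DD d′))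
      (sym (+-cong (DD.+-homo a a′) (*-congˡ
        (+-cong (DD.+-homo b b′) (*-congˡ
        (+-cong (DD.+-homo c c′) (*-congˡ (DD.+-homo d d′))))))))))

  DD*-dec : ∀ {e f} → T e → Decomposition f → Decomposition (DD e * f)
  DD*-dec {e} e∈ (decomposition {a} {b} {c} {d} a∈ b∈ c∈ d∈ p) =
    decomposition (*∈ e∈ a∈) (*∈ e∈ b∈) (*∈ e∈ c∈) (*∈ e∈ d∈) (trans (*-congˡ p) (trans
      (solve 6 (λ r e a b c d → e :* (a :+ r :* (b :+ r :* (c :+ r :* d)))
         := e :* a :+ r :* (e :* b :+ r :* (e :* c :+ r :* (e :* d)))) refl r (DD e) (DD a) (DD b)
           (DD c) (DD d))
      (sym (+-cong (DD.*-homo e a) (*-congˡ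
        (+-cong (DD.*-homo e b) (*-congˡ (+-cong (DD.*-homo e c) (*-congˡ (DD.*-homo e d))))))))))

  -- The coefficients shift by one place, and r⁴ = 1 - z(q⁴) brings the last one back as the first.
  r*-dec : ∀ {f} → Decomposition f → Decomposition (r * f)
  r*-dec {f} (decomposition {a} {b} {c} {d} a∈ b∈ c∈ d∈ p) =
    decomposition (*∈ (+∈ 1∈ (-∈ z∈)) d∈) a∈ b∈ c∈ (trans (*-congˡ p) (trans
      (solve 5 (λ r a b c d → r :* (a :+ r :* (b :+ r :* (c :+ r :* d)))
        := r :^ 4 :* d :+ r :* (a :+ r :* (b :+ r :* c)))
         refl r (DD a) (DD b) (DD c) (DD d))
      (+-congʳ (sym (trans (DD.*-homo (1# - z) d) (*-congʳ (trans (DD.+-homo 1# (- z))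
         (trans (+-cong DD.1#-homo (DD.-‿homo z)) (sym r⁴)))))))))

  *-dec : ∀ {f g} → Decomposition f → Decomposition g → Decomposition (f * g)
  *-dec {f} {g} (decomposition {a} {b} {c} {d} a∈ b∈ c∈ d∈ p) g∈ = ≈-dec
    (sym (trans (*-congʳ p) (solve 6 (λ r a b c d g → (a :+ r :* (b :+ r :* (c :+ r :* d))) :* g
       := a :* g :+ r :* (b :* g :+ r :* (c :* g :+ r :* (d :* g)))) refl r (DD a) (DD b) (DD c)
         (DD d) g)))
    (+-dec (DD*-dec a∈ g∈) (r*-dec (+-dec (DD*-dec b∈ g∈)
      (r*-dec (+-dec (DD*-dec c∈ g∈) (r*-dec (DD*-dec d∈ g∈)))))))

  1-dec : Decomposition 1#
  1-dec = ≈-dec DD.1#-homo (DD-dec 1∈)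

  r-dec : Decomposition r
  r-dec = ≈-dec (*-identityʳ r) (r*-dec 1-dec)

  neg-dec : ∀ {f} → Decomposition f → Decomposition (- f)
  neg-dec {f} f∈ = ≈-dec (trans (*-congʳ (trans (DD.-‿homo 1#) (-‿cong DD.1#-homo)))
    (solve 1 (λ f → :- :1 :* f := :- f) refl f))
    (DD*-dec (-∈ 1∈) f∈)

  ^-dec : ∀ {f} n → Decomposition f → Decomposition (f ^ n)
  ^-dec zero    f∈ = 1-dec
  ^-dec (suc n) f∈ = *-dec f∈ (^-dec n f∈)

  1+r-dec : Decomposition (1# + r)
  1+r-dec = +-dec 1-dec r-dec

  1-r-dec : Decomposition (1# - r)
  1-r-dec = +-dec 1-dec (neg-dec r-dec)

  1+r²-dec : Decomposition (1# + r * r)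
  1+r²-dec = +-dec 1-dec (*-dec r-dec r-dec)

  -- By `φ*I≈` and `φ̄*J≈`, y and 1/y are polynomials in r and y(q⁴); the decomposable series are
  -- closed under the ring operations.
  T⇒dec : ∀ {f} → T f → Decomposition f
  T⇒dec y∈ = ≈-dec (sym (^-congˡ 4 φ*I≈))
    (^-dec 4 (*-dec (*-dec (*-dec 1+r-dec 1+r-dec) 1+r²-dec) (DD-dec y∈)))
  T⇒dec z∈ = ≈-dec (sym (^-congˡ 4 φ̄*J≈))
    (^-dec 4 (*-dec (*-dec (*-dec 1-r-dec 1-r-dec) 1+r²-dec) (DD-dec y∈)))
  T⇒dec 1∈ = 1-dec
  T⇒dec (+∈ p p′) = +-dec (T⇒dec p) (T⇒dec p′)
  T⇒dec (*∈ p p′) = *-dec (T⇒dec p) (T⇒dec p′)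
  T⇒dec (-∈ p) = neg-dec (T⇒dec p)
  T⇒dec (≈∈ e p) = ≈-dec e (T⇒dec p)

  UU : Series → Series
  UU f = U (U f)

  UU-cong : ∀ {f g} → f ≈ g → UU f ≈ UU g
  UU-cong p = U-cong (U-cong p)

  UU-+ : ∀ f g → UU (f + g) ≈ UU f + UU g
  UU-+ f g = trans (U-cong (U-+ f g)) (U-+ (U f) (U g))

  UU-DD* : ∀ f g → UU (DD f * g) ≈ f * UU g
  UU-DD* f g = trans (U-cong (U-D-* (D f) g)) (U-D-* f (U g))

  UU-DD : ∀ f → UU (DD f) ≈ f
  UU-DD f = pointwise λ n → P.trans (U-D (D f) (dbl n)) (U-D f n)

  -- The series with r = q s(q⁴). Thus r, r², r³ have exponents 1, 2, 3 modulo 4 and are annihilated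
  -- by `UU`, also with cofactors in q⁴.
  s : Series
  s = (D ψ + D ψ) * J

  r≈ : r ≈ q * DD s
  r≈ = begin
    (q * D³ ψ + q * D³ ψ) * K
      ≈⟨ solve 3 (λ q p k → (q :* p :+ q :* p) :* k := q :* ((p :+ p) :* k)) refl q (D³ ψ) K ⟩
    q * ((D³ ψ + D³ ψ) * K)
      ≈⟨ *-congˡ (trans (DD.*-homo (D ψ + D ψ) J) (*-congʳ (DD.+-homo (D ψ) (D ψ)))) ⟨
    q * DD s ∎

  U-D′ : ∀ f → U (D f) ≈ f
  U-D′ f = pointwise (U-D f)

  UU-q : UU q ≈ 0#
  UU-q = U-cong (trans (U-cong (sym (trans (*-congˡ D.1#-homo) (*-identityʳ q)))) (U-q*D 1#))

  UU-q² : UU (q * q) ≈ 0#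
  UU-q² = trans (U-cong (trans (U-cong (sym D-q)) (U-D′ q)))
    (trans (U-cong (sym (trans (*-congˡ D.1#-homo) (*-identityʳ q)))) (U-q*D 1#))

  UU-q³ : UU (q * (q * q)) ≈ 0#
  UU-q³ = U-cong (trans (U-cong (*-congˡ (sym D-q))) (U-q*D q))

  UU-vanish : ∀ {g} c → UU g ≈ 0# → UU (DD c * g) ≈ 0#
  UU-vanish c p = trans (UU-DD* c _) (trans (*-congˡ p) (zeroʳ c))

  -- The extra r moves c₀, c₁, c₂ into nonzero classes modulo 4. Only c₃ survives, with the factor
  -- r⁴ = 1 - z(q⁴).
  UU-A*r* : ∀ {f} (f∈ : Decomposition f) → let open Decomposition f∈ in UU (A * (r * f)) ≈ φ * ((1# - z) * c₃)
  UU-A*r* {f} (decomposition {a} {b} {c} {d} _ _ _ _ p) = begin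
    UU (A * (r * f))
      ≈⟨ UU-DD* φ (r * f) ⟩
    φ * UU (r * f)
      ≈⟨ *-congˡ (UU-cong (trans (*-congˡ p) (trans
           (solve 5 (λ r a b c d → r :* (a :+ r :* (b :+ r :* (c :+ r :* d)))
              := r :^ 4 :* d :+ (r :* a :+ (r :* r :* b :+ r :* r :* r :* c))) refl r (DD a) (DD b)
                (DD c) (DD d))
           (+-cong (trans (*-congʳ r⁴) (sym
             (trans (DD.*-homo (1# - z) d) (*-congʳ
             (trans (DD.+-homo 1# (- z)) (+-cong DD.1#-homo (DD.-‿homo z)))))))
             (+-cong (*-congʳ r≈) (+-cong (*-congʳ (*-cong r≈ r≈))
               (*-congʳ (*-cong (*-cong r≈ r≈) r≈)))))))) ⟩
    φ * UU (DD ((1# - z) * d) + (q * DD s * DD a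
      + (q * DD s * (q * DD s) * DD b + q * DD s * (q * DD s) * (q * DD s) * DD c)))
      ≈⟨ *-congˡ (trans (UU-+ _ _) (+-cong (UU-DD _)
        (trans (UU-+ _ _) (+-cong v₁ (trans (UU-+ _ _) (+-cong v₂ v₃)))))) ⟩
    φ * ((1# - z) * d + (0# + (0# + 0#)))
      ≈⟨ *-congˡ (solve 1 (λ a → a :+ (:0 :+ (:0 :+ :0)) := a) refl _) ⟩
    φ * ((1# - z) * d) ∎
    where
    v₁ : UU (q * DD s * DD a) ≈ 0#
    v₁ = trans (UU-cong (trans (solve 3 (λ q s a → q :* s :* a := s :* a :* q) refl q (DD s) (DD a))
      (*-congʳ (sym (DD.*-homo s a)))))
           (UU-vanish (s * a) UU-q)
    v₂ : UU (q * DD s * (q * DD s) * DD b) ≈ 0#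
    v₂ = trans (UU-cong (trans (solve 3 (λ q s a → q :* s :* (q :* s) :* a
      := s :* s :* a :* (q :* q)) refl q (DD s) (DD b))
           (*-congʳ (sym (trans (DD.*-homo (s * s) b) (*-congʳ (DD.*-homo s s)))))))
             (UU-vanish (s * s * b) UU-q²)
    v₃ : UU (q * DD s * (q * DD s) * (q * DD s) * DD c) ≈ 0#
    v₃ = trans (UU-cong (trans (solve 3 (λ q s a → q :* s :* (q :* s) :* (q :* s) :* a
      := s :* s :* s :* a :* (q :* (q :* q))) refl q (DD s) (DD c))
           (*-congʳ (sym (trans (DD.*-homo (s * s * s) c)
             (*-congʳ (trans (DD.*-homo (s * s) s) (*-congʳ (DD.*-homo s s)))))))))
             (UU-vanish (s * s * s * c) UU-q³)

  D-⟦⟧ : ∀ n → D ⟦ + n ⟧ ≈ ⟦ + n ⟧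
  D-⟦⟧ zero          = D.0#-homo
  D-⟦⟧ (suc zero)    = D.1#-homo
  D-⟦⟧ (suc (suc n)) = trans (D.+-homo _ _) (+-cong (D-⟦⟧ (suc n)) D.1#-homo)

  UU-⟦⟧* : ∀ n f → UU (⟦ + n ⟧ * f) ≈ ⟦ + n ⟧ * UU f
  UU-⟦⟧* n f = trans (UU-cong (*-congʳ (sym (trans (D.cong (D-⟦⟧ n)) (D-⟦⟧ n))))) (UU-DD* ⟦ + n ⟧ f)

  φ*X≈ : φ * X ≈ ⟦ + 8 ⟧ * (A * (r * ((1# + r) ^ 5 * (1# + r * r) ^ 5 * Y ^ 4)))
  φ*X≈ = trans (*-cong φ≈A[1+r] X≈) (solve 3 (λ a r y →
    a :* (:1 :+ r) :* (con (+ 8) :* (r :* (:1 :+ r :* r) :* ((:1 :+ r) :* (:1 :+ r :* r) :* y) :^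
      4))
    := con (+ 8) :* (a :* (r :* ((:1 :+ r) :^ 5 :* (:1 :+ r :* r) :^ 5 :* y :^ 4)))) refl A r Y)

  -- The 8 is the one in φ X = 8 A r H; the surviving factor 1 - z = z (y - 1) restores X, so the
  -- shape reproduces itself.
  UU-φX : ∀ {f} → T f → ∃ λ g → T g × UU (φ * X * f) ≈ ⟦ + 8 ⟧ * (φ * X * g)
  UU-φX {f} f∈ = z * c₃ , *∈ z∈ c₃∈ , (begin
    UU (φ * X * f)
      ≈⟨ UU-cong (trans (*-congʳ φ*X≈)
        (solve 5 (λ k a r h f → k :* (a :* (r :* h)) :* f
        := k :* (a :* (r :* (h :* f)))) refl ⟦ + 8 ⟧ A r _ f)) ⟩
    UU (⟦ + 8 ⟧ * (A * (r * (h * f))))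
      ≈⟨ UU-⟦⟧* 8 _ ⟩
    ⟦ + 8 ⟧ * UU (A * (r * (h * f)))
      ≈⟨ *-congˡ (UU-A*r* hf∈) ⟩
    ⟦ + 8 ⟧ * (φ * ((1# - z) * c₃))
      ≈⟨ *-congˡ (*-congˡ (*-congʳ (+-congʳ (sym y*z)))) ⟩
    ⟦ + 8 ⟧ * (φ * ((y * z - z) * c₃))
      ≈⟨ *-congˡ (solve 4 (λ f y z c → f :* ((y :* z :- z) :* c)
        := f :* (y :- :1) :* (z :* c)) refl φ y z c₃) ⟩
    ⟦ + 8 ⟧ * (φ * X * (z * c₃)) ∎)
    where
    h = (1# + r) ^ 5 * (1# + r * r) ^ 5 * Y ^ 4
    hf∈ : Decomposition (h * f)
    hf∈ = *-dec (*-dec (*-dec (^-dec 5 1+r-dec) (^-dec 5 1+r²-dec)) (^-dec 4 (DD-dec y∈)))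
      (T⇒dec f∈)
    open Decomposition hf∈

  UU-φ : UU φ ≈ φ
  UU-φ = begin
    UU φ
      ≈⟨ UU-cong φ≈ ⟩
    UU (A + b)
      ≈⟨ UU-+ A b ⟩
    UU A + UU b
      ≈⟨ +-cong (UU-DD φ) (trans (UU-cong
        (solve 2 (λ q p → q :* p :+ q :* p := (p :+ p) :* q) refl q (D³ ψ)))
           (trans (UU-cong (*-congʳ (sym (DD.+-homo (D ψ) (D ψ))))) (UU-vanish (D ψ + D ψ) UU-q))) ⟩
    φ + 0#
      ≈⟨ +-identityʳ φ ⟩
    φ ∎

  -- Of (1 + r)³ (1 + r²) = 1 + 3r + 4r² + 4r³ + 3r⁴ + r⁵ only 1 + 3r⁴ survives. As r⁴ Y = Y - 1, it
  -- contributes 4y - 3 = 1 + 4X.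
  UU-W : UU W ≈ φ + ⟦ + 4 ⟧ * (φ * X * 1#)
  UU-W = begin
    UU W
      ≈⟨ UU-cong (trans W≈ (*-congˡ (trans
           (solve 2 (λ r y → (:1 :+ r) :^ 3 :* (:1 :+ r :* r) :* y
             := (:1 :+ con (+ 3) :* r :^ 4) :* y :+ y :* (con (+ 3) :+ r :^ 4) :* r
                :+ con (+ 4) :* y :* (r :* r) :+ con (+ 4) :* y :* (r :* r :* r)) refl r Y)
           (+-cong (+-cong (+-cong c₀ (*-cong (*-congˡ (+-congˡ r⁴)) r≈)) (*-congˡ (*-cong r≈ r≈)))
             (*-congˡ (*-cong (*-cong r≈ r≈) r≈)))))) ⟩
    UU (A * (DD (y * ⟦ + 4 ⟧ - ⟦ + 3 ⟧) + Y * (⟦ + 3 ⟧ + (1# - Z̄)) * (q * DD s)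
          + ⟦ + 4 ⟧ * Y * (q * DD s * (q * DD s)) + ⟦ + 4 ⟧ * Y
            * (q * DD s * (q * DD s) * (q * DD s))))
      ≈⟨ trans (UU-DD* φ _) (*-congˡ (trans (UU-+ _ _)
        (+-cong (trans (UU-+ _ _) (+-cong (trans (UU-+ _ _)
           (+-cong (UU-DD _) v₁)) v₂)) v₃))) ⟩
    φ * (y * ⟦ + 4 ⟧ - ⟦ + 3 ⟧ + 0# + 0# + 0#)
      ≈⟨ solve 2 (λ f y → f :* (y :* con (+ 4) :- con (+ 3) :+ :0 :+ :0 :+ :0)
        := f :+ con (+ 4) :* (f :* (y :- :1) :* :1)) refl φ y ⟩
    φ + ⟦ + 4 ⟧ * (φ * X * 1#) ∎
    where
    4D : ⟦ + 4 ⟧ ≈ DD ⟦ + 4 ⟧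
    4D = sym (trans (D.cong (D-⟦⟧ 4)) (D-⟦⟧ 4))
    3D : ⟦ + 3 ⟧ ≈ DD ⟦ + 3 ⟧
    3D = sym (trans (D.cong (D-⟦⟧ 3)) (D-⟦⟧ 3))
    c₀ : (1# + ⟦ + 3 ⟧ * r ^ 4) * Y ≈ DD (y * ⟦ + 4 ⟧ - ⟦ + 3 ⟧)
    c₀ = begin
      (1# + ⟦ + 3 ⟧ * r ^ 4) * Y
        ≈⟨ *-congʳ (+-congˡ (*-congˡ r⁴)) ⟩
      (1# + ⟦ + 3 ⟧ * (1# - Z̄)) * Y
        ≈⟨ solve 2 (λ y z → (:1 :+ con (+ 3) :* (:1 :- z)) :* y
          := y :* con (+ 4) :- con (+ 3) :* (y :* z)) refl Y Z̄ ⟩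
      Y * ⟦ + 4 ⟧ - ⟦ + 3 ⟧ * (Y * Z̄)
        ≈⟨ +-congˡ (-‿cong (trans (*-congˡ Y*Z̄) (*-identityʳ _))) ⟩
      Y * ⟦ + 4 ⟧ - ⟦ + 3 ⟧
        ≈⟨ +-cong (*-congˡ 4D) (-‿cong 3D) ⟩
      Y * DD ⟦ + 4 ⟧ - DD ⟦ + 3 ⟧
        ≈⟨ trans (DD.+-homo _ _) (+-cong (DD.*-homo y ⟦ + 4 ⟧) (DD.-‿homo ⟦ + 3 ⟧)) ⟨
      DD (y * ⟦ + 4 ⟧ - ⟦ + 3 ⟧) ∎
    v₁ : UU (Y * (⟦ + 3 ⟧ + (1# - Z̄)) * (q * DD s)) ≈ 0#
    v₁ = trans (UU-cong (trans (solve 3 (λ y q s → y :* (q :* s)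
      := y :* s :* q) refl (Y * (⟦ + 3 ⟧ + (1# - Z̄))) q (DD s))
      (*-congʳ (sym (trans (DD.*-homo (y * (⟦ + 3 ⟧ + (1# - z))) s)
        (*-congʳ (trans (DD.*-homo y (⟦ + 3 ⟧ + (1# - z))) (*-congˡ
        (trans (DD.+-homo ⟦ + 3 ⟧ (1# - z))
          (+-cong (sym 3D) (trans (DD.+-homo 1# (- z)) (+-cong DD.1#-homo (DD.-‿homo z)))))))))))))
      (UU-vanish (y * (⟦ + 3 ⟧ + (1# - z)) * s) UU-q)
    4Y : ⟦ + 4 ⟧ * Y ≈ DD (⟦ + 4 ⟧ * y)
    4Y = trans (*-congʳ 4D) (sym (DD.*-homo ⟦ + 4 ⟧ y))
    v₂ : UU (⟦ + 4 ⟧ * Y * (q * DD s * (q * DD s))) ≈ 0#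
    v₂ = trans (UU-cong (trans (solve 3 (λ y q s → y :* (q :* s :* (q :* s))
      := y :* (s :* s) :* (q :* q)) refl (⟦ + 4 ⟧ * Y) q (DD s))
      (*-congʳ (trans (*-cong 4Y (sym (DD.*-homo s s))) (sym (DD.*-homo (⟦ + 4 ⟧ * y) (s * s)))))))
      (UU-vanish (⟦ + 4 ⟧ * y * (s * s)) UU-q²)
    v₃ : UU (⟦ + 4 ⟧ * Y * (q * DD s * (q * DD s) * (q * DD s))) ≈ 0#
    v₃ = trans (UU-cong (trans (solve 3 (λ y q s → y :* (q :* s :* (q :* s) :* (q :* s))
      := y :* (s :* s :* s) :* (q :* (q :* q))) refl (⟦ + 4 ⟧ * Y) q (DD s))
      (*-congʳ (trans (*-cong 4Y (sym (trans (DD.*-homo (s * s) s) (*-congʳ (DD.*-homo s s)))))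
        (sym (DD.*-homo (⟦ + 4 ⟧ * y) (s * s * s)))))))
      (UU-vanish (⟦ + 4 ⟧ * y * (s * s * s)) UU-q³)

  UU^ : ℕ → Series → Series
  UU^ zero    f = f
  UU^ (suc n) f = UU (UU^ n f)

  UU^-W : ∀ α → ∃ λ f → T f × UU^ (suc α) W ≈ φ + ⟦ + (8 ℕ.^ α) ⟧ * (⟦ + 4 ⟧ * (φ * X * f))
  UU^-W zero    = 1# , 1∈ , trans UU-W (+-congˡ (sym (*-identityˡ _)))
  UU^-W (suc α) = let f , f∈ , p = UU^-W α ; g , g∈ , p′ = UU-φX f∈ in g , g∈ , (begin
    UU (UU^ (suc α) W)
      ≈⟨ UU-cong p ⟩
    UU (φ + ⟦ + (8 ℕ.^ α) ⟧ * (⟦ + 4 ⟧ * (φ * X * f)))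
      ≈⟨ trans (UU-+ _ _) (+-cong UU-φ
        (trans (UU-⟦⟧* (8 ℕ.^ α) _) (*-congˡ (trans (UU-⟦⟧* 4 _) (*-congˡ p′))))) ⟩
    φ + ⟦ + (8 ℕ.^ α) ⟧ * (⟦ + 4 ⟧ * (⟦ + 8 ⟧ * (φ * X * g)))
      ≈⟨ +-congˡ (solve 4 (λ a b c d → a :* (b :* (c :* d))
        := c :* a :* (b :* d)) refl ⟦ + (8 ℕ.^ α) ⟧ ⟦ + 4 ⟧ ⟦ + 8 ⟧ (φ * X * g)) ⟩
    φ + ⟦ + 8 ⟧ * ⟦ + (8 ℕ.^ α) ⟧ * (⟦ + 4 ⟧ * (φ * X * g))
      ≈⟨ +-congˡ (*-congʳ (sym (trans (reflexive (P.cong ⟦_⟧ (ℤₚ.pos-* 8 (8 ℕ.^ α))))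
        (⟦⟧-* (+ 8) (+ (8 ℕ.^ α)))))) ⟩
    φ + ⟦ + (8 ℕ.^ suc α) ⟧ * (⟦ + 4 ⟧ * (φ * X * g)) ∎)

  ⟦⟧*-coeff : ∀ c f n → (⟦ c ⟧ * f) n ≡ c ℤ.* f n
  ⟦⟧*-coeff (+ c)    f n = go c
    where
    go : ∀ c → (⟦ + c ⟧ * f) n ≡ + c ℤ.* f n
    go zero          = at (zeroˡ f) n
    go (suc zero)    = P.trans (at (*-identityˡ f) n) (P.sym (ℤₚ.*-identityˡ (f n)))
    go (suc (suc c)) = P.trans (at (distribʳ f ⟦ + suc c ⟧ 1#) n) (P.trans (+-coeff _ _ n)
      (P.trans (P.cong₂ ℤ._+_ (go (suc c)) (at (*-identityˡ f) n))
        (P.trans (ℤₚ.+-comm _ (f n)) (P.sym (ℤₚ.suc-* (+ suc c) (f n))))))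
  ⟦⟧*-coeff -[1+ c ] f n = P.trans (at (sym (-‿distribˡ-* ⟦ + suc c ⟧ f)) n)
    (P.trans (neg-coeff _ n)
    (P.trans (P.cong ℤ.-_ (⟦⟧*-coeff (+ suc c) f n)) (ℤₚ.neg-distribˡ-* (+ suc c) (f n))))

  D-odd : ∀ f n → D f (suc (dbl n)) ≡ 0ℤ
  D-odd f zero    = P.refl
  D-odd f (suc n) = D-odd (tail f) n

  -- Divisibility in residue classes

  -- The indices 4n + 2, 4n + 3, 8n + 5 and 8n + 7.
  pos₂ pos₃ pos₅ pos₇ : ℕ → ℕ
  pos₂ n = dbl (suc (dbl n))
  pos₃ n = suc (dbl (suc (dbl n)))
  pos₅ n = suc (dbl (dbl (suc (dbl n))))
  pos₇ n = suc (dbl (suc (dbl (suc (dbl n)))))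

  -- Each modulus has one power of 2 more than v₀ requires, as W carries 2 v₀(4n). The class 4n + 2
  -- serves the first congruence of the theorem at α + 1.
  record Good (f : Series) : Set where
    field
      at₂ : ∀ n → + 16 ∣ₛ f (pos₂ n)
      at₃ : ∀ n → + 32 ∣ₛ f (pos₃ n)
      at₅ : ∀ n → + 128 ∣ₛ f (pos₅ n)
      at₇ : ∀ n → + 128 ∣ₛ f (pos₇ n)

  open Good

  record Vanishing (f : Series) : Set where
    field
      zero₂ : ∀ n → f (pos₂ n) ≡ 0ℤ
      zero₃ : ∀ n → f (pos₃ n) ≡ 0ℤ
      zero₅ : ∀ n → f (pos₅ n) ≡ 0ℤ
      zero₇ : ∀ n → f (pos₇ n) ≡ 0ℤ

  open Vanishing

  ∣ₛ-resp : ∀ {k a a′} → a ≡ a′ → k ∣ₛ a → k ∣ₛ a′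
  ∣ₛ-resp P.refl p = p

  zero⇒∣ : ∀ {k a} → a ≡ 0ℤ → k ∣ₛ a
  zero⇒∣ p = ∣ₛ-resp (P.sym p) (divides 0ℤ P.refl)

  vanishing⇒good : ∀ {f} → Vanishing f → Good f
  vanishing⇒good v = record { at₂ = zero⇒∣ ∘ zero₂ v ; at₃ = zero⇒∣ ∘ zero₃ v ; at₅ = zero⇒∣ ∘ zero₅
    v ; at₇ = zero⇒∣ ∘ zero₇ v }

  good-≈ : ∀ {f g} → f ≈ g → Good f → Good g
  good-≈ p v = record { at₂ = λ n → ∣ₛ-resp (at p _) (at₂ v n) ; at₃ = λ n →
    ∣ₛ-resp (at p _) (at₃ v n)
                      ; at₅ = λ n → ∣ₛ-resp (at p _) (at₅ v n) ; at₇ = λ n →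
                        ∣ₛ-resp (at p _) (at₇ v n) }

  good-+ : ∀ {f g} → Good f → Good g → Good (f + g)
  good-+ {f} {g} v w = record { at₂ = λ n → go (at₂ v n) (at₂ w n) ; at₃ = λ n →
    go (at₃ v n) (at₃ w n)
                              ; at₅ = λ n → go (at₅ v n) (at₅ w n) ; at₇ = λ n →
                                go (at₇ v n) (at₇ w n) }
    where
    go : ∀ {k n} → k ∣ₛ f n → k ∣ₛ g n → k ∣ₛ (f + g) n
    go {n = n} p p′ = ∣ₛ-resp (P.sym (+-coeff f g n)) (Signed.∣m∣n⇒∣m+n p p′)

  good-⟦⟧* : ∀ {f} c → Good f → Good (⟦ c ⟧ * f)
  good-⟦⟧* {f} c v = record { at₂ = λ n → go (at₂ v n) ; at₃ = λ n → go (at₃ v n)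
                            ; at₅ = λ n → go (at₅ v n) ; at₇ = λ n → go (at₇ v n) }
    where
    go : ∀ {k n} → k ∣ₛ f n → k ∣ₛ (⟦ c ⟧ * f) n
    go {n = n} p = ∣ₛ-resp (P.sym (⟦⟧*-coeff c f n)) (Signed.∣n⇒∣m*n c p)

  vanishing-≈ : ∀ {f g} → f ≈ g → Vanishing f → Vanishing g
  vanishing-≈ p v = record { zero₂ = λ n → P.trans (P.sym (at p _)) (zero₂ v n) ; zero₃ = λ n →
    P.trans (P.sym (at p _)) (zero₃ v n)
                           ; zero₅ = λ n → P.trans (P.sym (at p _)) (zero₅ v n) ; zero₇ = λ n →
                             P.trans (P.sym (at p _)) (zero₇ v n) }

  vanishing-+ : ∀ {f g} → Vanishing f → Vanishing g → Vanishing (f + g)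
  vanishing-+ {f} {g} v w = record
    { zero₂ = λ n → go (zero₂ v n) (zero₂ w n) ; zero₃ = λ n → go (zero₃ v n) (zero₃ w n)
                                   ; zero₅ = λ n → go (zero₅ v n) (zero₅ w n) ; zero₇ = λ n →
                                     go (zero₇ v n) (zero₇ w n) }
    where
    go : ∀ {n} → f n ≡ 0ℤ → g n ≡ 0ℤ → (f + g) n ≡ 0ℤ
    go {n} p p′ = P.trans (+-coeff f g n) (P.cong₂ ℤ._+_ p p′)

  vanishing-DD : ∀ f → Vanishing (DD f)
  vanishing-DD f = record
    { zero₂ = λ n → P.trans (U-D (D f) (suc (dbl n))) (D-odd f n)
    ; zero₃ = λ n → D-odd (D f) (suc (dbl n))
    ; zero₅ = λ n → D-odd (D f) (dbl (suc (dbl n)))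
    ; zero₇ = λ n → D-odd (D f) (suc (dbl (suc (dbl n)))) }

  q*D-even : ∀ f n → (q * D f) (dbl n) ≡ 0ℤ
  q*D-even f = at (U-q*D f)

  q*D-odd : ∀ f n → (q * D f) (suc (dbl n)) ≡ f n
  q*D-odd f n = P.trans (q*-suc (D f) (dbl n)) (U-D f n)

  vanishing-q*D³ : ∀ f → Vanishing (q * D³ f)
  vanishing-q*D³ f = record
    { zero₂ = λ n → q*D-even (DD f) (suc (dbl n))
    ; zero₃ = λ n → P.trans (q*D-odd (DD f) (suc (dbl n))) (D-odd (D f) n)
    ; zero₅ = λ n → P.trans (q*D-odd (DD f) (dbl (suc (dbl n))))
      (P.trans (U-D (D f) (suc (dbl n))) (D-odd f n))
    ; zero₇ = λ n → P.trans (q*D-odd (DD f) (suc (dbl (suc (dbl n))))) (D-odd (D f) (suc (dbl n))) }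

  multiple : ∀ k f n → + k ∣ₛ (⟦ + k ⟧ * f) n
  multiple k f n = divides (f n) (P.trans (⟦⟧*-coeff (+ k) f n) (ℤₚ.*-comm (+ k) (f n)))

  ⟦⟧*-zero : ∀ c f n → f n ≡ 0ℤ → (⟦ c ⟧ * f) n ≡ 0ℤ
  ⟦⟧*-zero c f n p = P.trans (⟦⟧*-coeff c f n) (P.trans (P.cong (c ℤ.*_) p) (ℤₚ.*-zeroʳ c))

  good-128 : ∀ f → Good (⟦ + 128 ⟧ * f)
  good-128 f = record
    { at₂ = λ n → Signed.∣-trans (divides (+ 8) P.refl) (multiple 128 f _)
    ; at₃ = λ n → Signed.∣-trans (divides (+ 4) P.refl) (multiple 128 f _)
    ; at₅ = λ n → multiple 128 f _
    ; at₇ = λ n → multiple 128 f _ }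

  good-16D : ∀ f → Good (⟦ + 16 ⟧ * D f)
  good-16D f = record
    { at₂ = λ n → multiple 16 (D f) _
    ; at₃ = λ n → zero⇒∣ (⟦⟧*-zero (+ 16) (D f) (pos₃ n) (D-odd f (suc (dbl n))))
    ; at₅ = λ n → zero⇒∣ (⟦⟧*-zero (+ 16) (D f) (pos₅ n) (D-odd f (dbl (suc (dbl n)))))
    ; at₇ = λ n → zero⇒∣ (⟦⟧*-zero (+ 16) (D f) (pos₇ n) (D-odd f (suc (dbl (suc (dbl n)))))) }

  -- The series is 32 q³ f(q⁸), with exponents 3 modulo 8 only, where 32 is enough.
  good-32 : ∀ f → Good (⟦ + 32 ⟧ * (q * D (q * DD f)))
  good-32 f = record
    { at₂ = λ n → zero⇒∣ (⟦⟧*-zero (+ 32) g (pos₂ n) (q*D-even (q * DD f) (suc (dbl n))))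
    ; at₃ = λ n → multiple 32 g _
    ; at₅ = λ n → zero⇒∣ (⟦⟧*-zero (+ 32) g (pos₅ n)
      (P.trans (q*D-odd (q * DD f) (dbl (suc (dbl n)))) (q*D-even (D f) (suc (dbl n)))))
    ; at₇ = λ n → zero⇒∣ (⟦⟧*-zero (+ 32) g (pos₇ n)
      (P.trans (q*D-odd (q * DD f) (suc (dbl (suc (dbl n)))))
              (P.trans (q*D-odd (D f) (suc (dbl n))) (D-odd f n)))) }
    where g = q * D (q * DD f)

  -- 2-adic expansion in r

  β : Series
  β = q * D³ ψ

  ρ : Series
  ρ = β * K

  r≈2ρ : r ≈ ⟦ + 2 ⟧ * ρ
  r≈2ρ = solve 2 (λ β k → (β :+ β) :* k := :2 :* (β :* k)) refl β K

  -- This is X / 16: the 8 of `X≈` together with the 2 in r = 2ρ.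
  u : Series
  u = ρ * (1# + r * r) * ((1# + r) * (1# + r * r) * Y) ^ 4

  y≈ : y ≈ 1# + ⟦ + 16 ⟧ * u
  y≈ = begin
    y           ≈⟨ solve 1 (λ y → y := :1 :+ (y :- :1)) refl y ⟩
    1# + X      ≈⟨ +-congˡ (trans X≈ (*-congˡ (*-congʳ (*-congʳ r≈2ρ)))) ⟩
    1# + ⟦ + 8 ⟧ * (⟦ + 2 ⟧ * ρ * (1# + r * r) * ((1# + r) * (1# + r * r) * Y) ^ 4)
      ≈⟨ +-congˡ (solve 3 (λ p a b → con (+ 8) :* (:2 :* p :* a :* b)
        := con (+ 16) :* (p :* a :* b)) refl ρ (1# + r * r) _) ⟩
    1# + ⟦ + 16 ⟧ * u ∎

  z≈ : z ≈ 1# + ⟦ + 16 ⟧ * (- (u * z))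
  z≈ = begin
    z
      ≈⟨ solve 2 (λ u z → z := (:1 :+ con (+ 16) :* u) :* z :+ con (+ 16) :* (:- (u :* z))) refl u z
        ⟩
    (1# + ⟦ + 16 ⟧ * u) * z + ⟦ + 16 ⟧ * (- (u * z))
      ≈⟨ +-congʳ (trans (*-congʳ (sym y≈)) y*z) ⟩
    1# + ⟦ + 16 ⟧ * (- (u * z)) ∎

  -- Both generators are 1 modulo 16. Next to a factor 8 an element of T therefore acts as an
  -- integer modulo 128, which does not disturb the residue classes.
  T⇒constant-mod-16 : ∀ {f} → T f → ∃ λ c → ∃ λ h → f ≈ ⟦ c ⟧ + ⟦ + 16 ⟧ * h
  T⇒constant-mod-16 y∈ = + 1 , u , y≈
  T⇒constant-mod-16 z∈ = + 1 , - (u * z) , z≈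
  T⇒constant-mod-16 1∈ = + 1 , 0# , solve 0 (:1 := :1 :+ con (+ 16) :* :0) refl
  T⇒constant-mod-16 (+∈ p p′) = let c , h , e = T⇒constant-mod-16 p ; c′ , h′ , e′ = T⇒constant-mod-16 p′ in
    c ℤ.+ c′ , h + h′ , trans (+-cong e e′) (trans
      (solve 4 (λ c h c′ h′ → c :+ con (+ 16) :* h :+ (c′ :+ con (+ 16) :* h′)
        := c :+ c′ :+ con (+ 16) :* (h :+ h′)) refl ⟦ c ⟧ h ⟦ c′ ⟧ h′)
      (+-congʳ (sym (⟦⟧-+ c c′))))
  T⇒constant-mod-16 (*∈ p p′) = let c , h , e = T⇒constant-mod-16 p ; c′ , h′ , e′ = T⇒constant-mod-16 p′ in
    c ℤ.* c′ , ⟦ c ⟧ * h′ + h * ⟦ c′ ⟧ + ⟦ + 16 ⟧ * (h * h′) , trans (*-cong e e′) (trans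
      (solve 4 (λ c h c′ h′ → (c :+ con (+ 16) :* h) :* (c′ :+ con (+ 16) :* h′)
         := c :* c′ :+ con (+ 16) :* (c :* h′ :+ h :* c′ :+ con (+ 16) :* (h :* h′))) refl ⟦ c ⟧ h ⟦
           c′ ⟧ h′)
      (+-congʳ (sym (⟦⟧-* c c′))))
  T⇒constant-mod-16 (-∈ p) = let c , h , e = T⇒constant-mod-16 p in
    ℤ.- c , - h , trans (-‿cong e) (trans
      (solve 2 (λ c h → :- (c :+ con (+ 16) :* h) := :- c :+ con (+ 16) :* :- h) refl ⟦ c ⟧ h)
      (+-congʳ (sym (⟦⟧-neg c))))
  T⇒constant-mod-16 (≈∈ e p) = let c , h , e′ = T⇒constant-mod-16 p in c , h , trans (sym e) e′

  DD-⟦⟧ : ∀ n → DD ⟦ + n ⟧ ≈ ⟦ + n ⟧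
  DD-⟦⟧ n = trans (D.cong (D-⟦⟧ n)) (D-⟦⟧ n)

  Y≈ : Y ≈ 1# + ⟦ + 16 ⟧ * DD u
  Y≈ = trans (DD.cong y≈) (trans (DD.+-homo 1# _)
    (+-cong DD.1#-homo (trans (DD.*-homo ⟦ + 16 ⟧ u) (*-congʳ (DD-⟦⟧ 16)))))

  -- φ = 1 + 2 λ₁ implies φ² = 1 + 4 (λ₁ + λ₁²), so J² and K² are 1 modulo 4.
  K²-defect : Series
  K²-defect = DD (- ((λ₁ + λ₁ * λ₁) * (J * J)))
    where λ₁ = Lim sq - 1#

  K² : K * K ≈ 1# + ⟦ + 4 ⟧ * K²-defect
  K² = begin
    K * K              ≈⟨ DD.*-homo J J ⟨
    DD (J * J)         ≈⟨ DD.cong J² ⟩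
    DD (1# + ⟦ + 4 ⟧ * (- ((l + l * l) * (J * J))))
      ≈⟨ trans (DD.+-homo 1# _) (+-cong DD.1#-homo
        (trans (DD.*-homo ⟦ + 4 ⟧ _) (*-congʳ (DD-⟦⟧ 4)))) ⟩
    1# + ⟦ + 4 ⟧ * K²-defect ∎
    where
    l = Lim sq - 1#
    J² : J * J ≈ 1# + ⟦ + 4 ⟧ * (- ((l + l * l) * (J * J)))
    J² = begin
      J * J
        ≈⟨ solve 2 (λ L J → let l = L :- :1 ; f = L :+ L :- :1 in
             J :* J := f :* J :* (f :* J) :+ con (+ 4) :* (:- ((l :+ l :* l) :* (J :* J)))) refl
               (Lim sq) J ⟩
      φ * J * (φ * J) + ⟦ + 4 ⟧ * (- ((l + l * l) * (J * J)))
        ≈⟨ +-congʳ (trans (*-cong φ*J φ*J) (*-identityˡ 1#)) ⟩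
      1# + ⟦ + 4 ⟧ * (- ((l + l * l) * (J * J))) ∎

  good-β : Good β
  good-β = vanishing⇒good (vanishing-q*D³ ψ)

  -- β² c(q⁴) is a series in q², so the odd classes are empty and 16 is enough.
  good-16β² : ∀ c → Good (⟦ + 16 ⟧ * (β * β * DD c))
  good-16β² c = good-≈ (*-congˡ (begin
    D (q * D (D ψ * D ψ * c))
      ≈⟨ trans (D.*-homo q _) (*-cong D-q
        (trans (DD.*-homo (D ψ * D ψ) c) (*-congʳ (DD.*-homo (D ψ) (D ψ))))) ⟩
    q * q * (D³ ψ * D³ ψ * DD c)
      ≈⟨ solve 3 (λ q p c → q :* q :* (p :* p :* c)
        := q :* p :* (q :* p) :* c) refl q (D³ ψ) (DD c) ⟩
    β * β * DD c ∎)) (good-16D (q * D (D ψ * D ψ * c)))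

  -- β³ has exponents 3 modulo 8. A cofactor in q⁴ could move them to 7 modulo 8, where 128 is
  -- required; being 1 modulo 4, it does so only with coefficients divisible by 32 · 4.
  good-32β³ : ∀ m → Good (⟦ + 32 ⟧ * (β * β * β * (1# + ⟦ + 4 ⟧ * m)))
  good-32β³ m = good-≈ (begin
    ⟦ + 32 ⟧ * (q * D (q * DD (ψ * ψ * ψ))) + ⟦ + 128 ⟧ * (β * β * β * m)
      ≈⟨ +-congʳ (*-congˡ (*-congˡ (trans (D.*-homo q _) (*-cong D-q
           (trans (D.cong (DD.*-homo (ψ * ψ) ψ))
             (trans (D.*-homo _ _) (*-congʳ (trans (D.cong (DD.*-homo ψ ψ)) (D.*-homo _ _))))))))) ⟩
    ⟦ + 32 ⟧ * (q * (q * q * (D³ ψ * D³ ψ * D³ ψ))) + ⟦ + 128 ⟧ * (β * β * β * m)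
      ≈⟨ solve 3 (λ q p m → let β = q :* p in
           con (+ 32) :* (q :* (q :* q :* (p :* p :* p))) :+ con (+ 128) :* (β :* β :* β :* m)
           := con (+ 32) :* (β :* β :* β :* (:1 :+ con (+ 4) :* m))) refl q (D³ ψ) m ⟩
    ⟦ + 32 ⟧ * (β * β * β * (1# + ⟦ + 4 ⟧ * m)) ∎) (good-+ (good-32 (ψ * ψ * ψ)) (good-128 _))

  good-β⁴ : ∀ c → Good (β * β * β * β * DD c)
  good-β⁴ c = good-≈ (begin
    DD (q * (D ψ * D ψ * D ψ * D ψ * c))
      ≈⟨ trans (DD.*-homo q _) (*-cong (trans (D.cong D-q) (trans (D.*-homo q q) (*-cong D-q D-q)))
           (trans (DD.*-homo (D ψ * D ψ * D ψ * D ψ) c)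
             (*-congʳ (trans (DD.*-homo _ _)
             (*-congʳ (trans (DD.*-homo _ _) (*-congʳ (DD.*-homo _ _)))))))) ⟩
    q * q * (q * q) * (D³ ψ * D³ ψ * D³ ψ * D³ ψ * DD c)
      ≈⟨ solve 3 (λ q p c → q :* q :* (q :* q) :* (p :* p :* p :* p :* c)
        := q :* p :* (q :* p) :* (q :* p) :* (q :* p) :* c) refl q (D³ ψ) (DD c) ⟩
    β * β * β * β * DD c ∎) (vanishing⇒good (vanishing-DD _))

  -- The cofactor in φ X = 16 β H.
  H : Series
  H = (1# + r) ^ 5 * (1# + r * r) ^ 5 * Y ^ 4

  -- The coefficients 1, 5, 15, 35 of (1 + r)⁵ (1 + r²)⁵ and r = 2 β K give 8β, 80 β²K, 480 β³K²,
  -- 2240 β⁴K³. The first and last avoid all classes of `Good`, the second is even with 16 dividing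
  -- 80, the third has 32 dividing 480 and K² = 1 modulo 4. Since Y⁴ is 1 modulo 16, it adds
  -- multiples of 128 only.
  good-8βH : Good (⟦ + 8 ⟧ * (β * H))
  good-8βH = good-≈ (sym expand) (good-+
    (good-+ (good-+ (good-+ (good-⟦⟧* (+ 8) good-β) (good-⟦⟧* (+ 5) (good-16β² J)))
      (good-⟦⟧* (+ 15) (good-32β³ K²-defect)))
        (good-⟦⟧* (+ 2240) (good-≈ (*-congˡ K³) (good-β⁴ (J * J * J))))) (good-128 _))
    where
    K³ : DD (J * J * J) ≈ K * K * K
    K³ = trans (DD.*-homo (J * J) J) (*-congʳ (DD.*-homo J J))
    P = (1# + r) ^ 5 * (1# + r * r) ^ 5
    -- The cofactor of r⁴ in P; with r⁴ = 16 ρ⁴ all of its terms carry 8 · 16 = 128.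
    Q = ⟦ + 65 ⟧ + r * (⟦ + 101 ⟧ + r
      * (⟦ + 135 ⟧ + r * (⟦ + 155 ⟧ + r * (⟦ + 155 ⟧ + r * (⟦ + 135 ⟧
      + r * (⟦ + 101 ⟧ + r * (⟦ + 65 ⟧ + r * (⟦ + 35 ⟧ + r * (⟦ + 15 ⟧ + r * (⟦ + 5 ⟧ + r))))))))))
    P≈ : P ≈ 1# + ⟦ + 5 ⟧ * r + ⟦ + 15 ⟧ * (r * r) + ⟦ + 35 ⟧ * (r * r * r) + r ^ 4 * Q
    P≈ = solve 1 (λ r → (:1 :+ r) :^ 5 :* (:1 :+ r :* r) :^ 5 :=
           :1 :+ con (+ 5) :* r :+ con (+ 15) :* (r :* r) :+ con (+ 35) :* (r :* r :* r) :+ r :^ 4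
             :*
           (con (+ 65) :+ r :* (con (+ 101) :+ r
             :* (con (+ 135) :+ r :* (con (+ 155) :+ r :* (con (+ 155) :+ r :* (con (+ 135)
             :+ r :* (con (+ 101) :+ r :* (con (+ 65) :+ r
               :* (con (+ 35) :+ r :* (con (+ 15) :+ r :* (con (+ 5) :+ r)))))))))))) refl r
    ū = DD u
    R = ū * (⟦ + 4 ⟧ + ⟦ + 96 ⟧ * ū + ⟦ + 1024 ⟧ * (ū * ū) + ⟦ + 4096 ⟧ * (ū * ū * ū))
    Y⁴ : Y ^ 4 ≈ 1# + ⟦ + 16 ⟧ * R
    Y⁴ = trans (^-congˡ 4 Y≈) (solve 1 (λ u → (:1 :+ con (+ 16) :* u) :^ 4 :=
           :1 :+ con (+ 16) :* (u :* (con (+ 4) :+ con (+ 96) :* u :+ con (+ 1024) :* (u :* u)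
             :+ con (+ 4096) :* (u :* u :* u)))) refl ū)
    expand : ⟦ + 8 ⟧ * (β * H) ≈ ⟦ + 8 ⟧ * β + ⟦ + 5 ⟧ * (⟦ + 16 ⟧ * (β * β * K))
      + ⟦ + 15 ⟧ * (⟦ + 32 ⟧ * (β * β * β * (1# + ⟦ + 4 ⟧ * K²-defect)))
      + ⟦ + 2240 ⟧ * (β * β * β * β * (K * K * K)) + ⟦ + 128 ⟧ * (β * (ρ ^ 4 * Q) + β * P * R)
    expand = begin
      ⟦ + 8 ⟧ * (β * (P * Y ^ 4))
        ≈⟨ *-congˡ (*-congˡ (*-congˡ Y⁴)) ⟩
      ⟦ + 8 ⟧ * (β * (P * (1# + ⟦ + 16 ⟧ * R)))
        ≈⟨ solve 3 (λ b p v → con (+ 8) :* (b :* (p :* (:1 :+ con (+ 16) :* v)))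
          := con (+ 8) :* (b :* p) :+ con (+ 128) :* (b :* p :* v)) refl β P R ⟩
      ⟦ + 8 ⟧ * (β * P) + ⟦ + 128 ⟧ * (β * P * R)
        ≈⟨ +-congʳ (*-congˡ (*-congˡ (trans P≈
          (+-cong (+-cong (+-cong (+-congˡ (*-congˡ r≈2ρ)) (*-congˡ (*-cong r≈2ρ r≈2ρ)))
             (*-congˡ (*-cong (*-cong r≈2ρ r≈2ρ) r≈2ρ))) (*-congʳ (^-congˡ 4 r≈2ρ)))))) ⟩
      ⟦ + 8 ⟧ * (β * (1# + ⟦ + 5 ⟧ * (⟦ + 2 ⟧ * ρ) + ⟦ + 15 ⟧ * (⟦ + 2 ⟧ * ρ * (⟦ + 2 ⟧ * ρ))
        + ⟦ + 35 ⟧ * (⟦ + 2 ⟧ * ρ * (⟦ + 2 ⟧ * ρ) * (⟦ + 2 ⟧ * ρ)) + (⟦ + 2 ⟧ * ρ) ^ 4 * Q)) + ⟦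
          + 128 ⟧ * (β * P * R)
        ≈⟨ solve 4 (λ b k q pv → let r = :2 :* (b :* k) in
             con (+ 8) :* (b :* (:1 :+ con (+ 5) :* r :+ con (+ 15) :* (r :* r) :+ con (+ 35)
               :* (r :* r :* r) :+ r :^ 4 :* q)) :+ con (+ 128) :* pv
             := con (+ 8) :* b :+ con (+ 5) :* (con (+ 16) :* (b :* b :* k)) :+ con (+ 15)
               :* (con (+ 32) :* (b :* b :* b :* (k :* k)))
                :+ con (+ 2240) :* (b :* b :* b :* b :* (k :* k :* k)) :+ con (+ 128)
                  :* (b :* ((b :* k) :^ 4 :* q) :+ pv))
             refl β K Q (β * P * R) ⟩
      ⟦ + 8 ⟧ * β + ⟦ + 5 ⟧ * (⟦ + 16 ⟧ * (β * β * K)) + ⟦ + 15 ⟧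
        * (⟦ + 32 ⟧ * (β * β * β * (K * K)))
        + ⟦ + 2240 ⟧ * (β * β * β * β * (K * K * K)) + ⟦ + 128 ⟧ * (β * (ρ ^ 4 * Q) + β * P * R)
        ≈⟨ +-congʳ (+-congʳ (+-congˡ (*-congˡ (*-congˡ (*-congˡ K²))))) ⟩
      _ ∎

  good-8βHf : ∀ {f} → T f → Good (⟦ + 8 ⟧ * (β * H * f))
  good-8βHf {f} f∈ = let c , h , e = T⇒constant-mod-16 f∈ in good-≈
    (trans (solve 3 (λ c g h → c :* (con (+ 8) :* g) :+ con (+ 128) :* (g :* h)
      := con (+ 8) :* (g :* (c :+ con (+ 16) :* h))) refl ⟦ c ⟧ (β * H) h)
      (*-congˡ (*-congˡ (sym e))))
    (good-+ (good-⟦⟧* c good-8βH) (good-128 (β * H * h)))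

  4φXf≈ : ∀ f → ⟦ + 4 ⟧ * (φ * X * f) ≈ ⟦ + 8 ⟧ * (⟦ + 8 ⟧ * (β * H * f))
  4φXf≈ f = begin
    ⟦ + 4 ⟧ * (φ * X * f)
      ≈⟨ *-congˡ (*-congʳ (trans φ*X≈
        (*-congˡ (trans (sym (*-assoc A r H)) (*-congʳ (sym b≈A*r)))))) ⟩
    ⟦ + 4 ⟧ * (⟦ + 8 ⟧ * ((β + β) * H) * f)
      ≈⟨ solve 3 (λ b h f → con (+ 4) :* (con (+ 8) :* ((b :+ b) :* h) :* f)
        := con (+ 8) :* (con (+ 8) :* (b :* h :* f))) refl β H f ⟩
    ⟦ + 8 ⟧ * (⟦ + 8 ⟧ * (β * H * f)) ∎

  -- After r⁴ Y = Y - 1 the term linear in r is 2β (4Y - 1) = 6β + 128 β u(q⁴), of which 2β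
  -- completes A to φ. In the cubic term A cancels one K, and K² Y is 1 modulo 4, as `good-32β³`
  -- demands.
  W-expansion : W ≈ φ + (A * (⟦ + 4 ⟧ * Y - ⟦ + 4 ⟧) + ⟦ + 4 ⟧ * β + ⟦ + 16 ⟧
    * (β * β * (A * Y * (K * K)))
                         + ⟦ + 32 ⟧ * (β * β * β * (1# + ⟦ + 4 ⟧
                           * (K²-defect + ⟦ + 4 ⟧ * DD u + ⟦ + 16 ⟧ * (K²-defect * DD u))))
                         + ⟦ + 128 ⟧ * (β * DD u))
  W-expansion = begin
    W
      ≈⟨ trans W≈ (solve 3 (λ a r y → a :* ((:1 :+ r) :^ 3 :* (:1 :+ r :* r) :* y)
           := a :* ((:1 :+ con (+ 3) :* r :^ 4) :* y) :+ a :* r :* ((con (+ 3) :+ r :^ 4) :* y)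
              :+ con (+ 4) :* (a :* y :* (r :* r)) :+ con (+ 4) :* (a :* y :* (r :* r :* r))) refl A
                r Y) ⟩
    A * ((1# + ⟦ + 3 ⟧ * r ^ 4) * Y) + A * r * ((⟦ + 3 ⟧ + r ^ 4) * Y) + ⟦ + 4 ⟧ * (A * Y * (r * r))
      + ⟦ + 4 ⟧ * (A * Y * (r * r * r))
      ≈⟨ +-cong (+-cong (+-cong (*-congˡ t₀) (*-cong (sym b≈A*r) t₁))
        (*-congˡ (*-congˡ (*-cong r≈2ρ r≈2ρ))))
           (*-congˡ (*-congˡ (*-cong (*-cong r≈2ρ r≈2ρ) r≈2ρ))) ⟩
    A * (⟦ + 4 ⟧ * Y - ⟦ + 3 ⟧) + (β + β) * (⟦ + 3 ⟧ + ⟦ + 64 ⟧ * ū) + ⟦ + 4 ⟧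
      * (A * Y * (⟦ + 2 ⟧ * ρ * (⟦ + 2 ⟧ * ρ)))
      + ⟦ + 4 ⟧ * (A * Y * (⟦ + 2 ⟧ * ρ * (⟦ + 2 ⟧ * ρ) * (⟦ + 2 ⟧ * ρ)))
      ≈⟨ solve 5 (λ a y b k u → let r = :2 :* (b :* k) in
           a :* (con (+ 4) :* y :- con (+ 3)) :+ (b :+ b) :* (con (+ 3) :+ con (+ 64) :* u) :+ con
             (+ 4) :* (a :* y :* (r :* r))
             :+ con (+ 4) :* (a :* y :* (r :* r :* r))
           := a :+ (b :+ b) :+ (a :* (con (+ 4) :* y :- con (+ 4)) :+ con (+ 4) :* b :+ con (+ 16)
             :* (b :* b :* (a :* y :* (k :* k)))
                :+ con (+ 32) :* (b :* b :* b :* (a :* k :* (k :* k) :* y)) :+ con (+ 128)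
                  :* (b :* u))) refl A Y β K ū ⟩
    A + b + (A * (⟦ + 4 ⟧ * Y - ⟦ + 4 ⟧) + ⟦ + 4 ⟧ * β + ⟦ + 16 ⟧ * (β * β * (A * Y * (K * K)))
      + ⟦ + 32 ⟧ * (β * β * β * (A * K * (K * K) * Y)) + ⟦ + 128 ⟧ * (β * ū))
      ≈⟨ +-cong (sym φ≈) (+-congʳ (+-congˡ (*-congˡ (*-congˡ (trans (*-cong (*-cong A*K K²) Y≈)
           (solve 2 (λ k u → :1 :* (:1 :+ con (+ 4) :* k) :* (:1 :+ con (+ 16) :* u)
              := :1 :+ con (+ 4) :* (k :+ con (+ 4) :* u :+ con (+ 16) :* (k :* u))) refl K²-defect
                ū)))))) ⟩
    _ ∎
    where
    ū = DD u
    r⁴Y : r ^ 4 * Y ≈ Y - 1#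
    r⁴Y = trans (*-congʳ r⁴) (trans (solve 2 (λ y z → (:1 :- z) :* y := y :- y :* z) refl Y Z̄)
      (+-congˡ (-‿cong Y*Z̄)))
    t₀ : (1# + ⟦ + 3 ⟧ * r ^ 4) * Y ≈ ⟦ + 4 ⟧ * Y - ⟦ + 3 ⟧
    t₀ = trans (solve 2 (λ v y → (:1 :+ con (+ 3) :* v) :* y
      := y :+ con (+ 3) :* (v :* y)) refl (r ^ 4) Y)
      (trans (+-congˡ (*-congˡ r⁴Y)) (solve 1 (λ y → y :+ con (+ 3) :* (y :- :1)
        := con (+ 4) :* y :- con (+ 3)) refl Y))
    t₁ : (⟦ + 3 ⟧ + r ^ 4) * Y ≈ ⟦ + 3 ⟧ + ⟦ + 64 ⟧ * ū
    t₁ = trans (solve 2 (λ v y → (con (+ 3) :+ v) :* y := con (+ 3) :* y :+ v :* y) refl (r ^ 4) Y)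
      (trans (+-congˡ r⁴Y) (trans (+-cong (*-congˡ Y≈) (+-congʳ Y≈))
        (solve 1 (λ u → con (+ 3) :* (:1 :+ con (+ 16) :* u) :+ (:1 :+ con (+ 16) :* u :- :1)
          := con (+ 3) :+ con (+ 64) :* u) refl ū)))

  -- At α = 0 the correction is that of `W-expansion`. From then on it is 4 φ X f = 8 · 8βHf, where
  -- one 8 joins the power 8^α and 8βHf is good.
  UU^W≈ : ∀ α → ∃ λ g → Good g × UU^ α W ≈ φ + ⟦ + (8 ℕ.^ α) ⟧ * g
  UU^W≈ zero = _ , good , trans W-expansion (+-congˡ (sym (*-identityˡ _)))
    where
    good = good-+ (good-+ (good-+ (good-+
      (good-≈ (trans (DD.*-homo φ (⟦ + 4 ⟧ * y - ⟦ + 4 ⟧)) (*-congˡ (trans (DD.+-homo _ _)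
          (+-cong (trans (DD.*-homo ⟦ + 4 ⟧ y) (*-congʳ (DD-⟦⟧ 4)))
            (trans (DD.-‿homo ⟦ + 4 ⟧) (-‿cong (DD-⟦⟧ 4))))))) (vanishing⇒good (vanishing-DD _)))
      (good-⟦⟧* (+ 4) good-β))
      (good-≈ (*-congˡ (*-congˡ (trans (DD.*-homo (φ * y) (J * J))
        (*-cong (DD.*-homo φ y) (DD.*-homo J J))))) (good-16β² (φ * y * (J * J)))))
      (good-32β³ _)) (good-128 _)
  UU^W≈ (suc α) = let f , f∈ , p = UU^-W α in ⟦ + 8 ⟧ * (β * H * f) , good-8βHf f∈ , trans p (+-congˡ (begin
    ⟦ + (8 ℕ.^ α) ⟧ * (⟦ + 4 ⟧ * (φ * X * f))
      ≈⟨ *-congˡ (4φXf≈ f) ⟩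
    ⟦ + (8 ℕ.^ α) ⟧ * (⟦ + 8 ⟧ * (⟦ + 8 ⟧ * (β * H * f)))
      ≈⟨ solve 3 (λ a e g → a :* (e :* g)
        := e :* a :* g) refl ⟦ + (8 ℕ.^ α) ⟧ ⟦ + 8 ⟧ (⟦ + 8 ⟧ * (β * H * f)) ⟩
    ⟦ + 8 ⟧ * ⟦ + (8 ℕ.^ α) ⟧ * (⟦ + 8 ⟧ * (β * H * f))
      ≈⟨ *-congʳ (sym (trans (reflexive (P.cong ⟦_⟧ (ℤₚ.pos-* 8 (8 ℕ.^ α))))
        (⟦⟧-* (+ 8) (+ (8 ℕ.^ α))))) ⟩
    ⟦ + (8 ℕ.^ suc α) ⟧ * (⟦ + 8 ⟧ * (β * H * f)) ∎))

  -- From coefficients of W to values of v₀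

  dbl≡2* : ∀ n → dbl n ≡ 2 ℕ.* n
  dbl≡2* zero    = P.refl
  dbl≡2* (suc n) = P.trans (P.cong (suc ∘ suc) (dbl≡2* n))
    (P.cong suc (P.sym (ℕₚ.+-suc n (n ℕ.+ 0))))

  -- quad α n = 4^α n
  quad : ℕ → ℕ → ℕ
  quad zero    n = n
  quad (suc α) n = quad α (dbl (dbl n))

  UU^-coeff : ∀ α f n → UU^ α f n ≡ f (quad α n)
  UU^-coeff zero    f n = P.refl
  UU^-coeff (suc α) f n = UU^-coeff α f (dbl (dbl n))

  quad-suc : ∀ α n → ∃ λ k → quad α (suc n) ≡ suc k
  quad-suc zero    n = n , P.refl
  quad-suc (suc α) n = quad-suc α _

  -- Positivity of the index excludes the constant term, the only one touched by the -1 in `E`.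
  W-coeff : ∀ {n} → (∃ λ k → n ≡ suc k) → W n ≡ + 2 ℤ.* v₀ (dbl (dbl n))
  W-coeff (k , P.refl) = P.trans (+-coeff (U v₀ + U v₀) (- 1#) (dbl (suc k))) (P.trans
    (P.cong₂ ℤ._+_ (+-coeff (U v₀) (U v₀) (dbl (suc k))) (neg-coeff 1# (dbl (suc k))))
    (double (v₀ (dbl (dbl (suc k))))))
    where
    double : ∀ v → v ℤ.+ v ℤ.+ 0ℤ ≡ + 2 ℤ.* v
    double = Z.solve 1 (λ v → v Z.:+ v Z.:+ Z.con 0ℤ Z.:= Z.con (+ 2) Z.:* v) P.refl

  vanishing-φ : Vanishing φ
  vanishing-φ = vanishing-≈ (sym φ≈)
    (vanishing-+ (vanishing-DD φ) (vanishing-+ (vanishing-q*D³ ψ) (vanishing-q*D³ ψ)))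

  coeff-quad : ∀ {f h g k} α n → UU^ α f ≈ h + ⟦ k ⟧ * g → h n ≡ 0ℤ → f (quad α n) ≡ k ℤ.* g n
  coeff-quad {f} {h} {g} {k} α n p h₀ = P.trans (P.sym (UU^-coeff α f n))
    (P.trans (at p n) (P.trans (+-coeff h (⟦ k ⟧ * g) n)
    (P.trans (P.cong₂ ℤ._+_ h₀ (⟦⟧*-coeff k g n)) (ℤₚ.+-identityˡ (k ℤ.* g n)))))

  ∣-half : ∀ {a k m c} → + 2 ℤ.* a ≡ + k ℤ.* c → + (2 ℕ.* m) ∣ₛ c → + (k ℕ.* m) ∣ a
  ∣-half {a} {k} {m} e (divides c e′) = Signed.∣⇒∣ᵤ
    (divides c (ℤₚ.*-cancelˡ-≡ (+ 2) a (c ℤ.* + (k ℕ.* m)) (P.trans e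
    (P.trans (P.cong (+ k ℤ.*_) e′) (P.trans (P.cong (λ j → + k ℤ.* (c ℤ.* j)) (ℤₚ.pos-* 2 m))
      (P.trans (rearrange (+ k) c (+ m))
        (P.cong (λ j → + 2 ℤ.* (c ℤ.* j)) (P.sym (ℤₚ.pos-* k m)))))))))
    where
    rearrange : ∀ k c m → k ℤ.* (c ℤ.* (+ 2 ℤ.* m)) ≡ + 2 ℤ.* (c ℤ.* (k ℤ.* m))
    rearrange = Z.solve 3 (λ k c m → k Z.:* (c Z.:* (Z.con (+ 2) Z.:* m))
      Z.:= Z.con (+ 2) Z.:* (c Z.:* (k Z.:* m))) P.refl

  8^∣v₀ : ∀ α m n {g} → UU^ α W ≈ φ + ⟦ + (8 ℕ.^ α) ⟧ * g → φ (suc n) ≡ 0ℤ →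
    + (2 ℕ.* m) ∣ₛ g (suc n) →
          + (8 ℕ.^ α ℕ.* m) ∣ v₀ (dbl (dbl (quad α (suc n))))
  8^∣v₀ α m n {g} p φ₀ = ∣-half {v₀ (dbl (dbl (quad α (suc n))))} {8 ℕ.^ α} {m} {g (suc n)}
    (P.trans (P.sym (W-coeff (quad-suc α n))) (coeff-quad {k = + (8 ℕ.^ α)} α (suc n) p φ₀))

  dbl-dbl-quad : ∀ α n → dbl (dbl (quad α n)) ≡ 2 ℕ.^ (2 ℕ.* α ℕ.+ 2) ℕ.* n
  dbl-dbl-quad zero    n = dbl-dbl n
    where
    dbl-dbl : ∀ n → dbl (dbl n) ≡ 4 ℕ.* n
    dbl-dbl n = P.trans (dbl≡2* (dbl n))
      (P.trans (P.cong (2 ℕ.*_) (dbl≡2* n)) (P.sym (ℕₚ.*-assoc 2 2 n)))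
  dbl-dbl-quad (suc α) n = P.trans (dbl-dbl-quad α (dbl (dbl n))) (P.trans
    (P.cong (2 ℕ.^ (2 ℕ.* α ℕ.+ 2) ℕ.*_) (P.trans (dbl≡2* (dbl n)) (P.cong (2 ℕ.*_) (dbl≡2* n))))
    (P.trans (solveℕ 2 (λ a n → a ℕS.:* (ℕS.con 2 ℕS.:* (ℕS.con 2 ℕS.:* n))
      ℕS.:= ℕS.con 2 ℕS.:* (ℕS.con 2 ℕS.:* a) ℕS.:* n) P.refl (2 ℕ.^ (2 ℕ.* α ℕ.+ 2)) n)
      (P.cong (λ k → 2 ℕ.^ (k ℕ.+ 2) ℕ.* n) (P.sym (ℕₚ.*-suc 2 α)))))
    where
    module ℕS = ℕ-Solver.+-*-Solver
    solveℕ = ℕ-Solver.+-*-Solver.solve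

  2^[3*] : ∀ α k → 2 ℕ.^ (3 ℕ.* α ℕ.+ k) ≡ 8 ℕ.^ α ℕ.* 2 ℕ.^ k
  2^[3*] α k = P.trans (ℕₚ.^-distribˡ-+-* 2 (3 ℕ.* α) k)
    (P.cong (ℕ._* 2 ℕ.^ k) (P.sym (ℕₚ.^-*-assoc 2 3 α)))

  -- The exponent `suc k` pays for the 2 in 2 v₀(4n); φ must vanish at the index because its
  -- coefficient does not carry 8^α.
  v₀-divisible : ∀ α k n {g} → UU^ α W ≈ φ + ⟦ + (8 ℕ.^ α) ⟧ * g → φ (suc n) ≡ 0ℤ →
    + (2 ℕ.^ suc k) ∣ₛ g (suc n) →
           + (2 ℕ.^ (3 ℕ.* α ℕ.+ k)) ∣ v₀ (2 ℕ.^ (2 ℕ.* α ℕ.+ 2) ℕ.* suc n)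
  v₀-divisible α k n p φ₀ d = P.subst₂ (λ a b → + a ∣ v₀ b) (P.sym (2^[3*] α k))
    (dbl-dbl-quad α (suc n)) (8^∣v₀ α (2 ℕ.^ k) n p φ₀ d)

  pos₃≡ : ∀ n → pos₃ n ≡ 4 ℕ.* n ℕ.+ 3
  pos₃≡ n = P.trans (P.cong suc (P.trans (dbl≡2* (suc (dbl n)))
    (P.cong (λ k → 2 ℕ.* suc k) (dbl≡2* n))))
    (S.solve 1 (λ n → S.con 1 S.:+ S.con 2 S.:* (S.con 1 S.:+ S.con 2 S.:* n)
      S.:= S.con 4 S.:* n S.:+ S.con 3) P.refl n)
    where module S = ℕ-Solver.+-*-Solver

  pos₇≡ : ∀ n → pos₇ n ≡ 8 ℕ.* n ℕ.+ 7
  pos₇≡ n = P.trans (P.cong suc (P.trans (dbl≡2* (pos₃ n)) (P.cong (2 ℕ.*_) (pos₃≡ n))))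
    (S.solve 1 (λ n → S.con 1 S.:+ S.con 2 S.:* (S.con 4 S.:* n S.:+ S.con 3)
      S.:= S.con 8 S.:* n S.:+ S.con 7) P.refl n)
    where module S = ℕ-Solver.+-*-Solver

  pos₂≡ : ∀ n → pos₂ n ≡ 2 ℕ.* (2 ℕ.* n ℕ.+ 1)
  pos₂≡ n = P.trans (dbl≡2* (suc (dbl n)))
    (P.cong (2 ℕ.*_) (P.trans (P.cong suc (dbl≡2* n)) (ℕₚ.+-comm 1 (2 ℕ.* n))))

  pos₅≡ : ∀ n → pos₅ n ≡ 8 ℕ.* n ℕ.+ 5
  pos₅≡ n = P.trans (P.cong suc (P.trans (dbl≡2* (pos₂ n)) (P.cong (2 ℕ.*_) (pos₂≡ n))))
    (S.solve 1 (λ n → S.con 1 S.:+ S.con 2 S.:* (S.con 2 S.:* (S.con 2 S.:* n S.:+ S.con 1))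
      S.:= S.con 8 S.:* n S.:+ S.con 5) P.refl n)
    where module S = ℕ-Solver.+-*-Solver

  odd-part : ∀ n α → + (2 ℕ.^ (3 ℕ.* α)) ∣ v₀ (2 ℕ.^ (2 ℕ.* α ℕ.+ 1) ℕ.* (2 ℕ.* n ℕ.+ 1))
  odd-part n zero    = ℕ∣.1∣ _
  -- 2^(2α+3) (2n+1) = 4 · 4^α (4n+2), so the class 2 modulo 4 at level α applies, and 8^α · 8 is
  -- the modulus for α + 1.
  odd-part n (suc α) = let g , good , p = UU^W≈ α in P.subst₂ (λ a b → + (2 ℕ.^ a) ∣ v₀ b)
    (P.trans (ℕₚ.+-comm (3 ℕ.* α) 3) (P.sym (ℕₚ.*-suc 3 α)))
    (P.trans (P.cong (2 ℕ.^ (2 ℕ.* α ℕ.+ 2) ℕ.*_) (pos₂≡ n))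
      (P.trans (P.sym (ℕₚ.*-assoc (2 ℕ.^ (2 ℕ.* α ℕ.+ 2)) 2 (2 ℕ.* n ℕ.+ 1)))
        (P.cong (ℕ._* (2 ℕ.* n ℕ.+ 1)) (P.trans (ℕₚ.*-comm (2 ℕ.^ (2 ℕ.* α ℕ.+ 2)) 2)
          (P.cong (2 ℕ.^_) (S.solve 1 (λ a → S.con 1 S.:+ (S.con 2 S.:* a S.:+ S.con 2)
            S.:= S.con 2 S.:* (S.con 1 S.:+ a) S.:+ S.con 1) P.refl α))))))
    (v₀-divisible α 3 _ p (zero₂ vanishing-φ n) (at₂ good n))
    where module S = ℕ-Solver.+-*-Solver

open ThetaSeries using (UU^W≈; Good; Vanishing; vanishing-φ; odd-part; v₀-divisible; pos₃≡; pos₅≡;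
  pos₇≡)
open import Data.Nat using (ℕ; _+_; _*_; _^_)

theorem1p2 : (n α : ℕ) →
    (+ (2 ^ (3 * α)) ∣ v₀ (2 ^ (2 * α + 1) * (2 * n + 1))) ×
    (+ (2 ^ (3 * α + 4)) ∣ v₀ (2 ^ (2 * α + 2) * (4 * n + 3))) ×
    (+ (2 ^ (3 * α + 6)) ∣ v₀ (2 ^ (2 * α + 2) * (8 * n + 7))) ×
    (+ (2 ^ (3 * α + 6)) ∣ v₀ (2 ^ (2 * α + 2) * (8 * n + 5)))
theorem1p2 n α =
  let g , good , p = UU^W≈ α
      at-index : ∀ {k m m′} → m ≡ m′ →
                 + (2 ^ k) ∣ v₀ (2 ^ (2 * α + 2) * m) → + (2 ^ k) ∣ v₀ (2 ^ (2 * α + 2) * m′)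
      at-index {k} = P.subst (λ m → + (2 ^ k) ∣ v₀ (2 ^ (2 * α + 2) * m))
  in  odd-part n α
    , at-index {3 * α + 4} (pos₃≡ n)
      (v₀-divisible α 4 _ p (Vanishing.zero₃ vanishing-φ n) (Good.at₃ good n))
    , at-index {3 * α + 6} (pos₇≡ n)
      (v₀-divisible α 6 _ p (Vanishing.zero₇ vanishing-φ n) (Good.at₇ good n))
    , at-index {3 * α + 6} (pos₅≡ n)
      (v₀-divisible α 6 _ p (Vanishing.zero₅ vanishing-φ n) (Good.at₅ good n))
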